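{- Let $\delta>0$ and let $\{a_n\}_{n=1}^\infty$ be a sequence of complex numbers satisfying $a_n\ll n^{1-\delta}$. Let $f(s)=\sum_{n=1}^\infty a_n n^{ -s}$. Let $a$ and $b$ be positive integers, and for each positive integer $n$ let $H_n^{(a,b)}[f]=\det_{1\le i,j\le n}\bigl(f(a(i+j)+b)\bigr)$. Then, as $n\to\infty$, $$\log |H_n^{(a,b)}[f]|\le -\frac a2 n^2\log n+O\big(n^2\big).$$
   Context: The condition $a_n\ll n^{1-\delta}$ means that there is a constant $C>0$ with $|a_n|\le C n^{1-\delta}$ for all $n\ge1$. The Dirichlet series $f(s)$ then converges absolutely for $\operatorname{Re}(s)>2-\delta$, so $f(m)$ is defined for every integer $m\ge2$. The integer $a$ is unrelated to the coefficients $a_n$. The conclusion means that there are constants $K$ and $N$ (possibly depending on the sequence $\{a_n\}$, $\delta$, $a$ and $b$) such that $\log|H_n^{(a,b)}[f]|\le-\frac a2 n^2\log n+Kn^2$ for all $n\ge N$, with the convention $\log 0=-\infty$ (i.e. the inequality holds trivially when $H_n^{(a,b)}[f]=0$). -}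

module Defs where

open import Data.Fin.Base using (Fin; zero; suc; toℕ; punchIn)
open import Data.Integer.Base as ℤ using (-[1+_])
import Data.Integer.Properties as ℤ
open import Data.Nat.Base as ℕ using (ℕ; zero; suc)
import Data.Nat.Properties as ℕ
open import Data.Product.Base using (∃; _×_; _,_; proj₁; proj₂)
open import Data.Rational.Base
open import Data.Rational.Properties
open import Data.Rational.Unnormalised.Base as ℚᵘ using (mkℚᵘ)
import Data.Rational.Unnormalised.Properties as ℚᵘ
open import Data.Rational.Solver using (module +-*-Solver)
open import Data.Empty using (⊥)
open import Data.Sum.Base using (_⊎_; inj₁; inj₂; [_,_]′)
open import Relation.Binary.PropositionalEquality
  using (_≡_; refl; sym; trans; cong; cong₂; subst; subst₂)
open import Algebra.Bundles using (CommutativeRing)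
open import Algebra.Properties.CommutativeSemiring.Exp
  (CommutativeRing.commutativeSemiring +-*-commutativeRing)
  using (_^_; ^-homo-*; ^-distrib-*)
open +-*-Solver using (solve; _:+_; _:*_; _:-_; :-_; con; _:=_)

⅓ ⅔ 2ℚ : ℚ
⅓  = ℤ.+ 1 / 3
⅔  = ℤ.+ 2 / 3
2ℚ = ℤ.+ 2 / 1

0<1 : 0ℚ < 1ℚ
0<1 = positive⁻¹ 1ℚ

0<½ : 0ℚ < ½
0<½ = positive⁻¹ ½

0≤+ : ∀ {p q} → 0ℚ ≤ p → 0ℚ ≤ q → 0ℚ ≤ p + q
0≤+ = +-mono-≤

0<+ : ∀ {p q} → 0ℚ < p → 0ℚ ≤ q → 0ℚ < p + q
0<+ = +-mono-<-≤

0≤* : ∀ {p q} → 0ℚ ≤ p → 0ℚ ≤ q → 0ℚ ≤ p * q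
0≤* {p} {q} 0≤p 0≤q = nonNegative⁻¹ (p * q)
  {{nonNeg*nonNeg⇒nonNeg p {{nonNegative 0≤p}} q {{nonNegative 0≤q}}}}

0<* : ∀ {p q} → 0ℚ < p → 0ℚ < q → 0ℚ < p * q
0<* {p} {q} 0<p 0<q = positive⁻¹ (p * q)
  {{pos*pos⇒pos p {{positive 0<p}} q {{positive 0<q}}}}

0≤² : ∀ p → 0ℚ ≤ p * p
0≤² p with ≤-total 0ℚ p
... | inj₁ 0≤p = 0≤* 0≤p 0≤p
... | inj₂ p≤0 = subst (0ℚ ≤_) (solve 1 (λ p → (:- p) :* (:- p) := p :* p) refl p)
                   (0≤* (neg-antimono-≤ p≤0) (neg-antimono-≤ p≤0))

≤-from : ∀ {p q} d → 0ℚ ≤ d → p + d ≡ q → p ≤ q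
≤-from {p} d 0≤d refl = subst (_≤ p + d) (+-identityʳ p) (+-monoʳ-≤ p 0≤d)

<-from : ∀ {p q} d → 0ℚ < d → p + d ≡ q → p < q
<-from {p} d 0<d refl = subst (_< p + d) (+-identityʳ p) (+-monoʳ-< p 0<d)

gap : ∀ {p q} → p ≤ q → 0ℚ ≤ q - p
gap {p} {q} p≤q = subst (_≤ q - p) (+-inverseʳ p) (+-monoˡ-≤ (- p) p≤q)

gap< : ∀ {p q} → p < q → 0ℚ < q - p
gap< {p} {q} p<q = subst (_< q - p) (+-inverseʳ p) (+-monoˡ-< (- p) p<q)

*-monoʳ : ∀ {p q} r → 0ℚ ≤ r → p ≤ q → p * r ≤ q * r
*-monoʳ r 0≤r = *-monoʳ-≤-nonNeg r {{nonNegative 0≤r}}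

*-monoˡ : ∀ {p q} r → 0ℚ ≤ r → p ≤ q → r * p ≤ r * q
*-monoˡ r 0≤r = *-monoˡ-≤-nonNeg r {{nonNegative 0≤r}}

*-mono : ∀ {p p′ q q′} → 0ℚ ≤ p′ → 0ℚ ≤ q → p ≤ p′ → q ≤ q′ → p * q ≤ p′ * q′
*-mono {p′ = p′} {q} 0≤p′ 0≤q p≤p′ q≤q′ =
  ≤-trans (*-monoʳ q 0≤q p≤p′) (*-monoˡ p′ 0≤p′ q≤q′)

p≤∣p∣ : ∀ p → p ≤ ∣ p ∣
p≤∣p∣ p with ≤-total 0ℚ p
... | inj₁ 0≤p = ≤-reflexive (sym (0≤p⇒∣p∣≡p 0≤p))
... | inj₂ p≤0 = ≤-trans p≤0 (0≤∣p∣ p)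

abs-range : ∀ {p B} → ∣ p ∣ ≤ B → - B ≤ p × p ≤ B
abs-range {p} {B} h =
  subst (- B ≤_) (neg-involutive p)
    (neg-antimono-≤ (≤-trans (p≤∣p∣ (- p)) (subst (_≤ B) (sym (∣-p∣≡∣p∣ p)) h))) ,
  ≤-trans (p≤∣p∣ p) h
  where
  neg-involutive : ∀ p → - - p ≡ p
  neg-involutive = solve 1 (λ p → :- (:- p) := p) refl

abs-lower : ∀ {p q ε} → ∣ p - q ∣ ≤ ε → p ≤ q + ε
abs-lower {p} {q} {ε} h = ≤-from (ε - (p - q)) (gap (≤-trans (p≤∣p∣ (p - q)) h))
  (solve 3 (λ p q ε → p :+ (ε :- (p :- q)) := q :+ ε) refl p q ε)

abs-swap : ∀ p q → ∣ p - q ∣ ≡ ∣ q - p ∣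
abs-swap p q = trans (sym (∣-p∣≡∣p∣ (p - q)))
  (cong ∣_∣ (solve 2 (λ p q → :- (p :- q) := q :- p) refl p q))

abs-upper : ∀ {p q ε} → ∣ p - q ∣ ≤ ε → q ≤ p + ε
abs-upper {p} {q} {ε} h = abs-lower (subst (_≤ ε) (abs-swap p q) h)

abs-intro : ∀ {p q ε} → p ≤ q + ε → q ≤ p + ε → ∣ p - q ∣ ≤ ε
abs-intro {p} {q} {ε} h k with ∣p∣≡p∨∣p∣≡-p (p - q)
... | inj₁ e = subst (_≤ ε) (sym e) (≤-from ((q + ε) - p) (gap h)
  (solve 3 (λ p q ε → (p :- q) :+ ((q :+ ε) :- p) := ε) refl p q ε))
... | inj₂ e = subst (_≤ ε) (sym e) (≤-from ((p + ε) - q) (gap k)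
  (solve 3 (λ p q ε → (:- (p :- q)) :+ ((p :+ ε) :- q) := ε) refl p q ε))

quotient : ∀ ε B → 0ℚ < ε → 0ℚ < B → ∃ λ η → 0ℚ < η × η * B ≡ ε
quotient ε B 0<ε 0<B = ε * B⁻¹ , 0<* 0<ε 0<B⁻¹ , η*B≡ε
  where
  instance
    B⁺ : Positive B
    B⁺ = positive 0<B
    B≢0 : NonZero B
    B≢0 = pos⇒nonZero B
  B⁻¹ = 1/ B
  0<B⁻¹ : 0ℚ < B⁻¹
  0<B⁻¹ = positive⁻¹ B⁻¹ {{1/pos⇒pos B}}
  η*B≡ε : ε * B⁻¹ * B ≡ ε
  η*B≡ε = trans (*-assoc ε B⁻¹ B)
    (trans (cong (ε *_) (*-inverseˡ B)) (*-identityʳ ε))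

0≤^ : ∀ {p} n → 0ℚ ≤ p → 0ℚ ≤ p ^ n
0≤^ zero    _   = <⇒≤ 0<1
0≤^ (suc n) 0≤p = 0≤* 0≤p (0≤^ n 0≤p)

0<^ : ∀ {p} n → 0ℚ < p → 0ℚ < p ^ n
0<^ zero    _   = 0<1
0<^ (suc n) 0<p = 0<* 0<p (0<^ n 0<p)

^-mono : ∀ {p q} n → 0ℚ ≤ p → p ≤ q → p ^ n ≤ q ^ n
^-mono zero    _   _   = ≤-refl
^-mono (suc n) 0≤p p≤q =
  *-mono (≤-trans 0≤p p≤q) (0≤^ n 0≤p) p≤q (^-mono n 0≤p p≤q)

^-≤1 : ∀ {p} n → 0ℚ ≤ p → p ≤ 1ℚ → p ^ n ≤ 1ℚ
^-≤1 zero    _   _   = ≤-refl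
^-≤1 (suc n) 0≤p p≤1 = *-mono (<⇒≤ 0<1) (0≤^ n 0≤p) p≤1 (^-≤1 n 0≤p p≤1)

^-anti : ∀ {p m n} → 0ℚ ≤ p → p ≤ 1ℚ → m ℕ.≤ n → p ^ n ≤ p ^ m
^-anti {n = n} 0≤p p≤1 ℕ.z≤n       = ^-≤1 n 0≤p p≤1
^-anti         0≤p p≤1 (ℕ.s≤s m≤n) = *-monoˡ _ 0≤p (^-anti 0≤p p≤1 m≤n)

ι : ℕ → ℚ
ι zero    = 0ℚ
ι (suc n) = 1ℚ + ι n

0≤ι : ∀ n → 0ℚ ≤ ι n
0≤ι zero    = ≤-refl
0≤ι (suc n) = 0≤+ (<⇒≤ 0<1) (0≤ι n)

ι≡/1 : ∀ n → ι n ≡ ℤ.+ n / 1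
ι≡/1 zero    = refl
ι≡/1 (suc n) = trans (cong (_+_ 1ℚ) (ι≡/1 n)) (toℚᵘ-injective
  (ℚᵘ.≃-trans (toℚᵘ-homo-+ 1ℚ (ℤ.+ n / 1))
  (ℚᵘ.≃-trans (ℚᵘ.+-congʳ (toℚᵘ 1ℚ) (toℚᵘ-fromℚᵘ (mkℚᵘ (ℤ.+ n) 0)))
  (ℚᵘ.≃-trans (ℚᵘ.*≡* (cong (ℤ._* ℤ.+ 1) (cong (ℤ._+_ (ℤ.+ 1)) (ℤ.*-identityʳ (ℤ.+ n)))))
  (ℚᵘ.≃-sym (toℚᵘ-fromℚᵘ (mkℚᵘ (ℤ.+ suc n) 0)))))))

archimedean : ∀ q → ∃ λ n → q ≤ ι n
archimedean q@(mkℚ i d _) = ℤ.∣ i ∣ , subst (q ≤_) (sym (ι≡/1 ℤ.∣ i ∣))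
  (toℚᵘ-cancel-≤ (ℚᵘ.≤-respʳ-≃ (ℚᵘ.≃-sym (toℚᵘ-fromℚᵘ (mkℚᵘ (ℤ.+ ℤ.∣ i ∣) 0)))
    (ℚᵘ.*≤* (bound i))))
  where
  bound : ∀ i → i ℤ.* ℤ.+ 1 ℤ.≤ ℤ.+ ℤ.∣ i ∣ ℤ.* ℤ.+ suc d
  bound i = subst₂ ℤ._≤_ (sym (ℤ.*-identityʳ i)) (ℤ.pos-* ℤ.∣ i ∣ (suc d))
    (ℤ.≤-trans (i≤∣i∣ i) (ℤ.+≤+ (ℕ.m≤m*n ℤ.∣ i ∣ (suc d))))
    where
    i≤∣i∣ : ∀ i → i ℤ.≤ ℤ.+ ℤ.∣ i ∣
    i≤∣i∣ (ℤ.+ n)       = ℤ.≤-refl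
    i≤∣i∣ (-[1+ n ]) = ℤ.-≤+

0≤⅔ : 0ℚ ≤ ⅔
0≤⅔ = nonNegative⁻¹ ⅔

⅔≤1 : ⅔ ≤ 1ℚ
⅔≤1 = <⇒≤ (<-from ⅓ (positive⁻¹ ⅓) refl)

⅔^-decay : ∀ n → (2ℚ + ι n) * ⅔ ^ n ≤ 2ℚ
⅔^-decay zero    = ≤-refl
⅔^-decay (suc n) = ≤-trans
  (≤-from (⅓ * ι n * ⅔ ^ n)
    (0≤* (0≤* (nonNegative⁻¹ ⅓) (0≤ι n)) (0≤^ n 0≤⅔))
    (solve 2 (λ n p → (con 2ℚ :+ (con 1ℚ :+ n)) :* (con ⅔ :* p) :+ con ⅓ :* n :* p
                   := (con 2ℚ :+ n) :* p) refl (ι n) (⅔ ^ n)))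
  (⅔^-decay n)

shrink : ∀ T ε → 0ℚ < ε → ∃ λ K → ∀ k → K ℕ.≤ k → T * ⅔ ^ k ≤ ε
shrink T ε 0<ε = n , decay
  where
  open ≤-Reasoning
  η = proj₁ (quotient 1ℚ ε 0<1 0<ε)
  ηε≡1 : η * ε ≡ 1ℚ
  ηε≡1 = proj₂ (proj₂ (quotient 1ℚ ε 0<1 0<ε))
  n = proj₁ (archimedean (2ℚ * (T * η)))
  h : 2ℚ * (T * η) ≤ ι n
  h = proj₂ (archimedean (2ℚ * (T * η)))

  eq : ∀ T η ε p → T * p * (η * ε) ≡ ½ * (2ℚ * (T * η) * p * ε)
  eq = solve 4 (λ T η ε p → T :* p :* (η :* ε)
                         := con ½ :* (con 2ℚ :* (T :* η) :* p :* ε)) refl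

  eq′ : ∀ ε → ½ * (2ℚ * ε) ≡ ε
  eq′ = solve 1 (λ ε → con ½ :* (con 2ℚ :* ε) := ε) refl

  ιn≤ : ι n ≤ 2ℚ + ι n
  ιn≤ = ≤-from {ι n} 2ℚ (nonNegative⁻¹ 2ℚ) (+-comm (ι n) 2ℚ)

  bound : ∀ k → n ℕ.≤ k → 2ℚ * (T * η) * ⅔ ^ k ≤ 2ℚ
  bound k n≤k = begin
    2ℚ * (T * η) * ⅔ ^ k   ≤⟨ *-monoʳ (⅔ ^ k) (0≤^ k 0≤⅔) h ⟩
    ι n * ⅔ ^ k            ≤⟨ *-monoˡ (ι n) (0≤ι n) (^-anti 0≤⅔ ⅔≤1 n≤k) ⟩
    ι n * ⅔ ^ n            ≤⟨ *-monoʳ (⅔ ^ n) (0≤^ n 0≤⅔) ιn≤ ⟩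
    (2ℚ + ι n) * ⅔ ^ n     ≤⟨ ⅔^-decay n ⟩
    2ℚ                     ∎

  decay : ∀ k → n ℕ.≤ k → T * ⅔ ^ k ≤ ε
  decay k n≤k = begin
    T * ⅔ ^ k                          ≡⟨ *-identityʳ (T * ⅔ ^ k) ⟨
    T * ⅔ ^ k * 1ℚ                     ≡⟨ cong (T * ⅔ ^ k *_) ηε≡1 ⟨
    T * ⅔ ^ k * (η * ε)                ≡⟨ eq T η ε (⅔ ^ k) ⟩
    ½ * (2ℚ * (T * η) * ⅔ ^ k * ε)     ≤⟨ *-monoˡ ½ (<⇒≤ 0<½) (*-monoʳ ε (<⇒≤ 0<ε) (bound k n≤k)) ⟩
    ½ * (2ℚ * ε)                       ≡⟨ eq′ ε ⟩
    ε                                  ∎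

½≤⅔ : ½ ≤ ⅔
½≤⅔ = <⇒≤ (<-from (ℤ.+ 1 / 6) (positive⁻¹ (ℤ.+ 1 / 6)) refl)

shrink½ : ∀ T ε → 0ℚ ≤ T → 0ℚ < ε → ∃ λ K → ∀ k → K ℕ.≤ k → T * ½ ^ k ≤ ε
shrink½ T ε 0≤T 0<ε = proj₁ (shrink T ε 0<ε) , λ k K≤k →
  ≤-trans (*-monoˡ T 0≤T (^-mono k (<⇒≤ 0<½) ½≤⅔)) (proj₂ (shrink T ε 0<ε) k K≤k)

-- Cauchy sequences of rationals, compared up to null sequences.  The
-- ring operations are pointwise.

Eventually : (ℕ → Set) → Set
Eventually P = ∃ λ N → ∀ n → N ℕ.≤ n → P n

ev-map₂ : {P Q R : ℕ → Set} → (∀ {n} → P n → Q n → R n) →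
          Eventually P → Eventually Q → Eventually R
ev-map₂ f (M , p) (N , q) = M ℕ.⊔ N , λ n h →
  f (p n (ℕ.≤-trans (ℕ.m≤m⊔n M N) h)) (q n (ℕ.≤-trans (ℕ.m≤n⊔m M N) h))

IsCauchy : (ℕ → ℚ) → Set
IsCauchy x = ∀ ε → 0ℚ < ε →
  ∃ λ N → ∀ m n → N ℕ.≤ m → N ℕ.≤ n → ∣ x m - x n ∣ ≤ ε

record ℝ : Set where
  constructor mkℝ
  field
    seq    : ℕ → ℚ
    cauchy : IsCauchy seq

open ℝ public

infix 4 _≃ʳ_ _≤ʳ_ _<ʳ_

_≃ʳ_ _≤ʳ_ _<ʳ_ : ℝ → ℝ → Set
x ≃ʳ y = ∀ ε → 0ℚ < ε → Eventually λ n → ∣ seq x n - seq y n ∣ ≤ ε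
x ≤ʳ y = ∀ ε → 0ℚ < ε → Eventually λ n → seq x n ≤ seq y n + ε
x <ʳ y = ∃ λ ε → 0ℚ < ε × Eventually λ n → seq x n + ε ≤ seq y n

-- By the symmetry in m and n a one-sided estimate is enough.
cauchy-intro : ∀ x → (∀ ε → 0ℚ < ε →
    ∃ λ N → ∀ m n → N ℕ.≤ m → N ℕ.≤ n → x m ≤ x n + ε) → IsCauchy x
cauchy-intro x h ε 0<ε with h ε 0<ε
... | N , b = N , λ m n N≤m N≤n → abs-intro (b m n N≤m N≤n) (b n m N≤n N≤m)

fromℚ : ℚ → ℝ
fromℚ q = mkℝ (λ _ → q)
  (cauchy-intro (λ _ → q) λ ε 0<ε → 0 , λ _ _ _ _ → ≤-from {q} ε (<⇒≤ 0<ε) refl)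

fromℕ : ℕ → ℝ
fromℕ n = fromℚ (ℤ.+ n / 1)

0ʳ 1ʳ : ℝ
0ʳ = fromℚ 0ℚ
1ʳ = fromℚ 1ℚ

half : ∀ ε → 0ℚ < ε → 0ℚ < ½ * ε
half ε = 0<* 0<½

infixl 6 _+ʳ_ _-ʳ_
infixl 7 _*ʳ_
infix  8 -ʳ_

_+ʳ_ : ℝ → ℝ → ℝ
x +ʳ y = mkℝ (λ n → seq x n + seq y n) (cauchy-intro (λ n → seq x n + seq y n) λ ε 0<ε →
  let M , p = cauchy x (½ * ε) (half ε 0<ε)
      N , q = cauchy y (½ * ε) (half ε 0<ε)
  in M ℕ.⊔ N , λ m n hm hn → subst (seq x m + seq y m ≤_)
       (solve 3 (λ a b ε → (a :+ con ½ :* ε) :+ (b :+ con ½ :* ε) := (a :+ b) :+ ε)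
          refl (seq x n) (seq y n) ε)
       (+-mono-≤
         (abs-lower {seq x m} {seq x n} (p m n (ℕ.m⊔n≤o⇒m≤o M N hm) (ℕ.m⊔n≤o⇒m≤o M N hn)))
         (abs-lower {seq y m} {seq y n} (q m n (ℕ.m⊔n≤o⇒n≤o M N hm) (ℕ.m⊔n≤o⇒n≤o M N hn)))))

-ʳ_ : ℝ → ℝ
-ʳ x = mkℝ (λ n → - seq x n) (cauchy-intro (λ n → - seq x n) λ ε 0<ε →
  let N , p = cauchy x ε 0<ε
  in N , λ m n hm hn →
       ≤-from (seq x m + ε - seq x n) (gap (abs-lower {seq x n} {seq x m} (p n m hn hm)))
         (solve 3 (λ a b ε → (:- a) :+ ((a :+ ε) :- b) := (:- b) :+ ε)
            refl (seq x m) (seq x n) ε))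

_-ʳ_ : ℝ → ℝ → ℝ
x -ʳ y = x +ʳ (-ʳ y)

bounded : ∀ x → ∃ λ B → 1ℚ ≤ B × Eventually λ n → ∣ seq x n ∣ ≤ B
bounded x with cauchy x 1ℚ 0<1
... | N , p = ∣ seq x N ∣ + 1ℚ
            , ≤-from ∣ seq x N ∣ (0≤∣p∣ (seq x N)) (+-comm 1ℚ ∣ seq x N ∣)
            , N , λ n N≤n → ≤-trans
                (subst (λ y → ∣ y ∣ ≤ ∣ seq x N ∣ + ∣ seq x n - seq x N ∣)
                  (solve 2 (λ a b → a :+ (b :- a) := b) refl (seq x N) (seq x n))
                  (∣p+q∣≤∣p∣+∣q∣ (seq x N) (seq x n - seq x N)))
                (+-monoʳ-≤ ∣ seq x N ∣ (p n N N≤n ℕ.≤-refl))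

_*ʳ_ : ℝ → ℝ → ℝ
x *ʳ y = mkℝ (λ n → seq x n * seq y n) λ ε 0<ε →
  let A , 1≤A , K , p = bounded x
      B , 1≤B , L , q = bounded y
      0<A = <-≤-trans 0<1 1≤A
      0≤B = ≤-trans (<⇒≤ 0<1) 1≤B
      η , 0<η , ηAB≡ε = quotient ε (A + B) 0<ε (0<+ 0<A 0≤B)
      M , r = cauchy x η 0<η
      N , s = cauchy y η 0<η
      open ≤-Reasoning
  in K ℕ.⊔ L ℕ.⊔ (M ℕ.⊔ N) , λ m n hm hn →
    let hm₁ = ℕ.m⊔n≤o⇒m≤o (K ℕ.⊔ L) (M ℕ.⊔ N) hm
        hn₁ = ℕ.m⊔n≤o⇒m≤o (K ℕ.⊔ L) (M ℕ.⊔ N) hn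
        hm₂ = ℕ.m⊔n≤o⇒n≤o (K ℕ.⊔ L) (M ℕ.⊔ N) hm
        hn₂ = ℕ.m⊔n≤o⇒n≤o (K ℕ.⊔ L) (M ℕ.⊔ N) hn
        a = seq x m ; a′ = seq x n ; b = seq y m ; b′ = seq y n
    in begin
      ∣ a * b - a′ * b′ ∣
        ≡⟨ cong ∣_∣ (solve 4 (λ a b a′ b′ → a :* b :- a′ :* b′
                        := a :* (b :- b′) :+ (a :- a′) :* b′) refl a b a′ b′) ⟩
      ∣ a * (b - b′) + (a - a′) * b′ ∣
        ≤⟨ ∣p+q∣≤∣p∣+∣q∣ (a * (b - b′)) ((a - a′) * b′) ⟩
      ∣ a * (b - b′) ∣ + ∣ (a - a′) * b′ ∣
        ≡⟨ cong₂ _+_ (∣p*q∣≡∣p∣*∣q∣ a (b - b′)) (∣p*q∣≡∣p∣*∣q∣ (a - a′) b′) ⟩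
      ∣ a ∣ * ∣ b - b′ ∣ + ∣ a - a′ ∣ * ∣ b′ ∣
        ≤⟨ +-mono-≤
             (*-mono (<⇒≤ 0<A) (0≤∣p∣ (b - b′)) (p m (ℕ.m⊔n≤o⇒m≤o K L hm₁))
                (s m n (ℕ.m⊔n≤o⇒n≤o M N hm₂) (ℕ.m⊔n≤o⇒n≤o M N hn₂)))
             (*-mono (<⇒≤ 0<η) (0≤∣p∣ b′)
                (r m n (ℕ.m⊔n≤o⇒m≤o M N hm₂) (ℕ.m⊔n≤o⇒m≤o M N hn₂))
                (q n (ℕ.m⊔n≤o⇒n≤o K L hn₁))) ⟩
      A * η + η * B
        ≡⟨ trans (solve 3 (λ A B η → A :* η :+ η :* B := η :* (A :+ B)) refl A B η) ηAB≡ε ⟩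
      ε ∎

-- expApprox k p = (1 + p/2ᵏ)^2ᵏ.  Restricting the usual limit
-- lim (1 + p/n)ⁿ to n = 2ᵏ makes the approximations increase in k by
-- plain squaring.

base expApprox : ℕ → ℚ → ℚ
base k p = 1ℚ + p * ½ ^ k
expApprox k p = base k p ^ (2 ℕ.^ k)

^-double : ∀ p k → p ^ (2 ℕ.^ suc k) ≡ p ^ (2 ℕ.^ k) * p ^ (2 ℕ.^ k)
^-double p k = trans (cong (λ n → p ^ (2 ℕ.^ k ℕ.+ n)) (ℕ.+-identityʳ (2 ℕ.^ k)))
                     (^-homo-* p (2 ℕ.^ k) (2 ℕ.^ k))

0≤½^ : ∀ k → 0ℚ ≤ ½ ^ k
0≤½^ k = 0≤^ k (<⇒≤ 0<½)

2^½^ : ∀ k → 2ℚ ^ k * ½ ^ k ≡ 1ℚ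
2^½^ k = trans (sym (^-distrib-* 2ℚ ½ k)) (one k)
  where
  one : ∀ k → (2ℚ * ½) ^ k ≡ 1ℚ
  one zero    = refl
  one (suc k) = trans (cong ((2ℚ * ½) *_) (one k)) refl

0≤base-suc : ∀ k p → 0ℚ ≤ base k p → 0ℚ ≤ base (suc k) p
0≤base-suc k p h = subst (0ℚ ≤_)
  (solve 2 (λ p t → con ½ :+ con ½ :* (con 1ℚ :+ p :* t) := con 1ℚ :+ p :* (con ½ :* t))
    refl p (½ ^ k))
  (0≤+ (<⇒≤ 0<½) (0≤* (<⇒≤ 0<½) h))

0≤base-+ : ∀ k p d → 0ℚ ≤ base k p → 0ℚ ≤ base (d ℕ.+ k) p
0≤base-+ k p zero    h = h
0≤base-+ k p (suc d) h = 0≤base-suc (d ℕ.+ k) p (0≤base-+ k p d h)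

expApprox-suc : ∀ k p → 0ℚ ≤ base k p → expApprox k p ≤ expApprox (suc k) p
expApprox-suc k p h = begin
  base k p ^ n                            ≤⟨ ^-mono n h square ⟩
  (base (suc k) p * base (suc k) p) ^ n   ≡⟨ ^-distrib-* (base (suc k) p) (base (suc k) p) n ⟩
  base (suc k) p ^ n * base (suc k) p ^ n ≡⟨ ^-double (base (suc k) p) k ⟨
  expApprox (suc k) p                     ∎
  where
  open ≤-Reasoning
  n = 2 ℕ.^ k
  square : base k p ≤ base (suc k) p * base (suc k) p
  square = ≤-from (p * ½ ^ suc k * (p * ½ ^ suc k)) (0≤² (p * ½ ^ suc k))
    (solve 2 (λ p t → (con 1ℚ :+ p :* t) :+ p :* (con ½ :* t) :* (p :* (con ½ :* t))
                   := (con 1ℚ :+ p :* (con ½ :* t)) :* (con 1ℚ :+ p :* (con ½ :* t)))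
      refl p (½ ^ k))

expApprox-+ : ∀ k p d → 0ℚ ≤ base k p → expApprox k p ≤ expApprox (d ℕ.+ k) p
expApprox-+ k p zero    h = ≤-refl
expApprox-+ k p (suc d) h = ≤-trans (expApprox-+ k p d h)
  (expApprox-suc (d ℕ.+ k) p (0≤base-+ k p d h))

expApprox-≤ : ∀ {k m} p → k ℕ.≤ m → 0ℚ ≤ base k p → expApprox k p ≤ expApprox m p
expApprox-≤ {k} {m} p k≤m h =
  subst (λ i → expApprox k p ≤ expApprox i p) (ℕ.m∸n+n≡m k≤m) (expApprox-+ k p (m ℕ.∸ k) h)

1+p≤expApprox : ∀ k p → 0ℚ ≤ 1ℚ + p → 1ℚ + p ≤ expApprox k p
1+p≤expApprox k p h = subst (_≤ expApprox k p) (eq₂ p)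
  (expApprox-≤ {0} {k} p ℕ.z≤n (subst (0ℚ ≤_) (sym (eq₁ p)) h))
  where
  eq₁ : ∀ p → base 0 p ≡ 1ℚ + p
  eq₁ = solve 1 (λ p → con 1ℚ :+ p :* con 1ℚ := con 1ℚ :+ p) refl
  eq₂ : ∀ p → expApprox 0 p ≡ 1ℚ + p
  eq₂ p = trans (*-identityʳ (base 0 p)) (eq₁ p)

expApprox-neg : ∀ k p →
  expApprox k p * expApprox k (- p) ≡ expApprox k (- (p * p * ½ ^ k))
expApprox-neg k p = trans (sym (^-distrib-* (base k p) (base k (- p)) (2 ℕ.^ k)))
  (cong (_^ (2 ℕ.^ k))
    (solve 2 (λ p t → (con 1ℚ :+ p :* t) :* (con 1ℚ :+ (:- p) :* t)
                   := con 1ℚ :+ (:- (p :* p :* t)) :* t) refl p (½ ^ k)))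

expApprox-neg≤1 : ∀ k p → 0ℚ ≤ base k p → 0ℚ ≤ base k (- p) →
  expApprox k p * expApprox k (- p) ≤ 1ℚ
expApprox-neg≤1 k p h h′ = subst (_≤ 1ℚ) (^-distrib-* (base k p) (base k (- p)) (2 ℕ.^ k))
  (^-≤1 (2 ℕ.^ k) (0≤* h h′)
    (≤-from (p * ½ ^ k * (p * ½ ^ k)) (0≤² (p * ½ ^ k))
      (solve 2 (λ p t → (con 1ℚ :+ p :* t) :* (con 1ℚ :+ (:- p) :* t) :+ p :* t :* (p :* t)
                     := con 1ℚ) refl p (½ ^ k))))

-- Mean value estimate for v ↦ v^2ᵏ on [0, w].
^-lipschitz : ∀ k {u v w} → 0ℚ ≤ v → v ≤ u → u ≤ w → 1ℚ ≤ w →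
  u ^ (2 ℕ.^ k) ≤ v ^ (2 ℕ.^ k) + 2ℚ ^ k * (u - v) * w ^ (2 ℕ.^ k)
^-lipschitz zero {u} {v} {w} 0≤v v≤u u≤w 1≤w =
  ≤-from ((u - v) * (w - 1ℚ)) (0≤* (gap v≤u) (gap 1≤w))
    (solve 3 (λ u v w → u :* con 1ℚ :+ (u :- v) :* (w :- con 1ℚ)
                     := v :* con 1ℚ :+ con 1ℚ :* (u :- v) :* (w :* con 1ℚ)) refl u v w)
^-lipschitz (suc k) {u} {v} {w} 0≤v v≤u u≤w 1≤w = begin
  u ^ (2 ℕ.^ suc k)               ≡⟨ ^-double u k ⟩
  U * U                           ≤⟨ core ⟩
  V * V + 2ℚ * t * d * (W * W)    ≡⟨ cong₂ (λ a b → a + 2ℚ * t * d * b) (^-double v k) (^-double w k) ⟨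
  v ^ (2 ℕ.^ suc k) + 2ℚ ^ suc k * (u - v) * w ^ (2 ℕ.^ suc k) ∎
  where
  open ≤-Reasoning
  n = 2 ℕ.^ k
  t = 2ℚ ^ k
  d = u - v
  U = u ^ n
  V = v ^ n
  W = w ^ n
  0≤u = ≤-trans 0≤v v≤u
  0≤V : 0ℚ ≤ V
  0≤V = 0≤^ n 0≤v
  V≤U : V ≤ U
  V≤U = ^-mono n 0≤v v≤u
  U≤W : U ≤ W
  U≤W = ^-mono n 0≤u u≤w
  ih : U ≤ V + t * d * W
  ih = ^-lipschitz k 0≤v v≤u u≤w 1≤w
  -- U² − V² = (U − V)(U + V) ≤ t d W · 2W
  core : U * U ≤ V * V + 2ℚ * t * d * (W * W)
  core = ≤-from ((V + t * d * W - U) * (U + V) + t * d * W * ((W - U) + (W - V)))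
    (0≤+ (0≤* (gap ih) (0≤+ (≤-trans 0≤V V≤U) 0≤V))
         (0≤* (0≤* (0≤* (0≤^ k (nonNegative⁻¹ 2ℚ)) (gap v≤u))
                   (≤-trans 0≤V (≤-trans V≤U U≤W)))
              (0≤+ (gap U≤W) (gap (≤-trans V≤U U≤W)))))
    (solve 5 (λ U V W t d →
       U :* U :+ ((V :+ t :* d :* W :- U) :* (U :+ V) :+ t :* d :* W :* ((W :- U) :+ (W :- V)))
       := V :* V :+ con 2ℚ :* t :* d :* (W :* W)) refl U V W t d)

module ExpBounds (B : ℚ) (1≤B : 1ℚ ≤ B) (k₀ : ℕ) (small₀ : B * B * ½ ^ k₀ ≤ ½) where

  open ≤-Reasoning

  0≤B : 0ℚ ≤ B
  0≤B = ≤-trans (<⇒≤ 0<1) 1≤B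

  small : ∀ {k} → k₀ ℕ.≤ k → B * B * ½ ^ k ≤ ½
  small k₀≤k = ≤-trans
    (*-monoˡ (B * B) (0≤² B) (^-anti (<⇒≤ 0<½) ½≤1 k₀≤k)) small₀
    where
    ½≤1 : ½ ≤ 1ℚ
    ½≤1 = ≤-from ½ (<⇒≤ 0<½) refl

  B½^≤½ : ∀ {k} → k₀ ℕ.≤ k → B * ½ ^ k ≤ ½
  B½^≤½ {k} k₀≤k = ≤-trans (*-monoʳ (½ ^ k) (0≤½^ k) B≤B²) (small k₀≤k)
    where
    B≤B² : B ≤ B * B
    B≤B² = subst (_≤ B * B) (*-identityˡ B) (*-monoʳ B 0≤B 1≤B)

  base≥½ : ∀ {k p} → k₀ ℕ.≤ k → - B ≤ p → ½ ≤ base k p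
  base≥½ {k} {p} k₀≤k -B≤p = ≤-from ((p - - B) * ½ ^ k + (½ - B * ½ ^ k))
    (0≤+ (0≤* (gap -B≤p) (0≤½^ k)) (gap (B½^≤½ k₀≤k)))
    (solve 3 (λ p B t → con ½ :+ ((p :- (:- B)) :* t :+ (con ½ :- B :* t))
                     := con 1ℚ :+ p :* t) refl p B (½ ^ k))

  base≤2 : ∀ {k p} → k₀ ℕ.≤ k → p ≤ B → base k p ≤ 2ℚ
  base≤2 {k} {p} k₀≤k p≤B = ≤-from ((B - p) * ½ ^ k + (½ - B * ½ ^ k) + ½)
    (0≤+ (0≤+ (0≤* (gap p≤B) (0≤½^ k)) (gap (B½^≤½ k₀≤k))) (<⇒≤ 0<½))
    (solve 3 (λ p B t → (con 1ℚ :+ p :* t) :+ ((B :- p) :* t :+ (con ½ :- B :* t) :+ con ½)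
                     := con 2ℚ) refl p B (½ ^ k))

  0≤base : ∀ {k p} → k₀ ℕ.≤ k → - B ≤ p → 0ℚ ≤ base k p
  0≤base k₀≤k -B≤p = ≤-trans (<⇒≤ 0<½) (base≥½ k₀≤k -B≤p)

  0≤exp : ∀ {k p} → k₀ ℕ.≤ k → - B ≤ p → 0ℚ ≤ expApprox k p
  0≤exp {k} k₀≤k -B≤p = 0≤^ (2 ℕ.^ k) (0≤base k₀≤k -B≤p)

  base-mono : ∀ k {p q} → p ≤ q → base k p ≤ base k q
  base-mono k p≤q = +-monoʳ-≤ 1ℚ (*-monoʳ (½ ^ k) (0≤½^ k) p≤q)

  exp-mono : ∀ {k p q} → k₀ ℕ.≤ k → - B ≤ p → p ≤ q → expApprox k p ≤ expApprox k q
  exp-mono {k} k₀≤k -B≤p p≤q = ^-mono (2 ℕ.^ k) (0≤base k₀≤k -B≤p) (base-mono k p≤q)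

  p²≤B² : ∀ {p} → - B ≤ p → p ≤ B → p * p ≤ B * B
  p²≤B² {p} -B≤p p≤B = ≤-from ((p - - B) * (B - p)) (0≤* (gap -B≤p) (gap p≤B))
    (solve 2 (λ p B → p :* p :+ (p :- (:- B)) :* (B :- p) := B :* B) refl p B)

  -- expApprox m p · expApprox m (-p) ≤ 1 while
  -- expApprox k p · expApprox k (-p) ≥ 1 - p²/2ᵏ.
  exp-stable : ∀ {k m p} → k₀ ℕ.≤ k → k ℕ.≤ m → - B ≤ p → p ≤ B →
    expApprox m p * (1ℚ - p * p * ½ ^ k) ≤ expApprox k p
  exp-stable {k} {m} {p} k₀≤k k≤m -B≤p p≤B = begin
    a * (1ℚ - s)   ≤⟨ *-monoˡ a 0≤a (1+p≤expApprox k (- s) 0≤1-s) ⟩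
    a * expApprox k (- s) ≡⟨ cong (a *_) (expApprox-neg k p) ⟨
    a * (b * b′)   ≤⟨ *-monoˡ a 0≤a (*-monoˡ b 0≤b (expApprox-≤ (- p) k≤m (0≤base k₀≤k -B≤-p))) ⟩
    a * (b * a′)   ≡⟨ solve 3 (λ a b a′ → a :* (b :* a′) := b :* (a :* a′)) refl a b a′ ⟩
    b * (a * a′)   ≤⟨ *-monoˡ b 0≤b (expApprox-neg≤1 m p (0≤base k₀≤m -B≤p) (0≤base k₀≤m -B≤-p)) ⟩
    b * 1ℚ         ≡⟨ *-identityʳ b ⟩
    b              ∎
    where
    a = expApprox m p
    a′ = expApprox m (- p)
    b = expApprox k p
    b′ = expApprox k (- p)
    s = p * p * ½ ^ k
    k₀≤m = ℕ.≤-trans k₀≤k k≤m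
    -B≤-p : - B ≤ - p
    -B≤-p = neg-antimono-≤ p≤B
    0≤a : 0ℚ ≤ a
    0≤a = 0≤exp k₀≤m -B≤p
    0≤b : 0ℚ ≤ b
    0≤b = 0≤exp k₀≤k -B≤p
    s≤½ : s ≤ ½
    s≤½ = ≤-trans (*-monoʳ (½ ^ k) (0≤½^ k) (p²≤B² -B≤p p≤B)) (small k₀≤k)
    0≤1-s : 0ℚ ≤ 1ℚ + - s
    0≤1-s = ≤-trans (<⇒≤ 0<½) (≤-from (½ - s) (gap s≤½)
      (solve 1 (λ s → con ½ :+ (con ½ :- s) := con 1ℚ :+ (:- s)) refl s))

  -B≤B : - B ≤ B
  -B≤B = ≤-from (B + B) (0≤+ 0≤B 0≤B) (solve 1 (λ B → (:- B) :+ (B :+ B) := B) refl B)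

  M : ℚ
  M = 2ℚ * expApprox k₀ B

  0≤M : 0ℚ ≤ M
  0≤M = 0≤* (nonNegative⁻¹ 2ℚ) (0≤exp ℕ.≤-refl -B≤B)

  exp≤M : ∀ {m} → k₀ ℕ.≤ m → expApprox m B ≤ M
  exp≤M {m} k₀≤m = subst (_≤ M) (eq a) (*-monoˡ 2ℚ (nonNegative⁻¹ 2ℚ) (begin
    a * ½                     ≤⟨ *-monoˡ a (0≤exp k₀≤m -B≤B) ½≤ ⟩
    a * (1ℚ - B * B * ½ ^ k₀) ≤⟨ exp-stable ℕ.≤-refl k₀≤m -B≤B ≤-refl ⟩
    expApprox k₀ B            ∎))
    where
    a = expApprox m B
    eq : ∀ a → 2ℚ * (a * ½) ≡ a
    eq = solve 1 (λ a → con 2ℚ :* (a :* con ½) := a) refl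
    ½≤ : ½ ≤ 1ℚ - B * B * ½ ^ k₀
    ½≤ = ≤-from (½ - B * B * ½ ^ k₀) (gap small₀)
      (solve 1 (λ s → con ½ :+ (con ½ :- s) := con 1ℚ :- s) refl (B * B * ½ ^ k₀))

  exp-late : ∀ {k m p} → k₀ ℕ.≤ k → k ℕ.≤ m → - B ≤ p → p ≤ B →
    expApprox m p ≤ expApprox k p + M * (B * B) * ½ ^ k
  exp-late {k} {m} {p} k₀≤k k≤m -B≤p p≤B = begin
    a                                   ≡⟨ solve 2 (λ a s → a := a :* (con 1ℚ :- s) :+ a :* s) refl a s ⟩
    a * (1ℚ - s) + a * s                ≤⟨ +-mono-≤ (exp-stable k₀≤k k≤m -B≤p p≤B) a*s≤ ⟩
    expApprox k p + M * (B * B * ½ ^ k) ≡⟨ cong (expApprox k p +_) (sym (*-assoc M (B * B) (½ ^ k))) ⟩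
    expApprox k p + M * (B * B) * ½ ^ k ∎
    where
    a = expApprox m p
    s = p * p * ½ ^ k
    k₀≤m = ℕ.≤-trans k₀≤k k≤m
    a*s≤ : a * s ≤ M * (B * B * ½ ^ k)
    a*s≤ = *-mono 0≤M (0≤* (0≤² p) (0≤½^ k))
      (≤-trans (exp-mono k₀≤m -B≤p p≤B) (exp≤M k₀≤m))
      (*-monoʳ (½ ^ k) (0≤½^ k) (p²≤B² -B≤p p≤B))

  exp-lipschitz : ∀ {k p q} → k₀ ℕ.≤ k → - B ≤ p → p ≤ q → q ≤ B →
    expApprox k q ≤ expApprox k p + (q - p) * M
  exp-lipschitz {k} {p} {q} k₀≤k -B≤p p≤q q≤B = begin
    expApprox k q
      ≤⟨ ^-lipschitz k (0≤base k₀≤k -B≤p) (base-mono k p≤q) (base-mono k q≤B) 1≤base ⟩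
    expApprox k p + 2ℚ ^ k * (base k q - base k p) * expApprox k B
      ≡⟨ cong (λ c → expApprox k p + c * expApprox k B) (trans (eq p q (2ℚ ^ k) (½ ^ k))
           (trans (cong ((q - p) *_) (2^½^ k)) (*-identityʳ (q - p)))) ⟩
    expApprox k p + (q - p) * expApprox k B
      ≤⟨ +-monoʳ-≤ (expApprox k p) (*-monoˡ (q - p) (gap p≤q) (exp≤M k₀≤k)) ⟩
    expApprox k p + (q - p) * M ∎
    where
    1≤base : 1ℚ ≤ base k B
    1≤base = ≤-from (B * ½ ^ k) (0≤* 0≤B (0≤½^ k)) refl
    eq : ∀ p q t s → t * ((1ℚ + q * s) - (1ℚ + p * s)) ≡ (q - p) * (t * s)
    eq = solve 4 (λ p q t s → t :* ((con 1ℚ :+ q :* s) :- (con 1ℚ :+ p :* s))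
                           := (q :- p) :* (t :* s)) refl

  exp-strict : ∀ {k p q} → k₀ ℕ.≤ k → - B ≤ p → p ≤ q → q ≤ B →
    expApprox k p + expApprox k₀ p * (½ * (q - p)) ≤ expApprox k q
  exp-strict {k} {p} {q} k₀≤k -B≤p p≤q q≤B = begin
    a + expApprox k₀ p * d      ≤⟨ +-monoʳ-≤ a (*-monoʳ d 0≤d (expApprox-≤ p k₀≤k (0≤base ℕ.≤-refl -B≤p))) ⟩
    a + a * d                   ≡⟨ solve 2 (λ a d → a :+ a :* d := a :* (con 1ℚ :+ d)) refl a d ⟩
    a * (1ℚ + d)                ≤⟨ *-monoˡ a (0≤exp k₀≤k -B≤p) (1+p≤expApprox k d (0≤+ (<⇒≤ 0<1) 0≤d)) ⟩
    a * expApprox k d           ≡⟨ ^-distrib-* (base k p) (base k d) (2 ℕ.^ k) ⟨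
    (base k p * base k d) ^ (2 ℕ.^ k) ≤⟨ ^-mono (2 ℕ.^ k) (0≤* (0≤base k₀≤k -B≤p) 0≤base-d) base≤ ⟩
    expApprox k q               ∎
    where
    a = expApprox k p
    d = ½ * (q - p)
    0≤d : 0ℚ ≤ d
    0≤d = 0≤* (<⇒≤ 0<½) (gap p≤q)
    0≤base-d : 0ℚ ≤ base k d
    0≤base-d = 0≤+ (<⇒≤ 0<1) (0≤* 0≤d (0≤½^ k))
    base≤ : base k p * base k d ≤ base k q
    base≤ = ≤-from ((2ℚ - base k p) * (d * ½ ^ k))
      (0≤* (gap (base≤2 k₀≤k (≤-trans p≤q q≤B))) (0≤* 0≤d (0≤½^ k)))
      (solve 3 (λ p q t → (con 1ℚ :+ p :* t) :* (con 1ℚ :+ con ½ :* (q :- p) :* t)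
                          :+ (con 2ℚ :- (con 1ℚ :+ p :* t)) :* (con ½ :* (q :- p) :* t)
                       := con 1ℚ :+ q :* t) refl p q (½ ^ k))

expBoundIndex : ∀ B → ∃ λ k₀ → B * B * ½ ^ k₀ ≤ ½
expBoundIndex B = proj₁ K , proj₂ K (proj₁ K) ℕ.≤-refl
  where
  K = shrink½ (B * B) ½ (0≤² B) 0<½

lesser : ∀ η → 0ℚ < η → ∃ λ η′ → 0ℚ < η′ × η′ ≤ 1ℚ × η′ ≤ η
lesser η 0<η = [ (λ η≤1 → η , 0<η , η≤1 , ≤-refl) , (λ 1≤η → 1ℚ , 0<1 , ≤-refl , 1≤η) ]′
  (≤-total η 1ℚ)

exp-cauchy : ∀ x → IsCauchy (λ k → expApprox k (seq x k))
exp-cauchy x = cauchy-intro (λ k → expApprox k (seq x k)) λ ε 0<ε → modulus ε (half ε 0<ε)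
  where
  open ≤-Reasoning
  A = proj₁ (bounded x)
  1≤A = proj₁ (proj₂ (bounded x))
  N₀ = proj₁ (proj₂ (proj₂ (bounded x)))
  ∣x∣≤A : ∀ n → N₀ ℕ.≤ n → ∣ seq x n ∣ ≤ A
  ∣x∣≤A = proj₂ (proj₂ (proj₂ (bounded x)))

  B = A + 1ℚ
  A≤B : A ≤ B
  A≤B = ≤-from 1ℚ (<⇒≤ 0<1) refl
  k₀ = proj₁ (expBoundIndex B)
  open ExpBounds B (≤-trans 1≤A A≤B) k₀ (proj₂ (expBoundIndex B))

  x≤A : ∀ {n} → N₀ ℕ.≤ n → seq x n ≤ A
  x≤A {n} h = proj₂ (abs-range (∣x∣≤A n h))
  -B≤x : ∀ {n} → N₀ ℕ.≤ n → - B ≤ seq x n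
  -B≤x {n} h = ≤-trans (neg-antimono-≤ A≤B) (proj₁ (abs-range (∣x∣≤A n h)))

  modulus : ∀ ε → 0ℚ < ½ * ε → ∃ λ N → ∀ m n → N ℕ.≤ m → N ℕ.≤ n →
    expApprox m (seq x m) ≤ expApprox n (seq x n) + ε
  modulus ε 0<½ε = K , estimate
    where
    0<M+1 : 0ℚ < M + 1ℚ
    0<M+1 = subst (0ℚ <_) (+-comm 1ℚ M) (0<+ 0<1 0≤M)
    Q = quotient (½ * ε) (M + 1ℚ) 0<½ε 0<M+1
    η₀ = proj₁ Q
    L = lesser η₀ (proj₁ (proj₂ Q))
    η = proj₁ L
    0<η = proj₁ (proj₂ L)
    η≤1 = proj₁ (proj₂ (proj₂ L))
    ηM≤½ε : η * M ≤ ½ * ε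
    ηM≤½ε = begin
      η * M           ≤⟨ *-mono (<⇒≤ (proj₁ (proj₂ Q))) 0≤M (proj₂ (proj₂ (proj₂ L))) (≤-from 1ℚ (<⇒≤ 0<1) refl) ⟩
      η₀ * (M + 1ℚ)   ≡⟨ proj₂ (proj₂ Q) ⟩
      ½ * ε           ∎

    S = shrink½ (M * (B * B)) (½ * ε) (0≤* 0≤M (0≤² B)) 0<½ε
    C = cauchy x η 0<η
    K = (N₀ ℕ.⊔ k₀) ℕ.⊔ (proj₁ S ℕ.⊔ proj₁ C)
    N₀⊔k₀≤K = ℕ.m≤m⊔n (N₀ ℕ.⊔ k₀) (proj₁ S ℕ.⊔ proj₁ C)
    S⊔C≤K = ℕ.m≤n⊔m (N₀ ℕ.⊔ k₀) (proj₁ S ℕ.⊔ proj₁ C)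
    N₀≤K : N₀ ℕ.≤ K
    N₀≤K = ℕ.m⊔n≤o⇒m≤o N₀ k₀ N₀⊔k₀≤K
    k₀≤K : k₀ ℕ.≤ K
    k₀≤K = ℕ.m⊔n≤o⇒n≤o N₀ k₀ N₀⊔k₀≤K
    S≤K : proj₁ S ℕ.≤ K
    S≤K = ℕ.m⊔n≤o⇒m≤o (proj₁ S) (proj₁ C) S⊔C≤K
    C≤K : proj₁ C ℕ.≤ K
    C≤K = ℕ.m⊔n≤o⇒n≤o (proj₁ S) (proj₁ C) S⊔C≤K

    estimate : ∀ m n → K ℕ.≤ m → K ℕ.≤ n →
      expApprox m (seq x m) ≤ expApprox n (seq x n) + ε
    estimate m n K≤m K≤n = begin
      expApprox m p
        ≤⟨ exp-late k₀≤K K≤m -B≤p (≤-trans (x≤A N₀≤m) A≤B) ⟩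
      expApprox K p + M * (B * B) * ½ ^ K
        ≤⟨ +-mono-≤ (exp-mono k₀≤K -B≤p p≤q+η) (proj₂ S K S≤K) ⟩
      expApprox K (q + η) + ½ * ε
        ≤⟨ +-monoˡ-≤ (½ * ε) (exp-lipschitz k₀≤K -B≤q q≤q+η (+-mono-≤ (x≤A N₀≤n) η≤1)) ⟩
      expApprox K q + (q + η - q) * M + ½ * ε
        ≡⟨ cong (λ d → expApprox K q + d * M + ½ * ε)
             (solve 2 (λ q η → q :+ η :- q := η) refl q η) ⟩
      expApprox K q + η * M + ½ * ε
        ≤⟨ +-monoˡ-≤ (½ * ε) (+-mono-≤ (expApprox-≤ q K≤n (0≤base k₀≤K -B≤q)) ηM≤½ε) ⟩
      expApprox n q + ½ * ε + ½ * ε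
        ≡⟨ solve 2 (λ a ε → a :+ con ½ :* ε :+ con ½ :* ε := a :+ ε) refl (expApprox n q) ε ⟩
      expApprox n q + ε ∎
      where
      p = seq x m
      q = seq x n
      N₀≤m = ℕ.≤-trans N₀≤K K≤m
      N₀≤n = ℕ.≤-trans N₀≤K K≤n
      -B≤p : - B ≤ p
      -B≤p = -B≤x N₀≤m
      -B≤q : - B ≤ q
      -B≤q = -B≤x N₀≤n
      p≤q+η : p ≤ q + η
      p≤q+η = abs-lower (proj₂ C m n (ℕ.≤-trans C≤K K≤m) (ℕ.≤-trans C≤K K≤n))
      q≤q+η : q ≤ q + η
      q≤q+η = ≤-from η (<⇒≤ 0<η) refl

exp : ℝ → ℝ
exp x = mkℝ (λ k → expApprox k (seq x k)) (exp-cauchy x)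

exp-<-ℚ : ∀ {p q} → p < q → exp (fromℚ p) <ʳ exp (fromℚ q)
exp-<-ℚ {p} {q} p<q =
  expApprox k₀ p * (½ * (q - p)) ,
  0<* (0<^ (2 ℕ.^ k₀) (<-≤-trans 0<½ (base≥½ ℕ.≤-refl -B≤p))) (0<* 0<½ (gap< p<q)) ,
  k₀ , λ k k₀≤k → exp-strict k₀≤k -B≤p (<⇒≤ p<q) q≤B
  where
  B = 1ℚ + (∣ p ∣ + ∣ q ∣)
  1≤B : 1ℚ ≤ B
  1≤B = ≤-from (∣ p ∣ + ∣ q ∣) (0≤+ (0≤∣p∣ p) (0≤∣p∣ q)) refl
  k₀ = proj₁ (expBoundIndex B)
  open ExpBounds B 1≤B k₀ (proj₂ (expBoundIndex B))
  -B≤p : - B ≤ p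
  -B≤p = proj₁ (abs-range (≤-from (1ℚ + ∣ q ∣) (0≤+ (<⇒≤ 0<1) (0≤∣p∣ q))
    (solve 2 (λ a b → a :+ (con 1ℚ :+ b) := con 1ℚ :+ (a :+ b)) refl ∣ p ∣ ∣ q ∣)))
  q≤B : q ≤ B
  q≤B = proj₂ (abs-range (≤-from (1ℚ + ∣ p ∣) (0≤+ (<⇒≤ 0<1) (0≤∣p∣ p))
    (solve 2 (λ a b → b :+ (con 1ℚ :+ a) := con 1ℚ :+ (a :+ b)) refl ∣ p ∣ ∣ q ∣)))

<ʳ-cotrans : ∀ {u v} → u <ʳ v → ∀ x → x <ʳ v ⊎ u <ʳ x
<ʳ-cotrans {u} {v} (ε , 0<ε , N , h) x =
  [ (λ x≤ → inj₁ (ε₄ , half (½ * ε) (half ε 0<ε) , K , λ n K≤n → ≤-from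
        ((X + ε₈ - seq x n) + (U + ½ * ε - X) + (V - (U + ε)) + (seq v n + ε₈ - V))
        (0≤+ (0≤+ (0≤+ (gap (abs-lower {seq x n} {X} (proj₂ Cx n K (x≤K K≤n) (x≤K ℕ.≤-refl)))) (gap x≤)) (gap (h K N≤K)))
             (gap (abs-lower {V} {seq v n} (proj₂ Cv K n (v≤K ℕ.≤-refl) (v≤K K≤n)))))
        (solve 6 (λ X x U V v ε →
           x :+ con ½ :* (con ½ :* ε)
           :+ ((X :+ con ½ :* (con ½ :* (con ½ :* ε)) :- x) :+ (U :+ con ½ :* ε :- X) :+ (V :- (U :+ ε))
               :+ (v :+ con ½ :* (con ½ :* (con ½ :* ε)) :- V)) := v)
           refl X (seq x n) U V (seq v n) ε)))
  , (λ ≤x → inj₂ (ε₄ , half (½ * ε) (half ε 0<ε) , K , λ n K≤n → ≤-from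
        ((U + ε₈ - seq u n) + (X - (U + ½ * ε)) + (seq x n + ε₈ - X))
        (0≤+ (0≤+ (gap (abs-lower {seq u n} {U} (proj₂ Cu n K (u≤K K≤n) (u≤K ℕ.≤-refl)))) (gap ≤x))
             (gap (abs-lower {X} {seq x n} (proj₂ Cx K n (x≤K ℕ.≤-refl) (x≤K K≤n)))))
        (solve 5 (λ X x U u ε →
           u :+ con ½ :* (con ½ :* ε)
           :+ ((U :+ con ½ :* (con ½ :* (con ½ :* ε)) :- u) :+ (X :- (U :+ con ½ :* ε))
               :+ (x :+ con ½ :* (con ½ :* (con ½ :* ε)) :- X)) := x)
           refl X (seq x n) U (seq u n) ε)))
  ]′ (≤-total X (U + ½ * ε))
  where
  ε₄ = ½ * (½ * ε)
  ε₈ = ½ * ε₄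
  0<ε₈ : 0ℚ < ε₈
  0<ε₈ = half ε₄ (half (½ * ε) (half ε 0<ε))
  Cu = cauchy u ε₈ 0<ε₈
  Cv = cauchy v ε₈ 0<ε₈
  Cx = cauchy x ε₈ 0<ε₈
  a = proj₁ Cu
  b = proj₁ Cv
  c = proj₁ Cx
  K = (N ℕ.⊔ a) ℕ.⊔ (b ℕ.⊔ c)
  X = seq x K
  U = seq u K
  V = seq v K
  N≤K : N ℕ.≤ K
  N≤K = ℕ.≤-trans (ℕ.m≤m⊔n N a) (ℕ.m≤m⊔n (N ℕ.⊔ a) (b ℕ.⊔ c))
  u≤K : ∀ {n} → K ℕ.≤ n → a ℕ.≤ n
  u≤K K≤n = ℕ.≤-trans (ℕ.≤-trans (ℕ.m≤n⊔m N a) (ℕ.m≤m⊔n (N ℕ.⊔ a) (b ℕ.⊔ c))) K≤n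
  v≤K : ∀ {n} → K ℕ.≤ n → b ℕ.≤ n
  v≤K K≤n = ℕ.≤-trans (ℕ.≤-trans (ℕ.m≤m⊔n b c) (ℕ.m≤n⊔m (N ℕ.⊔ a) (b ℕ.⊔ c))) K≤n
  x≤K : ∀ {n} → K ℕ.≤ n → c ℕ.≤ n
  x≤K K≤n = ℕ.≤-trans (ℕ.≤-trans (ℕ.m≤n⊔m b c) (ℕ.m≤n⊔m (N ℕ.⊔ a) (b ℕ.⊔ c))) K≤n

-- The solution y of g y = x, located by trisection: of two rationals p < q
-- inside a bracket of y, either x < g q or g p < x.
module Inverse (g : ℚ → ℝ) (g-< : ∀ {p q} → p < q → g p <ʳ g q) (x : ℝ) where

  record Bracket : Set where
    constructor bracket
    field
      lo hi : ℚ
      lo<hi : lo < hi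
      above : g lo <ʳ x
      below : x <ʳ g hi

  open Bracket public

  width : Bracket → ℚ
  width b = hi b - lo b

  module _ (b : Bracket) where
    third : ℚ
    third = ⅓ * width b

    0<third : 0ℚ < third
    0<third = 0<* (positive⁻¹ ⅓) (gap< (lo<hi b))

    p q : ℚ
    p = lo b + third
    q = hi b - third

    lo<p : lo b < p
    lo<p = <-from third 0<third refl

    p<q : p < q
    p<q = <-from third 0<third
      (solve 2 (λ l h → l :+ con ⅓ :* (h :- l) :+ con ⅓ :* (h :- l) := h :- con ⅓ :* (h :- l))
        refl (lo b) (hi b))

    q<hi : q < hi b
    q<hi = <-from third 0<third (solve 2 (λ h t → h :- t :+ t := h) refl (hi b) third)

    side : x <ʳ g q ⊎ g p <ʳ x
    side = <ʳ-cotrans {g p} {g q} (g-< p<q) x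

    choose : x <ʳ g q ⊎ g p <ʳ x → Bracket
    choose (inj₁ x<gq) = bracket (lo b) q (<-trans lo<p p<q) (above b) x<gq
    choose (inj₂ gp<x) = bracket p (hi b) (<-trans p<q q<hi) gp<x (below b)

    refine : Bracket
    refine = choose side

    choose-width : ∀ c → width (choose c) ≡ ⅔ * width b
    choose-width (inj₁ _) =
      solve 2 (λ l h → h :- con ⅓ :* (h :- l) :- l := con ⅔ :* (h :- l)) refl (lo b) (hi b)
    choose-width (inj₂ _) =
      solve 2 (λ l h → h :- (l :+ con ⅓ :* (h :- l)) := con ⅔ :* (h :- l)) refl (lo b) (hi b)

    choose-lo : ∀ c → lo b ≤ lo (choose c)
    choose-lo (inj₁ _) = ≤-refl
    choose-lo (inj₂ _) = <⇒≤ lo<p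

    choose-hi : ∀ c → hi (choose c) ≤ hi b
    choose-hi (inj₁ _) = <⇒≤ q<hi
    choose-hi (inj₂ _) = ≤-refl

  module _ (b₀ : Bracket) where
    brackets : ℕ → Bracket
    brackets zero    = b₀
    brackets (suc n) = refine (brackets n)

    brackets-width : ∀ n → width (brackets n) ≡ width b₀ * ⅔ ^ n
    brackets-width zero    = sym (*-identityʳ (width b₀))
    brackets-width (suc n) = trans (choose-width (brackets n) (side (brackets n)))
      (trans (cong (⅔ *_) (brackets-width n))
        (solve 2 (λ w t → con ⅔ :* (w :* t) := w :* (con ⅔ :* t)) refl (width b₀) (⅔ ^ n)))

    lo-mono : ∀ n d → lo (brackets n) ≤ lo (brackets (d ℕ.+ n))
    lo-mono n zero    = ≤-refl
    lo-mono n (suc d) = ≤-trans (lo-mono n d) (choose-lo (brackets (d ℕ.+ n)) (side (brackets (d ℕ.+ n))))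

    hi-mono : ∀ n d → hi (brackets (d ℕ.+ n)) ≤ hi (brackets n)
    hi-mono n zero    = ≤-refl
    hi-mono n (suc d) = ≤-trans (choose-hi (brackets (d ℕ.+ n)) (side (brackets (d ℕ.+ n)))) (hi-mono n d)

    lo-≤ : ∀ {m n} → m ℕ.≤ n → lo (brackets m) ≤ lo (brackets n)
    lo-≤ {m} {n} m≤n = subst (λ i → lo (brackets m) ≤ lo (brackets i))
      (ℕ.m∸n+n≡m m≤n) (lo-mono m (n ℕ.∸ m))

    hi-≤ : ∀ {m n} → m ℕ.≤ n → hi (brackets n) ≤ hi (brackets m)
    hi-≤ {m} {n} m≤n = subst (λ i → hi (brackets i) ≤ hi (brackets m))
      (ℕ.m∸n+n≡m m≤n) (hi-mono m (n ℕ.∸ m))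

    lo≤hi : ∀ n → lo (brackets n) ≤ hi (brackets n)
    lo≤hi n = <⇒≤ (lo<hi (brackets n))

    inverse : ℝ
    inverse = mkℝ (λ n → lo (brackets n))
      (cauchy-intro (λ n → lo (brackets n)) λ ε 0<ε →
        proj₁ (shrink (width b₀) ε 0<ε) , λ m n N≤m N≤n →
          estimate ε _ m n (proj₂ (shrink (width b₀) ε 0<ε) _ ℕ.≤-refl) N≤m N≤n)
      where
      open ≤-Reasoning
      estimate : ∀ ε N m n → width b₀ * ⅔ ^ N ≤ ε → N ℕ.≤ m → N ℕ.≤ n →
        lo (brackets m) ≤ lo (brackets n) + ε
      estimate ε N m n small N≤m N≤n = begin
        lo (brackets m)                        ≤⟨ lo≤hi m ⟩
        hi (brackets m)                        ≤⟨ hi-≤ N≤m ⟩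
        hi (brackets N)                        ≡⟨ solve 2 (λ l h → h := l :+ (h :- l)) refl (lo (brackets N)) (hi (brackets N)) ⟩
        lo (brackets N) + width (brackets N)   ≡⟨ cong (lo (brackets N) +_) (brackets-width N) ⟩
        lo (brackets N) + width b₀ * ⅔ ^ N     ≤⟨ +-mono-≤ (lo-≤ N≤n) small ⟩
        lo (brackets n) + ε                    ∎

    brackets-narrow : ∀ η → 0ℚ < η → ∃ λ J → width (brackets J) ≤ η
    brackets-narrow η 0<η = proj₁ S ,
      subst (_≤ η) (sym (brackets-width (proj₁ S))) (proj₂ S (proj₁ S) ℕ.≤-refl)
      where
      S = shrink (width b₀) η 0<η

-- q ∣q∣ extends squaring on [0, ∞) to a strictly increasing function on ℚ.
signedSquare : ℚ → ℚ
signedSquare q = q * ∣ q ∣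

∣∣-nonPos : ∀ {p} → p ≤ 0ℚ → ∣ p ∣ ≡ - p
∣∣-nonPos {p} p≤0 = trans (sym (∣-p∣≡∣p∣ p)) (0≤p⇒∣p∣≡p (neg-antimono-≤ p≤0))

signedSquare-< : ∀ {p q} → p < q → signedSquare p < signedSquare q
signedSquare-< {p} {q} p<q = cases (≤-total 0ℚ p) (≤-total 0ℚ q)
  where
  0<q-p : 0ℚ < q - p
  0<q-p = gap< p<q
  cases : 0ℚ ≤ p ⊎ p ≤ 0ℚ → 0ℚ ≤ q ⊎ q ≤ 0ℚ → p * ∣ p ∣ < q * ∣ q ∣
  cases (inj₁ 0≤p) _ =
    subst₂ (λ a b → p * a < q * b)
      (sym (0≤p⇒∣p∣≡p 0≤p)) (sym (0≤p⇒∣p∣≡p (<⇒≤ (≤-<-trans 0≤p p<q))))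
      (<-from ((q - p) * (q + p)) (0<* 0<q-p (0<+ (≤-<-trans 0≤p p<q) 0≤p))
        (solve 2 (λ p q → p :* p :+ (q :- p) :* (q :+ p) := q :* q) refl p q))
  cases (inj₂ p≤0) (inj₁ 0≤q) =
    subst₂ (λ a b → p * a < q * b) (sym (∣∣-nonPos p≤0)) (sym (0≤p⇒∣p∣≡p 0≤q))
      (<-from (½ * ((q - p) * (q - p)) + ½ * ((q + p) * (q + p)))
        (0<+ (0<* 0<½ (0<* 0<q-p 0<q-p)) (0≤* (<⇒≤ 0<½) (0≤² (q + p))))
        (solve 2 (λ p q → p :* (:- p) :+ (con ½ :* ((q :- p) :* (q :- p)) :+ con ½ :* ((q :+ p) :* (q :+ p)))
                       := q :* q) refl p q))
  cases (inj₂ p≤0) (inj₂ q≤0) =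
    subst₂ (λ a b → p * a < q * b) (sym (∣∣-nonPos p≤0)) (sym (∣∣-nonPos q≤0))
      (<-from ((q - p) * (- p + - q))
        (0<* 0<q-p (0<+ (≤-<-trans (neg-antimono-≤ q≤0) (neg-antimono-< p<q)) (neg-antimono-≤ q≤0)))
        (solve 2 (λ p q → p :* (:- p) :+ (q :- p) :* ((:- p) :+ (:- q)) := q :* (:- q)) refl p q))

fromℚ-< : ∀ {p q} → p < q → fromℚ p <ʳ fromℚ q
fromℚ-< {p} {q} p<q = q - p , gap< p<q , 0 , λ _ _ →
  ≤-reflexive (solve 2 (λ p q → p :+ (q :- p) := q) refl p q)

module Sqrt = Inverse (λ q → fromℚ (signedSquare q)) (λ p<q → fromℚ-< (signedSquare-< p<q))

sqrtBracket : ∀ x → 0ʳ ≤ʳ x → Sqrt.Bracket x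
sqrtBracket x 0≤x = Sqrt.bracket (- 1ℚ) (B + 1ℚ) -1<B+1 above₀ below₀
  where
  B = proj₁ (bounded x)
  0≤B : 0ℚ ≤ B
  0≤B = ≤-trans (<⇒≤ 0<1) (proj₁ (proj₂ (bounded x)))
  0<B+1 : 0ℚ < B + 1ℚ
  0<B+1 = +-mono-≤-< 0≤B 0<1
  -1<B+1 : - 1ℚ < B + 1ℚ
  -1<B+1 = <-trans (neg-antimono-< 0<1) 0<B+1
  above₀ : fromℚ (signedSquare (- 1ℚ)) <ʳ x
  above₀ = ½ , 0<½ , proj₁ (0≤x ½ 0<½) , λ n N≤n →
    ≤-from (seq x n + ½) (proj₂ (0≤x ½ 0<½) n N≤n)
      (solve 1 (λ y → (con (- 1ℚ) :+ con ½) :+ (y :+ con ½) := y) refl (seq x n))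
  below₀ : x <ʳ fromℚ (signedSquare (B + 1ℚ))
  below₀ = 1ℚ , 0<1 , proj₁ (proj₂ (proj₂ (bounded x))) , λ n N≤n →
    subst (λ a → seq x n + 1ℚ ≤ (B + 1ℚ) * a) (sym (0≤p⇒∣p∣≡p (<⇒≤ 0<B+1)))
      (≤-from ((B - seq x n) + B * (B + 1ℚ))
        (0≤+ (gap (proj₂ (abs-range (proj₂ (proj₂ (proj₂ (bounded x))) n N≤n))))
             (0≤* 0≤B (<⇒≤ 0<B+1)))
        (solve 2 (λ B y → (y :+ con 1ℚ) :+ ((B :- y) :+ B :* (B :+ con 1ℚ))
                       := (B :+ con 1ℚ) :* (B :+ con 1ℚ)) refl B (seq x n)))

sqrt : (x : ℝ) → 0ʳ ≤ʳ x → ℝ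
sqrt x 0≤x = Sqrt.inverse x (sqrtBracket x 0≤x)

sqrt-square : ∀ x 0≤x → sqrt x 0≤x *ʳ sqrt x 0≤x ≃ʳ x
sqrt-square x 0≤x ε 0<ε = J ℕ.⊔ (N₁ ℕ.⊔ (N₂ ℕ.⊔ (N₃ ℕ.⊔ N₄))) , λ k N≤k →
  close k (ℕ.m⊔n≤o⇒m≤o J _ N≤k)
    (proj₂ (proj₂ (proj₂ (Sqrt.above bJ))) k
      (ℕ.m⊔n≤o⇒m≤o N₁ _ (ℕ.m⊔n≤o⇒n≤o J _ N≤k)))
    (proj₂ (proj₂ (proj₂ (Sqrt.below bJ))) k
      (ℕ.m⊔n≤o⇒m≤o N₂ _ (ℕ.m⊔n≤o⇒n≤o N₁ _ (ℕ.m⊔n≤o⇒n≤o J _ N≤k))))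
    (proj₂ (0≤x ε₂ 0<ε₂) k
      (ℕ.m⊔n≤o⇒m≤o N₃ N₄ (ℕ.m⊔n≤o⇒n≤o N₂ _ (ℕ.m⊔n≤o⇒n≤o N₁ _ (ℕ.m⊔n≤o⇒n≤o J _ N≤k)))))
    (proj₂ (0≤x (½ * ε) (half ε 0<ε)) k
      (ℕ.m⊔n≤o⇒n≤o N₃ N₄ (ℕ.m⊔n≤o⇒n≤o N₂ _ (ℕ.m⊔n≤o⇒n≤o N₁ _ (ℕ.m⊔n≤o⇒n≤o J _ N≤k)))))
  where
  b₀ = sqrtBracket x 0≤x
  R = 1ℚ + ∣ Sqrt.hi b₀ ∣
  1≤R : 1ℚ ≤ R
  1≤R = ≤-from ∣ Sqrt.hi b₀ ∣ (0≤∣p∣ (Sqrt.hi b₀)) refl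
  0<R : 0ℚ < R
  0<R = <-≤-trans 0<1 1≤R
  Q = quotient (½ * (½ * ε)) R (half (½ * ε) (half ε 0<ε)) 0<R
  D = lesser (proj₁ Q) (proj₁ (proj₂ Q))
  η = proj₁ D
  0<η : 0ℚ < η
  0<η = proj₁ (proj₂ D)
  η≤1 : η ≤ 1ℚ
  η≤1 = proj₁ (proj₂ (proj₂ D))
  ηR≤ : η * R ≤ ½ * (½ * ε)
  ηR≤ = subst (η * R ≤_) (proj₂ (proj₂ Q)) (*-monoʳ R (<⇒≤ 0<R) (proj₂ (proj₂ (proj₂ D))))
  ηη≤ : η * η ≤ ½ * (½ * ε)
  ηη≤ = ≤-trans (*-monoˡ η (<⇒≤ 0<η) (≤-trans η≤1 1≤R)) ηR≤
  J = proj₁ (Sqrt.brackets-narrow x b₀ η 0<η)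
  bJ = Sqrt.brackets x b₀ J
  l = Sqrt.lo bJ
  h = Sqrt.hi bJ
  h-l≤η : h - l ≤ η
  h-l≤η = proj₂ (Sqrt.brackets-narrow x b₀ η 0<η)
  l≤h : l ≤ h
  l≤h = <⇒≤ (Sqrt.lo<hi bJ)
  h≤R : h ≤ R
  h≤R = ≤-trans (Sqrt.hi-≤ x b₀ {0} {J} ℕ.z≤n)
    (≤-trans (p≤∣p∣ (Sqrt.hi b₀)) (≤-from 1ℚ (<⇒≤ 0<1) (+-comm ∣ Sqrt.hi b₀ ∣ 1ℚ)))
  ε₁ = proj₁ (Sqrt.above bJ)
  0<ε₁ : 0ℚ < ε₁
  0<ε₁ = proj₁ (proj₂ (Sqrt.above bJ))
  N₁ = proj₁ (proj₂ (proj₂ (Sqrt.above bJ)))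
  ε₂ = proj₁ (Sqrt.below bJ)
  0<ε₂ : 0ℚ < ε₂
  0<ε₂ = proj₁ (proj₂ (Sqrt.below bJ))
  N₂ = proj₁ (proj₂ (proj₂ (Sqrt.below bJ)))
  N₃ = proj₁ (0≤x ε₂ 0<ε₂)
  N₄ = proj₁ (0≤x (½ * ε) (half ε 0<ε))

  close : ∀ k → J ℕ.≤ k →
    signedSquare l + ε₁ ≤ seq x k → seq x k + ε₂ ≤ signedSquare h →
    0ℚ ≤ seq x k + ε₂ → 0ℚ ≤ seq x k + ½ * ε →
    ∣ Sqrt.lo (Sqrt.brackets x b₀ k) * Sqrt.lo (Sqrt.brackets x b₀ k) - seq x k ∣ ≤ ε
  close k J≤k l²≤ ≤h² 0≤y₂ 0≤y = abs-intro (upper (≤-total 0ℚ l)) (lower (≤-total 0ℚ l))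
    where
    s = Sqrt.lo (Sqrt.brackets x b₀ k)
    y = seq x k
    l≤s : l ≤ s
    l≤s = Sqrt.lo-≤ x b₀ J≤k
    s≤h : s ≤ h
    s≤h = ≤-trans (Sqrt.lo≤hi x b₀ k) (Sqrt.hi-≤ x b₀ J≤k)
    0≤h : 0ℚ ≤ h
    0≤h = ≮⇒≥ λ h<0 → <⇒≱ (signedSquare-< h<0) (≤-trans 0≤y₂ ≤h²)
      where
      <⇒≱ : ∀ {p q} → p < q → q ≤ p → ⊥
      <⇒≱ p<q q≤p = <-irrefl refl (<-≤-trans p<q q≤p)
    y≤h² : y ≤ h * h
    y≤h² = ≤-trans (≤-from ε₂ (<⇒≤ 0<ε₂) refl)
      (subst (λ a → y + ε₂ ≤ h * a) (0≤p⇒∣p∣≡p 0≤h) ≤h²)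
    l²≤y : 0ℚ ≤ l → l * l ≤ y
    l²≤y 0≤l = ≤-trans (≤-from ε₁ (<⇒≤ 0<ε₁) refl)
      (subst (λ a → l * a + ε₁ ≤ y) (0≤p⇒∣p∣≡p 0≤l) l²≤)
    -- h² ≤ l² + η (h + l)
    h²≤l² : 0ℚ ≤ l → h * h ≤ l * l + ε
    h²≤l² 0≤l = ≤-from
      ((η - (h - l)) * (h + l) + η * ((R - h) + (R - l)) + 2ℚ * (½ * (½ * ε) - η * R) + ½ * ε)
      (0≤+ (0≤+ (0≤+ (0≤* (gap h-l≤η) (0≤+ 0≤h 0≤l))
        (0≤* (<⇒≤ 0<η) (0≤+ (gap h≤R) (gap (≤-trans l≤h h≤R)))))
        (0≤* (nonNegative⁻¹ 2ℚ) (gap ηR≤))) (<⇒≤ (half ε 0<ε)))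
      (solve 5 (λ h l η R ε →
         h :* h :+ ((η :- (h :- l)) :* (h :+ l) :+ η :* ((R :- h) :+ (R :- l))
           :+ con 2ℚ :* (con ½ :* (con ½ :* ε) :- η :* R) :+ con ½ :* ε)
         := l :* l :+ ε) refl h l η R ε)
    -- If l ≤ 0 ≤ h then s and h are within η of 0.
    h≤η : l ≤ 0ℚ → h ≤ η
    h≤η l≤0 = ≤-from ((η - (h - l)) + (0ℚ - l)) (0≤+ (gap h-l≤η) (gap l≤0))
      (solve 3 (λ h l η → h :+ ((η :- (h :- l)) :+ (con 0ℚ :- l)) := η) refl h l η)
    -η≤s : l ≤ 0ℚ → 0ℚ ≤ s + η
    -η≤s l≤0 = subst (0ℚ ≤_)
      (solve 4 (λ h l η s → ((η :- (h :- l)) :+ h) :+ (s :- l) := s :+ η) refl h l η s)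
      (0≤+ (0≤+ (gap h-l≤η) 0≤h) (gap l≤s))
    s²≤η² : l ≤ 0ℚ → s * s ≤ η * η
    s²≤η² l≤0 = ≤-from ((s + η) * (η - s)) (0≤* (-η≤s l≤0) (gap (≤-trans s≤h (h≤η l≤0))))
      (solve 2 (λ s η → s :* s :+ (s :+ η) :* (η :- s) := η :* η) refl s η)
    upper : 0ℚ ≤ l ⊎ l ≤ 0ℚ → s * s ≤ y + ε
    upper (inj₁ 0≤l) = ≤-trans (*-mono 0≤h (≤-trans 0≤l l≤s) s≤h s≤h)
      (≤-trans (h²≤l² 0≤l) (+-monoˡ-≤ ε (l²≤y 0≤l)))
    upper (inj₂ l≤0) = ≤-trans (s²≤η² l≤0) (≤-trans ηη≤ (≤-from ((y + ½ * ε) + ½ * (½ * ε))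
      (0≤+ 0≤y (<⇒≤ (half (½ * ε) (half ε 0<ε))))
      (solve 2 (λ y ε → con ½ :* (con ½ :* ε) :+ ((y :+ con ½ :* ε) :+ con ½ :* (con ½ :* ε))
                     := y :+ ε) refl y ε)))
    lower : 0ℚ ≤ l ⊎ l ≤ 0ℚ → y ≤ s * s + ε
    lower (inj₁ 0≤l) = ≤-trans y≤h² (≤-trans (h²≤l² 0≤l)
      (+-monoˡ-≤ ε (*-mono (≤-trans 0≤l l≤s) 0≤l l≤s l≤s)))
    lower (inj₂ l≤0) = ≤-trans y≤h² (≤-trans (*-mono (<⇒≤ 0<η) 0≤h (h≤η l≤0) (h≤η l≤0))
      (≤-trans ηη≤ (≤-from (s * s + (½ * ε + ½ * (½ * ε)))
        (0≤+ (0≤² s) (0≤+ (<⇒≤ (half ε 0<ε)) (<⇒≤ (half (½ * ε) (half ε 0<ε)))))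
        (solve 2 (λ s ε → con ½ :* (con ½ :* ε) :+ (s :* s :+ (con ½ :* ε :+ con ½ :* (con ½ :* ε)))
                       := s :* s :+ ε) refl s ε))))

sqrt-nonNeg : ∀ x 0≤x → 0ʳ ≤ʳ sqrt x 0≤x
sqrt-nonNeg x 0≤x ε 0<ε = proj₁ S , λ k J≤k →
  subst (0ℚ ≤_) (solve 3 (λ l h ε → (ε :- (h :- l)) :+ h := l :+ ε) refl (l k) (h k) ε)
    (0≤+ (gap (width≤ε k J≤k)) (0≤h k))
  where
  b₀ = sqrtBracket x 0≤x
  S = shrink (Sqrt.width x b₀) ε 0<ε
  l h : ℕ → ℚ
  l k = Sqrt.lo (Sqrt.brackets x b₀ k)
  h k = Sqrt.hi (Sqrt.brackets x b₀ k)
  width≤ε : ∀ k → proj₁ S ℕ.≤ k → h k - l k ≤ ε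
  width≤ε k J≤k = subst (_≤ ε) (sym (Sqrt.brackets-width x b₀ k)) (proj₂ S k J≤k)
  0≤h : ∀ k → 0ℚ ≤ h k
  0≤h k = ≮⇒≥ λ h<0 → <-irrefl refl (<-≤-trans (signedSquare-< h<0)
      (≤-trans (proj₂ (0≤x ε₂ 0<ε₂) m (ℕ.m≤n⊔m N N′))
               (proj₂ (proj₂ (proj₂ below)) m (ℕ.m≤m⊔n N N′))))
    where
    below = Sqrt.below (Sqrt.brackets x b₀ k)
    ε₂ = proj₁ below
    0<ε₂ : 0ℚ < ε₂
    0<ε₂ = proj₁ (proj₂ below)
    N = proj₁ (proj₂ (proj₂ below))
    N′ = proj₁ (0≤x ε₂ 0<ε₂)
    m = N ℕ.⊔ N′

module Log = Inverse (λ q → exp (fromℚ q)) exp-<-ℚ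

logBracket : ∀ x → 0ʳ <ʳ x → Log.Bracket x
logBracket x (ε , 0<ε , N , ε≤x) = Log.bracket (- L) B -L<B above₀ below₀
  where
  open ≤-Reasoning
  B = proj₁ (bounded x)
  0≤B : 0ℚ ≤ B
  0≤B = ≤-trans (<⇒≤ 0<1) (proj₁ (proj₂ (bounded x)))
  L = proj₁ (quotient 2ℚ ε (positive⁻¹ 2ℚ) 0<ε)
  0<L : 0ℚ < L
  0<L = proj₁ (proj₂ (quotient 2ℚ ε (positive⁻¹ 2ℚ) 0<ε))
  Lε≡2 : L * ε ≡ 2ℚ
  Lε≡2 = proj₂ (proj₂ (quotient 2ℚ ε (positive⁻¹ 2ℚ) 0<ε))
  -L<B : - L < B
  -L<B = <-≤-trans (neg-antimono-< 0<L) 0≤B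

  S = shrink½ L 1ℚ (<⇒≤ 0<L) 0<1

  exp-L≤ : ∀ k → proj₁ S ℕ.≤ k → expApprox k (- L) ≤ ½ * ε
  exp-L≤ k S≤k = ≤-from (½ * (a * ε) + ½ * ε * (1ℚ - (1ℚ + L) * a))
    (0≤+ (0≤* (<⇒≤ 0<½) (0≤* 0≤a (<⇒≤ 0<ε)))
         (0≤* (<⇒≤ (half ε 0<ε)) (gap (≤-trans (*-monoʳ a 0≤a (1+p≤expApprox k L 0≤1+L))
           (expApprox-neg≤1 k L 0≤base-L 0≤base--L)))))
    (trans (eq a ε L) (trans (cong (λ t → a * (1ℚ - ½ * t) + ½ * ε) Lε≡2) (eq′ a ε)))
    where
    a = expApprox k (- L)
    0≤base--L : 0ℚ ≤ base k (- L)
    0≤base--L = subst (0ℚ ≤_)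
      (solve 2 (λ L t → con 1ℚ :- L :* t := con 1ℚ :+ (:- L) :* t) refl L (½ ^ k))
      (gap (proj₂ S k S≤k))
    0≤1+L : 0ℚ ≤ 1ℚ + L
    0≤1+L = 0≤+ (<⇒≤ 0<1) (<⇒≤ 0<L)
    0≤base-L : 0ℚ ≤ base k L
    0≤base-L = 0≤+ (<⇒≤ 0<1) (0≤* (<⇒≤ 0<L) (0≤½^ k))
    0≤a : 0ℚ ≤ a
    0≤a = 0≤^ (2 ℕ.^ k) 0≤base--L
    eq : ∀ a ε L → a + (½ * (a * ε) + ½ * ε * (1ℚ - (1ℚ + L) * a)) ≡ a * (1ℚ - ½ * (L * ε)) + ½ * ε
    eq = solve 3 (λ a ε L → a :+ (con ½ :* (a :* ε) :+ con ½ :* ε :* (con 1ℚ :- (con 1ℚ :+ L) :* a))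
                         := a :* (con 1ℚ :- con ½ :* (L :* ε)) :+ con ½ :* ε) refl
    eq′ : ∀ a ε → a * (1ℚ - ½ * 2ℚ) + ½ * ε ≡ ½ * ε
    eq′ = solve 2 (λ a ε → a :* (con 1ℚ :- con ½ :* con 2ℚ) :+ con ½ :* ε := con ½ :* ε) refl

  above₀ : exp (fromℚ (- L)) <ʳ x
  above₀ = ½ * ε , half ε 0<ε , ev-map₂ step (proj₁ S , exp-L≤) (N , ε≤x)
    where
    step : ∀ {n} → expApprox n (- L) ≤ ½ * ε → 0ℚ + ε ≤ seq x n →
           expApprox n (- L) + ½ * ε ≤ seq x n
    step {n} a≤ ε≤ = ≤-from ((½ * ε - expApprox n (- L)) + (seq x n - (0ℚ + ε)))
      (0≤+ (gap a≤) (gap ε≤))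
      (solve 3 (λ a x ε → (a :+ con ½ :* ε) :+ ((con ½ :* ε :- a) :+ (x :- (con 0ℚ :+ ε))) := x)
        refl (expApprox n (- L)) (seq x n) ε)

  below₀ : x <ʳ exp (fromℚ B)
  below₀ = 1ℚ , 0<1 , proj₁ (proj₂ (proj₂ (bounded x))) , λ n N≤n → begin
    seq x n + 1ℚ    ≤⟨ +-monoˡ-≤ 1ℚ (proj₂ (abs-range (proj₂ (proj₂ (proj₂ (bounded x))) n N≤n))) ⟩
    B + 1ℚ          ≡⟨ +-comm B 1ℚ ⟩
    1ℚ + B          ≤⟨ 1+p≤expApprox n B (0≤+ (<⇒≤ 0<1) 0≤B) ⟩
    expApprox n B   ∎

log : (x : ℝ) → 0ʳ <ʳ x → ℝ
log x 0<x = Log.inverse x (logBracket x 0<x)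

exp-log : ∀ x 0<x → exp (log x 0<x) ≃ʳ x
exp-log x 0<x ε 0<ε = (J ℕ.⊔ k₀) ℕ.⊔ (N₁ ℕ.⊔ N₂) , λ k N≤k →
  close k (ℕ.m⊔n≤o⇒m≤o J k₀ (ℕ.m⊔n≤o⇒m≤o (J ℕ.⊔ k₀) (N₁ ℕ.⊔ N₂) N≤k))
    (ℕ.m⊔n≤o⇒n≤o J k₀ (ℕ.m⊔n≤o⇒m≤o (J ℕ.⊔ k₀) (N₁ ℕ.⊔ N₂) N≤k))
    (proj₂ (proj₂ (proj₂ (Log.above bJ))) k
      (ℕ.m⊔n≤o⇒m≤o N₁ N₂ (ℕ.m⊔n≤o⇒n≤o (J ℕ.⊔ k₀) (N₁ ℕ.⊔ N₂) N≤k)))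
    (proj₂ (proj₂ (proj₂ (Log.below bJ))) k
      (ℕ.m⊔n≤o⇒n≤o N₁ N₂ (ℕ.m⊔n≤o⇒n≤o (J ℕ.⊔ k₀) (N₁ ℕ.⊔ N₂) N≤k)))
  where
  b₀ = logBracket x 0<x
  B = 1ℚ + (∣ Log.lo b₀ ∣ + ∣ Log.hi b₀ ∣)
  1≤B : 1ℚ ≤ B
  1≤B = ≤-from (∣ Log.lo b₀ ∣ + ∣ Log.hi b₀ ∣) (0≤+ (0≤∣p∣ (Log.lo b₀)) (0≤∣p∣ (Log.hi b₀))) refl
  k₀ = proj₁ (expBoundIndex B)
  open ExpBounds B 1≤B k₀ (proj₂ (expBoundIndex B))
  0<M+1 : 0ℚ < M + 1ℚ
  0<M+1 = +-mono-≤-< 0≤M 0<1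
  Q = quotient ε (M + 1ℚ) 0<ε 0<M+1
  η = proj₁ Q
  0<η : 0ℚ < η
  0<η = proj₁ (proj₂ Q)
  J = proj₁ (Log.brackets-narrow x b₀ η 0<η)
  bJ = Log.brackets x b₀ J
  l = Log.lo bJ
  h = Log.hi bJ
  l≤h : l ≤ h
  l≤h = <⇒≤ (Log.lo<hi bJ)
  [h-l]M≤ε : (h - l) * M ≤ ε
  [h-l]M≤ε = subst ((h - l) * M ≤_) (proj₂ (proj₂ Q))
    (*-mono (<⇒≤ 0<η) 0≤M (proj₂ (Log.brackets-narrow x b₀ η 0<η)) (≤-from 1ℚ (<⇒≤ 0<1) refl))
  -B≤l : - B ≤ l
  -B≤l = ≤-trans (proj₁ (abs-range (≤-from (1ℚ + ∣ Log.hi b₀ ∣) (0≤+ (<⇒≤ 0<1) (0≤∣p∣ (Log.hi b₀)))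
    (solve 2 (λ a b → a :+ (con 1ℚ :+ b) := con 1ℚ :+ (a :+ b)) refl ∣ Log.lo b₀ ∣ ∣ Log.hi b₀ ∣))))
    (Log.lo-≤ x b₀ {0} {J} ℕ.z≤n)
  h≤B : h ≤ B
  h≤B = ≤-trans (Log.hi-≤ x b₀ {0} {J} ℕ.z≤n)
    (proj₂ (abs-range (≤-from (1ℚ + ∣ Log.lo b₀ ∣) (0≤+ (<⇒≤ 0<1) (0≤∣p∣ (Log.lo b₀)))
    (solve 2 (λ a b → b :+ (con 1ℚ :+ a) := con 1ℚ :+ (a :+ b)) refl ∣ Log.lo b₀ ∣ ∣ Log.hi b₀ ∣))))
  ε₁ = proj₁ (Log.above bJ)
  N₁ = proj₁ (proj₂ (proj₂ (Log.above bJ)))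
  ε₂ = proj₁ (Log.below bJ)
  N₂ = proj₁ (proj₂ (proj₂ (Log.below bJ)))

  close : ∀ k → J ℕ.≤ k → k₀ ℕ.≤ k →
    expApprox k l + ε₁ ≤ seq x k → seq x k + ε₂ ≤ expApprox k h →
    ∣ expApprox k (Log.lo (Log.brackets x b₀ k)) - seq x k ∣ ≤ ε
  close k J≤k k₀≤k el≤ ≤eh = abs-intro
    (≤-trans (exp-mono k₀≤k (≤-trans -B≤l l≤s) s≤h) (≤-trans eh≤ (+-monoˡ-≤ ε el≤y)))
    (≤-trans y≤eh (≤-trans eh≤ (+-monoˡ-≤ ε (exp-mono k₀≤k -B≤l l≤s))))
    where
    s = Log.lo (Log.brackets x b₀ k)
    l≤s : l ≤ s
    l≤s = Log.lo-≤ x b₀ J≤k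
    s≤h : s ≤ h
    s≤h = ≤-trans (Log.lo≤hi x b₀ k) (Log.hi-≤ x b₀ J≤k)
    el≤y : expApprox k l ≤ seq x k
    el≤y = ≤-trans (≤-from ε₁ (<⇒≤ (proj₁ (proj₂ (Log.above bJ)))) refl) el≤
    y≤eh : seq x k ≤ expApprox k h
    y≤eh = ≤-trans (≤-from ε₂ (<⇒≤ (proj₁ (proj₂ (Log.below bJ)))) refl) ≤eh
    eh≤ : expApprox k h ≤ expApprox k l + ε
    eh≤ = ≤-trans (exp-lipschitz k₀≤k -B≤l l≤h h≤B) (+-monoʳ-≤ (expApprox k l) [h-l]M≤ε)

fromℕ-positive : ∀ n .{{_ : ℕ.NonZero n}} → 0ʳ <ʳ fromℕ n
fromℕ-positive n@(suc _) = fromℚ-< (positive⁻¹ (ℤ.+ n / 1) {{normalize-pos n 1}})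

logℕ : (n : ℕ) .{{_ : ℕ.NonZero n}} → ℝ
logℕ n = log (fromℕ n) (fromℕ-positive n)

infixr 9 _^ʳ_

_^ʳ_ : (n : ℕ) .{{_ : ℕ.NonZero n}} → ℝ → ℝ
n ^ʳ s = exp (s *ʳ logℕ n)

infixl 6 _+ᶜ_ _-ᶜ_
infixl 7 _*ᶜ_
infix  8 -ᶜ_

record ℂ : Set where
  constructor _+i_
  field
    re im : ℝ

open ℂ public

0ᶜ 1ᶜ : ℂ
0ᶜ = 0ʳ +i 0ʳ
1ᶜ = 1ʳ +i 0ʳ

-ᶜ_ : ℂ → ℂ
-ᶜ z = (-ʳ re z) +i (-ʳ im z)

_+ᶜ_ _-ᶜ_ _*ᶜ_ : ℂ → ℂ → ℂ
w +ᶜ z = (re w +ʳ re z) +i (im w +ʳ im z)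
w -ᶜ z = w +ᶜ (-ᶜ z)
w *ᶜ z = (re w *ʳ re z -ʳ im w *ʳ im z) +i (re w *ʳ im z +ʳ im w *ʳ re z)

ℝ⇒ℂ : ℝ → ℂ
ℝ⇒ℂ x = x +i 0ʳ

∣_∣² : ℂ → ℝ
∣ z ∣² = re z *ʳ re z +ʳ im z *ʳ im z

∣∣²-nonNeg : ∀ z → 0ʳ ≤ʳ ∣ z ∣²
∣∣²-nonNeg z ε 0<ε = 0 , λ n _ →
  0≤+ (0≤+ (0≤² (seq (re z) n)) (0≤² (seq (im z) n))) (<⇒≤ 0<ε)

∣_∣ᶜ : ℂ → ℝ
∣ z ∣ᶜ = sqrt ∣ z ∣² (∣∣²-nonNeg z)

-- log ∣z∣ ≤ y, with the convention log 0 = -∞.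
log∣_∣≤_ : ℂ → ℝ → Set
log∣ z ∣≤ y = (z≢0 : 0ʳ <ʳ ∣ z ∣ᶜ) → log ∣ z ∣ᶜ z≢0 ≤ʳ y

_⟶_ : (ℕ → ℂ) → ℂ → Set
u ⟶ z = ∀ ε → 0ℚ < ε → Eventually λ n → ∣ u n -ᶜ z ∣ᶜ ≤ʳ fromℚ ε

-- Sum over 1 ≤ n ≤ N: the index starts at 1, so u 0 plays no role.
partialSum : (ℕ → ℂ) → ℕ → ℂ
partialSum u zero    = 0ᶜ
partialSum u (suc N) = partialSum u N +ᶜ u (suc N)

-- a n · n⁻ᵐ; the value at n = 0, where n⁻ᵐ is undefined, is never used.
dirichletTerm : (ℕ → ℂ) → ℕ → ℕ → ℂ
dirichletTerm a m zero      = 0ᶜ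
dirichletTerm a m n@(suc _) = a n *ᶜ ℝ⇒ℂ (fromℚ ((ℤ.+ 1 / n) ^ m))

IsDirichletSum : (ℕ → ℂ) → ℕ → ℂ → Set
IsDirichletSum a m z = partialSum (dirichletTerm a m) ⟶ z

_≪n^_ : (ℕ → ℂ) → ℝ → Set
a ≪n^ s = ∃ λ C → 0ʳ <ʳ C × (∀ n .{{_ : ℕ.NonZero n}} → ∣ a n ∣ᶜ ≤ʳ C *ʳ n ^ʳ s)

Σᶜ : ∀ {n} → (Fin n → ℂ) → ℂ
Σᶜ {zero}  u = 0ᶜ
Σᶜ {suc n} u = u zero +ᶜ Σᶜ (λ i → u (suc i))

sign : ℕ → ℂ
sign zero    = 1ᶜ
sign (suc n) = -ᶜ sign n

-- Laplace expansion along the first row.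
det : ∀ {n} → (Fin n → Fin n → ℂ) → ℂ
det {zero}  A = 1ᶜ
det {suc n} A = Σᶜ λ j →
  sign (toℕ j) *ᶜ A zero j *ᶜ det (λ i k → A (suc i) (punchIn j k))

-- Rows and columns are numbered from 1, hence the successors.
hankel : (a b : ℕ) → (ℕ → ℂ) → ℕ → ℂ
hankel a b f n = det {n} λ i j →
  f (a ℕ.* (suc (toℕ i) ℕ.+ suc (toℕ j)) ℕ.+ b)

{-# OPTIONS --safe #-}
module Submission where

open import Defs
open import Algebra.Bundles using (CommutativeRing)
open import Data.Empty using (⊥)
open import Data.Fin.Base using (Fin; zero; suc; toℕ; punchIn)
open import Data.Fin.Properties using (toℕ<n)
open import Data.Integer.Base as ℤ using ()
import Data.Integer.Properties as ℤ
open import Data.Nat.Base as ℕ using (ℕ; zero; suc)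
import Data.Nat.Properties as ℕ
open import Data.Nat.Solver using () renaming (module +-*-Solver to ℕ-Solver)
open import Data.Product.Base using (∃; _×_; _,_; proj₁; proj₂)
open import Data.Sum.Base using (inj₁; inj₂)
open import Function.Base using (_∘_)
open import Level using (Level; 0ℓ)
import Relation.Binary.PropositionalEquality as ≡
open ≡ using (_≡_)

-- Write xₜ = t⁻ᵃ, so that f (a (i + j) + b) = Σ cₜ t^(-2a-b-a(j-1)) xₜ^(i-1).
-- Unimodular row operations replace xₜ^(i-1) by the Newton polynomial
-- (xₜ - x₁) ⋯ (xₜ - x_{i-1}), which vanishes for t < i and is otherwise at
-- most x₁ ⋯ x_{i-1} = ((i-1)!)⁻ᵃ in absolute value.  Since |cₜ| ≪ t and
-- 2a + b ≥ 3, the entries of row i are ≪ ((i-1)!)⁻ᵃ, and expanding the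
-- determinant gives |Hₙ| ≤ n! Dⁿ ∏_{i<n} (i!)⁻ᵃ.  Finally nⁱ ≤ 4ⁿ i! for
-- i ≤ n yields n^(a n²) |Hₙ|² ≤ e^(O(n²)).
--
-- The analysis is carried out along the rational approximations: at each
-- index of the Cauchy sequences the determinant lives in ℚ[i], where the
-- row operations are exact, and is measured by the norm |re| + |im|.

-- The obstacle is uniformity. Every hypothesis on the coefficients and on the values of f concerns
-- real numbers, so on approximants it holds only from an index that depends on the coefficient or
-- on the argument, and no single index serves a whole series. The Newton functional gets around
-- this: it is linear and enlarges errors in row i by at most 2^i, so for each entry the series can
-- be cut off at some M before an index k is chosen, and only finitely many conditions remain. The
-- estimate at a cutoff must then be independent of M, which is where the convergence of the sum of
-- t⁻² enters.
--
-- The determinant bound is squared because a n²/2 need not be an integer. After squaring, all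
-- exponents are natural numbers and every estimate up to the logarithm is an inequality in ℚ.

module NewtonRows {c ℓ : Level} (R : CommutativeRing c ℓ) where

  open CommutativeRing R hiding (zero)
  open import Algebra.Properties.Semiring.Sum semiring
  open import Algebra.Solver.Ring.NaturalCoefficients.Default commutativeSemiring
    using (solve; _:+_; _:*_; _:=_)
  open import Algebra.Properties.Semiring.Exp semiring using (_^_)
  open import Relation.Binary.Reasoning.Setoid setoid

  -- Determinants and row operations over a commutative ring.

  sgn : ℕ → Carrier
  sgn zero    = 1#
  sgn (suc n) = - sgn n

  -- Only the first n of the rows A 0, A 1, … enter.
  detRows : ∀ n → (ℕ → Fin n → Carrier) → Carrier
  detRows zero    A = 1#
  detRows (suc n) A = sum λ j →
    sgn (toℕ j) * A 0 j * detRows n λ i k → A (suc i) (punchIn j k)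

  detRows-cong : ∀ n {A B : ℕ → Fin n → Carrier} →
    (∀ i j → A i j ≈ B i j) → detRows n A ≈ detRows n B
  detRows-cong zero    A≈B = refl
  detRows-cong (suc n) A≈B = sum-cong-≋ {suc n} λ j →
    *-cong (*-congˡ {sgn (toℕ j)} (A≈B 0 j)) (detRows-cong n λ i k → A≈B (suc i) (punchIn j k))

  lift : ∀ {m n} → (Fin m → Fin n) → Fin (suc m) → Fin (suc n)
  lift φ zero    = zero
  lift φ (suc c) = suc (φ c)

  -- The columns left after deleting two. Minors are regarded as functions of this embedding, so
  -- that an induction can restrict them to embeddings that fix column zero.
  punchIn² : ∀ {n} → Fin (suc (suc n)) → Fin (suc n) → Fin n → Fin (suc (suc n))
  punchIn² j k c = punchIn j (punchIn k c)

  lift-punchIn² : ∀ {n} j k (c : Fin (suc n)) →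
    punchIn² (suc j) (suc k) c ≡ lift (punchIn² j k) c
  lift-punchIn² j k zero    = ≡.refl
  lift-punchIn² j k (suc c) = ≡.refl

  -- The terms of (0, k) and (k + 1, 0) cancel, and deleting these pairs
  -- leaves a sum of the same shape in one dimension less.
  alternating-sum : ∀ n (v : Fin (suc (suc n)) → Carrier)
    (M : (Fin n → Fin (suc (suc n))) → Carrier) →
    (∀ {φ ψ} → (∀ c → φ c ≡ ψ c) → M φ ≈ M ψ) →
    sum (λ j → sum λ k →
      sgn (toℕ j) * v j * (sgn (toℕ k) * v (punchIn j k) * M (punchIn² j k))) ≈ 0#
  alternating-sum n v M M-cong = begin
    sum (F zero) + sum (λ j → F (suc j) zero + sum (λ k → F (suc j) (suc k)))
      ≈⟨ +-congˡ (∑-distrib-+ (λ j → F (suc j) zero) (λ j → sum (λ k → F (suc j) (suc k)))) ⟩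
    sum (F zero) + (sum (λ j → F (suc j) zero) + sum (λ j → sum (λ k → F (suc j) (suc k))))
      ≈⟨ +-assoc _ _ _ ⟨
    sum (F zero) + sum (λ j → F (suc j) zero) + sum (λ j → sum (λ k → F (suc j) (suc k)))
      ≈⟨ +-cong (trans (sym (∑-distrib-+ (F zero) (λ j → F (suc j) zero)))
                  (trans (sum-cong-≋ cancel) (sum-replicate-zero (suc n))))
                (rest n v M M-cong) ⟩
    0# + 0# ≈⟨ +-identityʳ 0# ⟩
    0# ∎
    where
    F : Fin (suc (suc n)) → Fin (suc n) → Carrier
    F j k = sgn (toℕ j) * v j * (sgn (toℕ k) * v (punchIn j k) * M (punchIn² j k))

    cancel : ∀ k → F zero k + F (suc k) zero ≈ 0#
    cancel k = begin
      F zero k + F (suc k) zero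
        ≈⟨ solve 6 (λ o s t a b m →
              o :* a :* (s :* b :* m) :+ t :* b :* (o :* a :* m) := (s :+ t) :* (o :* a :* b :* m))
            refl 1# (sgn (toℕ k)) (- sgn (toℕ k)) (v zero) (v (suc k)) (M (suc ∘ punchIn k)) ⟩
      (sgn (toℕ k) + - sgn (toℕ k)) * (1# * v zero * v (suc k) * M (suc ∘ punchIn k))
        ≈⟨ *-congʳ (-‿inverseʳ (sgn (toℕ k))) ⟩
      0# * (1# * v zero * v (suc k) * M (suc ∘ punchIn k))
        ≈⟨ zeroˡ _ ⟩
      0# ∎

    -*- : ∀ s t a b m → - s * a * (- t * b * m) ≈ s * a * (t * b * m)
    -*- s t a b m = begin
      - s * a * (- t * b * m)
        ≈⟨ solve 5 (λ s t a b m → s :* a :* (t :* b :* m) := s :* t :* (a :* b :* m))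
             refl (- s) (- t) a b m ⟩
      - s * - t * (a * b * m)
        ≈⟨ *-congʳ (neg*neg s t) ⟩
      s * t * (a * b * m)
        ≈⟨ solve 5 (λ s t a b m → s :* t :* (a :* b :* m) := s :* a :* (t :* b :* m))
             refl s t a b m ⟩
      s * a * (t * b * m) ∎
      where
      open import Algebra.Properties.Ring ring using (-‿distribˡ-*; -‿distribʳ-*; -‿involutive)
      neg*neg : ∀ x y → - x * - y ≈ x * y
      neg*neg x y = trans (sym (-‿distribˡ-* x (- y)))
        (trans (-‿cong (sym (-‿distribʳ-* x y))) (-‿involutive (x * y)))

    rest : ∀ n (v : Fin (suc (suc n)) → Carrier)
      (M : (Fin n → Fin (suc (suc n))) → Carrier) →
      (∀ {φ ψ} → (∀ c → φ c ≡ ψ c) → M φ ≈ M ψ) →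
      sum (λ j → sum λ k → sgn (suc (toℕ j)) * v (suc j) *
        (sgn (suc (toℕ k)) * v (suc (punchIn j k)) * M (punchIn² (suc j) (suc k)))) ≈ 0#
    rest zero    v M M-cong = +-identityʳ 0#
    -- Both signs flip, so their product survives; the remaining embeddings all fix column zero and
    -- hence factor through `lift`.
    rest (suc n) v M M-cong = trans
      (sum-cong-≋ λ j → sum-cong-≋ λ k → trans
        (-*- (sgn (toℕ j)) (sgn (toℕ k)) (v (suc j)) (v (suc (punchIn j k))) _)
        (*-congˡ (*-congˡ (M-cong (lift-punchIn² j k)))))
      (alternating-sum n (v ∘ suc) (M ∘ lift) λ φ≗ψ →
        M-cong λ { zero → ≡.refl ; (suc c) → ≡.cong suc (φ≗ψ c) })

  infixr 5 _∷ʳᵒʷ_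

  _∷ʳᵒʷ_ : ∀ {n} → (Fin n → Carrier) → (ℕ → Fin n → Carrier) → ℕ → Fin n → Carrier
  (u ∷ʳᵒʷ A) zero    = u
  (u ∷ʳᵒʷ A) (suc i) = A i

  -- A shear adds to each row a multiple of the row just above it, so this adjacent case is the only
  -- form of alternation that `detRows-shear` calls on.
  detRows-top-equal : ∀ n (u : Fin (suc (suc n)) → Carrier) (A : ℕ → Fin (suc (suc n)) → Carrier) →
    detRows (suc (suc n)) (u ∷ʳᵒʷ u ∷ʳᵒʷ A) ≈ 0#
  detRows-top-equal n u A = trans
    (sum-cong-≋ λ j → *-distribˡ-sum {suc n} (sgn (toℕ j) * u j) λ k →
        sgn (toℕ k) * u (punchIn j k) * detRows n λ i c → A i (punchIn² j k c))
    (alternating-sum n u (λ φ → detRows n λ i c → A i (φ c)) λ φ≗ψ →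
      detRows-cong n λ i c → reflexive (≡.cong (A i) (φ≗ψ c)))

  detRows-linear : ∀ n x (u v : Fin (suc n) → Carrier) (A : ℕ → Fin (suc n) → Carrier) →
    detRows (suc n) ((λ j → u j + x * v j) ∷ʳᵒʷ A) ≈
    detRows (suc n) (u ∷ʳᵒʷ A) + x * detRows (suc n) (v ∷ʳᵒʷ A)
  detRows-linear n x u v A = begin
    sum (λ j → s j * (u j + x * v j) * m j)
      ≈⟨ sum-cong-≋ (λ j → solve 5 (λ s u x v m →
            s :* (u :+ x :* v) :* m := s :* u :* m :+ x :* (s :* v :* m))
            refl (s j) (u j) x (v j) (m j)) ⟩
    sum (λ j → s j * u j * m j + x * (s j * v j * m j))
      ≈⟨ ∑-distrib-+ (λ j → s j * u j * m j) (λ j → x * (s j * v j * m j)) ⟩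
    sum (λ j → s j * u j * m j) + sum (λ j → x * (s j * v j * m j))
      ≈⟨ +-congˡ (*-distribˡ-sum x (λ j → s j * v j * m j)) ⟨
    sum (λ j → s j * u j * m j) + x * sum (λ j → s j * v j * m j) ∎
    where
    s m : Fin (suc n) → Carrier
    s j = sgn (toℕ j)
    m j = detRows n λ i k → A i (punchIn j k)

  shear : ∀ {n} → Carrier → (ℕ → Fin n → Carrier) → ℕ → Fin n → Carrier
  shear x A i j = A (suc i) j + x * A i j

  -- Expand along row 0 and split the top row A 1 + x A 0 of each minor by linearity. The A 1 parts
  -- are the induction hypothesis for the minors; the A 0 parts reassemble to x times a determinant
  -- with two equal top rows.
  detRows-shear : ∀ n x (A : ℕ → Fin n → Carrier) →
    detRows n (A 0 ∷ʳᵒʷ shear x A) ≈ detRows n A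
  detRows-shear zero          x A = refl
  detRows-shear (suc zero)    x A = refl
  detRows-shear (suc (suc n)) x A = begin
    sum (λ j → s j * detRows (suc n) (minor j (shear x A)))
      ≈⟨ sum-cong-≋ {suc (suc n)} (λ j → *-congˡ {s j} (expand (detRows-shear (suc n) x) j)) ⟩
    sum (λ j → s j * (d j + x * e j))
      ≈⟨ sum-cong-≋ (λ j → solve 4 (λ s d x e → s :* (d :+ x :* e) := s :* d :+ x :* (s :* e))
           refl (s j) (d j) x (e j)) ⟩
    sum (λ j → s j * d j + x * (s j * e j))
      ≈⟨ ∑-distrib-+ (λ j → s j * d j) (λ j → x * (s j * e j)) ⟩
    sum (λ j → s j * d j) + sum (λ j → x * (s j * e j))
      ≈⟨ +-congˡ (*-distribˡ-sum x (λ j → s j * e j)) ⟨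
    sum (λ j → s j * d j) + x * sum (λ j → s j * e j)
      ≈⟨ +-congˡ (trans (*-congˡ (trans
           (sum-cong-≋ {suc (suc n)} λ j → *-congˡ {s j} (detRows-cong (suc n)
             {minor j A 0 ∷ʳᵒʷ minor j (shear x (A ∘ suc))}
             {minor j (A 0 ∷ʳᵒʷ shear x (A ∘ suc))}
             λ { zero k → refl ; (suc i) k → refl }))
           (detRows-top-equal n (A 0) (shear x (A ∘ suc))))) (zeroʳ x)) ⟩
    sum (λ j → s j * d j) + 0#
      ≈⟨ +-identityʳ _ ⟩
    sum (λ j → s j * d j) ∎
    where
    minor : Fin (suc (suc n)) → (ℕ → Fin (suc (suc n)) → Carrier) → ℕ → Fin (suc n) → Carrier
    minor j B i k = B i (punchIn j k)
    s d e : Fin (suc (suc n)) → Carrier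
    s j = sgn (toℕ j) * A 0 j
    d j = detRows (suc n) (minor j (A ∘ suc))
    e j = detRows (suc n) (minor j A 0 ∷ʳᵒʷ minor j (shear x (A ∘ suc)))
    expand : (∀ B → detRows (suc n) (B 0 ∷ʳᵒʷ shear x B) ≈ detRows (suc n) B) →
      ∀ j → detRows (suc n) (minor j (shear x A)) ≈ d j + x * e j
    expand ih j = begin
      detRows (suc n) (minor j (shear x A))
        ≈⟨ detRows-cong (suc n) {minor j (shear x A)}
             {(λ k → B 0 k + x * minor j A 0 k) ∷ʳᵒʷ shear x B}
             (λ { zero k → refl ; (suc i) k → refl }) ⟩
      detRows (suc n) ((λ k → B 0 k + x * minor j A 0 k) ∷ʳᵒʷ shear x B)
        ≈⟨ detRows-linear n x (B 0) (minor j A 0) (shear x B) ⟩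
      detRows (suc n) (B 0 ∷ʳᵒʷ shear x B) + x * e j
        ≈⟨ +-congʳ (ih B) ⟩
      d j + x * e j ∎
      where B = minor j (A ∘ suc)

  -- The i-th value applies the functional xʲ ↦ ρ j to the Newton polynomial
  -- (x + z 0) ⋯ (x + z (i - 1)).
  newton : (ℕ → Carrier) → (ℕ → Carrier) → ℕ → Carrier
  newton ρ z zero    = ρ 0
  newton ρ z (suc i) = newton (λ l → ρ (suc l) + z 0 * ρ l) (z ∘ suc) i

  -- Row 0 is already in Newton form. The rows below are Newton rows of the sheared matrix for the
  -- shifted nodes, so induction on the minors strips all further steps and a single shear is left.
  detRows-newton : ∀ n (A : ℕ → Fin n → Carrier) z →
    detRows n (λ i j → newton (λ l → A l j) z i) ≈ detRows n A
  detRows-newton zero    A z = refl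
  detRows-newton (suc n) A z = trans
    (sum-cong-≋ {suc n} λ j → *-congˡ {sgn (toℕ j) * A 0 j} (detRows-newton n (λ i k → shear (z 0) A i (punchIn j k)) (z ∘ suc)))
    (detRows-shear (suc n) (z 0) A)

  newton-cong : ∀ {ρ σ} → (∀ l → ρ l ≈ σ l) → ∀ z i → newton ρ z i ≈ newton σ z i
  newton-cong h z zero    = h 0
  newton-cong h z (suc i) = newton-cong (λ l → +-cong (h (suc l)) (*-congˡ (h l))) (z ∘ suc) i

  newton-+ : ∀ ρ σ z i → newton (λ l → ρ l + σ l) z i ≈ newton ρ z i + newton σ z i
  newton-+ ρ σ z zero    = refl
  newton-+ ρ σ z (suc i) = trans
    (newton-cong (λ l → solve 5 (λ a b z c d →
        a :+ b :+ z :* (c :+ d) := a :+ z :* c :+ (b :+ z :* d))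
        refl (ρ (suc l)) (σ (suc l)) (z 0) (ρ l) (σ l)) (z ∘ suc) i)
    (newton-+ _ _ (z ∘ suc) i)

  shiftedProduct : Carrier → (ℕ → Carrier) → ℕ → Carrier
  shiftedProduct x z zero    = 1#
  shiftedProduct x z (suc i) = (x + z 0) * shiftedProduct x (z ∘ suc) i

  -- On a geometric sequence the functional is w times evaluation at x, so every shear contributes
  -- just a linear factor.
  newton-geometric : ∀ w x z i → newton (λ l → w * x ^ l) z i ≈ w * shiftedProduct x z i
  newton-geometric w x z zero    = refl
  newton-geometric w x z (suc i) = begin
    newton (λ l → w * (x * x ^ l) + z 0 * (w * x ^ l)) (z ∘ suc) i
      ≈⟨ newton-cong (λ l → solve 4 (λ w x p z →
           w :* (x :* p) :+ z :* (w :* p) := w :* (x :+ z) :* p) refl w x (x ^ l) (z 0)) (z ∘ suc) i ⟩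
    newton (λ l → w * (x + z 0) * x ^ l) (z ∘ suc) i
      ≈⟨ newton-geometric (w * (x + z 0)) x (z ∘ suc) i ⟩
    w * (x + z 0) * shiftedProduct x (z ∘ suc) i
      ≈⟨ *-assoc w _ _ ⟩
    w * ((x + z 0) * shiftedProduct x (z ∘ suc) i) ∎

open import Data.Rational.Base
open import Data.Rational.Properties
open import Data.Rational.Solver using (module +-*-Solver)
open import Data.Rational.Unnormalised.Base as ℚᵘ using (mkℚᵘ)
import Data.Rational.Unnormalised.Properties as ℚᵘ
open ≡ using (refl; sym; trans; cong; cong₂; subst; subst₂)
open import Algebra.Properties.CommutativeSemiring.Exp
  (CommutativeRing.commutativeSemiring +-*-commutativeRing)
  using (_^_; ^-homo-*; ^-distrib-*; ^-assocʳ)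
open +-*-Solver using (solve; _:+_; _:*_; _:-_; :-_; con; _:=_)
open ℕ-Solver using () renaming
  (solve to solveℕ; _:+_ to _⊕_; _:*_ to _⊗_; con to conℕ; _:=_ to _⊜_)

-- Gaussian rationals.

infixl 6 _+ᵍ_
infixl 7 _*ᵍ_
infix  8 -ᵍ_

ℚ[i] : Set
ℚ[i] = ℚ × ℚ

_+ᵍ_ _*ᵍ_ : ℚ[i] → ℚ[i] → ℚ[i]
(a , b) +ᵍ (c , d) = a + c , b + d
(a , b) *ᵍ (c , d) = a * c - b * d , a * d + b * c

-ᵍ_ : ℚ[i] → ℚ[i]
-ᵍ (a , b) = - a , - b

ofℚ : ℚ → ℚ[i]
ofℚ q = q , 0ℚ

gaussianRationals : CommutativeRing 0ℓ 0ℓ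
gaussianRationals = record
  { Carrier = ℚ[i]
  ; _≈_ = _≡_
  ; _+_ = _+ᵍ_
  ; _*_ = _*ᵍ_
  ; -_ = -ᵍ_
  ; 0# = ofℚ 0ℚ
  ; 1# = ofℚ 1ℚ
  ; isCommutativeRing = record
    { isRing = record
      { +-isAbelianGroup = record
        { isGroup = record
          { isMonoid = record
            { isSemigroup = record
              { isMagma = record { isEquivalence = ≡.isEquivalence ; ∙-cong = cong₂ _+ᵍ_ }
              ; assoc = λ (a , b) (c , d) (e , f) → cong₂ _,_ (+-assoc a c e) (+-assoc b d f)
              }
            ; identity = (λ (a , b) → cong₂ _,_ (+-identityˡ a) (+-identityˡ b))
                       , (λ (a , b) → cong₂ _,_ (+-identityʳ a) (+-identityʳ b))
            }
          ; inverse = (λ (a , b) → cong₂ _,_ (+-inverseˡ a) (+-inverseˡ b))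
                    , (λ (a , b) → cong₂ _,_ (+-inverseʳ a) (+-inverseʳ b))
          ; ⁻¹-cong = cong -ᵍ_
          }
        ; comm = λ (a , b) (c , d) → cong₂ _,_ (+-comm a c) (+-comm b d)
        }
      ; *-cong = cong₂ _*ᵍ_
      ; *-assoc = λ (a , b) (c , d) (e , f) → cong₂ _,_
          (solve 6 (λ a b c d e f → (a :* c :- b :* d) :* e :- (a :* d :+ b :* c) :* f
             := a :* (c :* e :- d :* f) :- b :* (c :* f :+ d :* e)) refl a b c d e f)
          (solve 6 (λ a b c d e f → (a :* c :- b :* d) :* f :+ (a :* d :+ b :* c) :* e
             := a :* (c :* f :+ d :* e) :+ b :* (c :* e :- d :* f)) refl a b c d e f)
      ; *-identity = identityˡ , λ z → trans (*ᵍ-comm z (ofℚ 1ℚ)) (identityˡ z)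
      ; distrib = distribˡ
                , λ x y z → trans (*ᵍ-comm (y +ᵍ z) x)
                    (trans (distribˡ x y z) (cong₂ _+ᵍ_ (*ᵍ-comm x y) (*ᵍ-comm x z)))
      }
    ; *-comm = *ᵍ-comm
    }
  }
  where
  *ᵍ-comm : ∀ w z → w *ᵍ z ≡ z *ᵍ w
  *ᵍ-comm (a , b) (c , d) = cong₂ _,_
    (solve 4 (λ a b c d → a :* c :- b :* d := c :* a :- d :* b) refl a b c d)
    (solve 4 (λ a b c d → a :* d :+ b :* c := c :* b :+ d :* a) refl a b c d)
  identityˡ : ∀ z → ofℚ 1ℚ *ᵍ z ≡ z
  identityˡ (a , b) = cong₂ _,_
    (solve 2 (λ a b → con 1ℚ :* a :- con 0ℚ :* b := a) refl a b)
    (solve 2 (λ a b → con 1ℚ :* b :+ con 0ℚ :* a := b) refl a b)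
  distribˡ : ∀ x y z → x *ᵍ (y +ᵍ z) ≡ x *ᵍ y +ᵍ x *ᵍ z
  distribˡ (a , b) (c , d) (e , f) = cong₂ _,_
    (solve 6 (λ a b c d e f → a :* (c :+ e) :- b :* (d :+ f)
       := (a :* c :- b :* d) :+ (a :* e :- b :* f)) refl a b c d e f)
    (solve 6 (λ a b c d e f → a :* (d :+ f) :+ b :* (c :+ e)
       := (a :* d :+ b :* c) :+ (a :* f :+ b :* e)) refl a b c d e f)

-- Norm estimates for determinants and Newton functionals.

module 𝔾 = CommutativeRing gaussianRationals
open NewtonRows gaussianRationals
open import Algebra.Properties.Semiring.Sum 𝔾.semiring using (sum; sum-cong-≗)
open import Algebra.Properties.Semiring.Exp 𝔾.semiring using () renaming (_^_ to _^ᵍ_)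

-- Unlike the modulus this norm is rational; it is still submultiplicative and exceeds the modulus
-- by a factor of at most the square root of 2.
∥_∥ : ℚ[i] → ℚ
∥ a , b ∥ = ∣ a ∣ + ∣ b ∣

0≤∥∥ : ∀ z → 0ℚ ≤ ∥ z ∥
0≤∥∥ (a , b) = 0≤+ (0≤∣p∣ a) (0≤∣p∣ b)

∥∥-+ : ∀ w z → ∥ w +ᵍ z ∥ ≤ ∥ w ∥ + ∥ z ∥
∥∥-+ (a , b) (c , d) = ≤-trans (+-mono-≤ (∣p+q∣≤∣p∣+∣q∣ a c) (∣p+q∣≤∣p∣+∣q∣ b d))
  (≤-reflexive (solve 4 (λ a b c d → (a :+ c) :+ (b :+ d) := (a :+ b) :+ (c :+ d)) refl
    (∣ a ∣) (∣ b ∣) (∣ c ∣) (∣ d ∣)))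

∥∥-neg : ∀ z → ∥ -ᵍ z ∥ ≡ ∥ z ∥
∥∥-neg (a , b) = cong₂ _+_ (∣-p∣≡∣p∣ a) (∣-p∣≡∣p∣ b)

∥∥-* : ∀ w z → ∥ w *ᵍ z ∥ ≤ ∥ w ∥ * ∥ z ∥
∥∥-* (a , b) (c , d) = begin
  ∣ a * c - b * d ∣ + ∣ a * d + b * c ∣
    ≤⟨ +-mono-≤ (∣p+q∣≤∣p∣+∣q∣ (a * c) (- (b * d))) (∣p+q∣≤∣p∣+∣q∣ (a * d) (b * c)) ⟩
  (∣ a * c ∣ + ∣ - (b * d) ∣) + (∣ a * d ∣ + ∣ b * c ∣)
    ≡⟨ cong₂ _+_ (cong₂ _+_ (∣p*q∣≡∣p∣*∣q∣ a c) (trans (∣-p∣≡∣p∣ (b * d)) (∣p*q∣≡∣p∣*∣q∣ b d)))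
                 (cong₂ _+_ (∣p*q∣≡∣p∣*∣q∣ a d) (∣p*q∣≡∣p∣*∣q∣ b c)) ⟩
  (∣ a ∣ * ∣ c ∣ + ∣ b ∣ * ∣ d ∣) + (∣ a ∣ * ∣ d ∣ + ∣ b ∣ * ∣ c ∣)
    ≡⟨ solve 4 (λ a b c d → (a :* c :+ b :* d) :+ (a :* d :+ b :* c) := (a :+ b) :* (c :+ d)) refl
         (∣ a ∣) (∣ b ∣) (∣ c ∣) (∣ d ∣) ⟩
  (∣ a ∣ + ∣ b ∣) * (∣ c ∣ + ∣ d ∣) ∎
  where open ≤-Reasoning

∥∥-*-mono : ∀ {p q} w z → ∥ w ∥ ≤ p → ∥ z ∥ ≤ q → ∥ w *ᵍ z ∥ ≤ p * q
∥∥-*-mono w z w≤p z≤q = ≤-trans (∥∥-* w z)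
  (*-mono (≤-trans (0≤∥∥ w) w≤p) (0≤∥∥ z) w≤p z≤q)

∥∥-+-mono : ∀ {p q} w z → ∥ w ∥ ≤ p → ∥ z ∥ ≤ q → ∥ w +ᵍ z ∥ ≤ p + q
∥∥-+-mono w z w≤p z≤q = ≤-trans (∥∥-+ w z) (+-mono-≤ w≤p z≤q)

∥ofℚ∥ : ∀ {q} → 0ℚ ≤ q → ∥ ofℚ q ∥ ≡ q
∥ofℚ∥ {q} 0≤q = trans (+-identityʳ ∣ q ∣) (0≤p⇒∣p∣≡p 0≤q)

∥sgn∥ : ∀ n → ∥ sgn n ∥ ≡ 1ℚ
∥sgn∥ zero    = refl
∥sgn∥ (suc n) = trans (∥∥-neg (sgn n)) (∥sgn∥ n)

∥sum∥≤ : ∀ {n} (u : Fin n → ℚ[i]) B → (∀ i → ∥ u i ∥ ≤ B) → ∥ sum u ∥ ≤ ι n * B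
∥sum∥≤ {zero}  u B h = ≤-reflexive (sym (*-zeroˡ B))
∥sum∥≤ {suc n} u B h = ≤-trans
  (∥∥-+-mono (u zero) (sum (u ∘ suc)) (h zero) (∥sum∥≤ (u ∘ suc) B (h ∘ suc)))
  (≤-reflexive (solve 2 (λ n B → B :+ n :* B := (con 1ℚ :+ n) :* B) refl (ι n) B))

∏ : (ℕ → ℚ) → ℕ → ℚ
∏ β zero    = 1ℚ
∏ β (suc n) = β 0 * ∏ (β ∘ suc) n

0≤∏ : ∀ {β} → (∀ i → 0ℚ ≤ β i) → ∀ n → 0ℚ ≤ ∏ β n
0≤∏ h zero    = <⇒≤ 0<1
0≤∏ h (suc n) = 0≤* (h 0) (0≤∏ (h ∘ suc) n)

0<∏ : ∀ {β} → (∀ i → 0ℚ < β i) → ∀ n → 0ℚ < ∏ β n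
0<∏ h zero    = 0<1
0<∏ h (suc n) = 0<* (h 0) (0<∏ (h ∘ suc) n)

ι-+ : ∀ m n → ι (m ℕ.+ n) ≡ ι m + ι n
ι-+ zero    n = sym (+-identityˡ (ι n))
ι-+ (suc m) n = trans (cong (_+_ 1ℚ) (ι-+ m n)) (sym (+-assoc 1ℚ (ι m) (ι n)))

ι-* : ∀ m n → ι (m ℕ.* n) ≡ ι m * ι n
ι-* zero    n = sym (*-zeroˡ (ι n))
ι-* (suc m) n = trans (ι-+ n (m ℕ.* n)) (trans (cong (_+_ (ι n)) (ι-* m n))
  (solve 2 (λ m n → n :+ m :* n := (con 1ℚ :+ m) :* n) refl (ι m) (ι n)))

ι-^ : ∀ m n → ι (m ℕ.^ n) ≡ ι m ^ n
ι-^ m zero    = refl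
ι-^ m (suc n) = trans (ι-* m (m ℕ.^ n)) (cong (ι m *_) (ι-^ m n))

ι-mono : ∀ {m n} → m ℕ.≤ n → ι m ≤ ι n
ι-mono {n = n} ℕ.z≤n   = 0≤ι n
ι-mono (ℕ.s≤s m≤n) = +-monoʳ-≤ 1ℚ (ι-mono m≤n)

-- The full expansion has n! terms, each a product of one entry from every row.
∥detRows∥≤ : ∀ n (A : ℕ → Fin n → ℚ[i]) (β : ℕ → ℚ) → (∀ i → 0ℚ ≤ β i) →
  (∀ i → i ℕ.< n → ∀ j → ∥ A i j ∥ ≤ β i) →
  ∥ detRows n A ∥ ≤ ι (n ℕ.!) * ∏ β n
∥detRows∥≤ zero    A β 0≤β h = ≤-refl
∥detRows∥≤ (suc n) A β 0≤β h = begin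
  ∥ detRows (suc n) A ∥
    ≤⟨ ∥sum∥≤ summand (1ℚ * β 0 * (ι (n ℕ.!) * ∏ (β ∘ suc) n)) term ⟩
  ι (suc n) * (1ℚ * β 0 * (ι (n ℕ.!) * ∏ (β ∘ suc) n))
    ≡⟨ solve 4 (λ m b f p → m :* (con 1ℚ :* b :* (f :* p)) := m :* f :* (b :* p)) refl
         (ι (suc n)) (β 0) (ι (n ℕ.!)) (∏ (β ∘ suc) n) ⟩
  ι (suc n) * ι (n ℕ.!) * ∏ β (suc n)
    ≡⟨ cong (_* ∏ β (suc n)) (ι-* (suc n) (n ℕ.!)) ⟨
  ι (suc n ℕ.!) * ∏ β (suc n) ∎
  where
  open ≤-Reasoning
  summand : Fin (suc n) → ℚ[i]
  summand j = sgn (toℕ j) *ᵍ A 0 j *ᵍ detRows n (λ i k → A (suc i) (punchIn j k))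
  term : ∀ j → ∥ summand j ∥ ≤ 1ℚ * β 0 * (ι (n ℕ.!) * ∏ (β ∘ suc) n)
  term j = ∥∥-*-mono (sgn (toℕ j) *ᵍ A 0 j) (detRows n λ i k → A (suc i) (punchIn j k))
    (∥∥-*-mono (sgn (toℕ j)) (A 0 j) (≤-reflexive (∥sgn∥ (toℕ j))) (h 0 (ℕ.s≤s ℕ.z≤n) j))
    (∥detRows∥≤ n (λ i k → A (suc i) (punchIn j k)) (β ∘ suc) (0≤β ∘ suc)
      λ i i<n k → h (suc i) (ℕ.s≤s i<n) (punchIn j k))

-- Each shear at most doubles the bound. This crude estimate is meant for truncation errors, which
-- can be made small after i is fixed.
∥newton∥≤ : ∀ {ε} ρ z i → (∀ l → ∥ z l ∥ ≤ 1ℚ) → (∀ l → l ℕ.≤ i → ∥ ρ l ∥ ≤ ε) →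
  ∥ newton ρ z i ∥ ≤ 2ℚ ^ i * ε
∥newton∥≤ {ε} ρ z zero    z≤1 h = ≤-trans (h 0 ℕ.z≤n) (≤-reflexive (sym (*-identityˡ ε)))
∥newton∥≤ {ε} ρ z (suc i) z≤1 h = ≤-trans
  (∥newton∥≤ (λ l → ρ (suc l) +ᵍ z 0 *ᵍ ρ l) (z ∘ suc) i (z≤1 ∘ suc) λ l l≤i →
    ∥∥-+-mono (ρ (suc l)) (z 0 *ᵍ ρ l) (h (suc l) (ℕ.s≤s l≤i))
      (∥∥-*-mono (z 0) (ρ l) (z≤1 0) (h l (ℕ.m≤n⇒m≤1+n l≤i))))
  (≤-reflexive (solve 2 (λ p ε → p :* (ε :+ con 1ℚ :* ε) := con 2ℚ :* p :* ε) refl (2ℚ ^ i) ε))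

-- If x is one of the nodes y l with l < i the product vanishes, and
-- otherwise every factor lies between - y l and 0.
∥shiftedProduct∥≤ : ∀ (y : ℕ → ℚ) → (∀ l → 0ℚ ≤ y l) → (∀ {l m} → l ℕ.≤ m → y m ≤ y l) →
  ∀ s i → ∥ shiftedProduct (ofℚ (y s)) (λ l → ofℚ (- y l)) i ∥ ≤ ∏ y i
∥shiftedProduct∥≤ y 0≤y anti s       zero    = ≤-refl
∥shiftedProduct∥≤ y 0≤y anti zero    (suc i) = ≤-trans
  (∥∥-*-mono {0ℚ} {∥ P ∥} (ofℚ (y 0) +ᵍ ofℚ (- y 0)) P
    (≤-reflexive (cong (λ q → ∥ ofℚ q ∥) {y 0 - y 0} {0ℚ} (+-inverseʳ (y 0)))) ≤-refl)
  (subst (_≤ ∏ y (suc i)) (sym (*-zeroˡ ∥ P ∥)) (0≤∏ 0≤y (suc i)))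
  where P = shiftedProduct (ofℚ (y 0)) (λ l → ofℚ (- y (suc l))) i
∥shiftedProduct∥≤ y 0≤y anti (suc s) (suc i) =
  ∥∥-*-mono (ofℚ (y (suc s)) +ᵍ ofℚ (- y 0)) _ factor
    (∥shiftedProduct∥≤ (y ∘ suc) (0≤y ∘ suc) (anti ∘ ℕ.s≤s) s i)
  where
  factor : ∥ ofℚ (y (suc s)) +ᵍ ofℚ (- y 0) ∥ ≤ y 0
  factor = subst (_≤ y 0) (sym (+-identityʳ _)) (abs-intro
    (≤-trans (anti ℕ.z≤n) (≤-from (y 0) (0≤y 0) refl))
    (≤-from (y (suc s)) (0≤y (suc s)) (+-comm (y 0) (y (suc s)))))

-- Reciprocals, interpolation nodes and inverse squares.

recip : ℕ → ℚ
recip s = ℤ.+ 1 / suc s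

0<recip : ∀ s → 0ℚ < recip s
0<recip s = positive⁻¹ (recip s) {{normalize-pos 1 (suc s)}}

0≤recip : ∀ s → 0ℚ ≤ recip s
0≤recip s = <⇒≤ (0<recip s)

ι*recip : ∀ s → ι (suc s) * recip s ≡ 1ℚ
ι*recip s = trans (cong (_* recip s) (ι≡/1 (suc s))) (toℚᵘ-injective
  (ℚᵘ.≃-trans (toℚᵘ-homo-* (ℤ.+ suc s / 1) (recip s))
  (ℚᵘ.≃-trans (ℚᵘ.*-cong (toℚᵘ-fromℚᵘ (mkℚᵘ (ℤ.+ suc s) 0)) (toℚᵘ-fromℚᵘ (mkℚᵘ (ℤ.+ 1) s)))
  (ℚᵘ.*≡* (trans (ℤ.*-identityʳ _) (trans (ℤ.*-identityʳ (ℤ.+ suc s))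
     (sym (trans (ℤ.*-identityˡ _) (ℤ.*-identityˡ (ℤ.+ suc s))))))))))

recip-anti : ∀ {l m} → l ℕ.≤ m → recip m ≤ recip l
recip-anti {l} {m} l≤m = begin
  recip m                       ≡⟨ *-identityʳ (recip m) ⟨
  recip m * 1ℚ                  ≡⟨ cong (recip m *_) (ι*recip l) ⟨
  recip m * (ι (suc l) * recip l)
    ≤⟨ *-monoˡ (recip m) (0≤recip m) (*-monoʳ (recip l) (0≤recip l) (ι-mono (ℕ.s≤s l≤m))) ⟩
  recip m * (ι (suc m) * recip l)
    ≡⟨ solve 3 (λ p m q → p :* (m :* q) := m :* p :* q) refl (recip m) (ι (suc m)) (recip l) ⟩
  ι (suc m) * recip m * recip l ≡⟨ cong (_* recip l) (ι*recip m) ⟩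
  1ℚ * recip l                  ≡⟨ *-identityˡ (recip l) ⟩
  recip l                       ∎
  where open ≤-Reasoning

recip≤1 : ∀ s → recip s ≤ 1ℚ
recip≤1 s = recip-anti {0} {s} ℕ.z≤n

-- The partial fraction 1/(s+1) - 1/(s+2) = 1/((s+1)(s+2)), which lets the sum of inverse squares
-- telescope.
recip-suc : ∀ s → recip (suc s) + recip s * recip (suc s) ≡ recip s
recip-suc s = begin
  q + p * q                    ≡⟨ cong (_+ p * q) (trans (cong (q *_) (ι*recip s)) (*-identityʳ q)) ⟨
  q * (ι (suc s) * p) + p * q
    ≡⟨ solve 3 (λ p q n → q :* ((con 1ℚ :+ n) :* p) :+ p :* q := p :* ((con 1ℚ :+ (con 1ℚ :+ n)) :* q))
         refl p q (ι s) ⟩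
  p * (ι (suc (suc s)) * q)    ≡⟨ cong (p *_) (ι*recip (suc s)) ⟩
  p * 1ℚ                       ≡⟨ *-identityʳ p ⟩
  p                            ∎
  where
  open ≡.≡-Reasoning
  p = recip s
  q = recip (suc s)

-- Indices start at zero: this is the x of the overview at t = l + 1.
node : ℕ → ℕ → ℚ
node a l = recip l ^ a

0≤node : ∀ a l → 0ℚ ≤ node a l
0≤node a l = 0≤^ a (0≤recip l)

0<node : ∀ a l → 0ℚ < node a l
0<node a l = 0<^ a (0<recip l)

node-anti : ∀ a {l m} → l ℕ.≤ m → node a m ≤ node a l
node-anti a {l} {m} l≤m = ^-mono a (0≤recip m) (recip-anti l≤m)

sumInvSquares : ℕ → ℚ
sumInvSquares zero    = 0ℚ
sumInvSquares (suc M) = sumInvSquares M + recip M * recip M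

-- The extra reciprocal makes the induction close: for consecutive reciprocals p and q one has q * q
-- ≤ p * q = p - q, so the left side never increases.
sumInvSquares+recip≤2 : ∀ M → sumInvSquares (suc M) + recip M ≤ 2ℚ
sumInvSquares+recip≤2 zero    = ≤-refl
sumInvSquares+recip≤2 (suc M) = ≤-trans (≤-from ((p - q) * q) (0≤* (gap (recip-anti {M} {suc M} (ℕ.n≤1+n M))) (0≤recip (suc M)))
  (trans (solve 3 (λ s p q → s :+ q :* q :+ q :+ (p :- q) :* q := s :+ (q :+ p :* q)) refl
           (sumInvSquares (suc M)) p q)
         (cong (_+_ (sumInvSquares (suc M))) (recip-suc M))))
  (sumInvSquares+recip≤2 M)
  where
  p = recip M
  q = recip (suc M)

sumInvSquares≤2 : ∀ M → sumInvSquares M ≤ 2ℚ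
sumInvSquares≤2 zero    = nonNegative⁻¹ 2ℚ
sumInvSquares≤2 (suc M) = ≤-trans (≤-from (recip M) (0≤recip M) refl) (sumInvSquares+recip≤2 M)

-- Newton rows of truncated Dirichlet series.

ofℚ-* : ∀ p q → ofℚ (p * q) ≡ ofℚ p *ᵍ ofℚ q
ofℚ-* p q = cong₂ _,_
  (solve 2 (λ p q → p :* q := p :* q :- con 0ℚ :* con 0ℚ) refl p q)
  (solve 2 (λ p q → con 0ℚ := p :* con 0ℚ :+ con 0ℚ :* q) refl p q)

ofℚ-^ : ∀ p n → ofℚ (p ^ n) ≡ ofℚ p ^ᵍ n
ofℚ-^ p zero    = refl
ofℚ-^ p (suc n) = trans (ofℚ-* p (p ^ n)) (cong (ofℚ p *ᵍ_) (ofℚ-^ p n))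

dirichletPartial : (ℕ → ℚ[i]) → ℕ → ℕ → ℚ[i]
dirichletPartial c m zero    = ofℚ 0ℚ
dirichletPartial c m (suc M) = dirichletPartial c m M +ᵍ c (suc M) *ᵍ ofℚ (recip M ^ m)

module _ (c : ℕ → ℚ[i]) (a e : ℕ) (3≤e : 3 ℕ.≤ e) where

  negNode : ℕ → ℚ[i]
  negNode l = ofℚ (- node a l)

  -- For t = s + 1 the term is geometric in l, with ratio `node a s` and weight c t^(-e). As e is at
  -- least 3, the bound D t on the coefficient leaves a weight of at most D/t², which is summable.
  ∥newton-term∥≤ : ∀ D s i → 0ℚ ≤ D → ∥ c (suc s) ∥ ≤ D * ι (suc s) →
    ∥ newton (λ l → c (suc s) *ᵍ ofℚ (recip s ^ (e ℕ.+ a ℕ.* l))) negNode i ∥ ≤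
    D * (recip s * recip s) * ∏ (node a) i
  ∥newton-term∥≤ D s i 0≤D c≤ = subst (λ z → ∥ z ∥ ≤ D * (recip s * recip s) * ∏ (node a) i)
    (sym (trans (newton-cong geometric negNode i) (newton-geometric w (ofℚ (node a s)) negNode i)))
    (∥∥-*-mono w (shiftedProduct (ofℚ (node a s)) negNode i) w≤
      (∥shiftedProduct∥≤ (node a) (0≤node a) (node-anti a) s i))
    where
    open ≤-Reasoning
    w = c (suc s) *ᵍ ofℚ (recip s ^ e)
    geometric : ∀ l → c (suc s) *ᵍ ofℚ (recip s ^ (e ℕ.+ a ℕ.* l)) ≡ w *ᵍ ofℚ (node a s) ^ᵍ l
    geometric l = trans (cong (c (suc s) *ᵍ_) (trans
        (cong ofℚ (trans (^-homo-* (recip s) e (a ℕ.* l))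
          (cong (recip s ^ e *_) (sym (^-assocʳ (recip s) a l)))))
        (trans (ofℚ-* (recip s ^ e) (node a s ^ l)) (cong (ofℚ (recip s ^ e) *ᵍ_) (ofℚ-^ (node a s) l)))))
      (sym (𝔾.*-assoc (c (suc s)) (ofℚ (recip s ^ e)) (ofℚ (node a s) ^ᵍ l)))
    w≤ : ∥ w ∥ ≤ D * (recip s * recip s)
    w≤ = begin
      ∥ w ∥
        ≤⟨ ∥∥-*-mono (c (suc s)) (ofℚ (recip s ^ e)) c≤
             (≤-trans (≤-reflexive (∥ofℚ∥ (0≤^ e (0≤recip s)))) (^-anti (0≤recip s) (recip≤1 s) 3≤e)) ⟩
      D * ι (suc s) * recip s ^ 3
        ≡⟨ solve 3 (λ D n r → D :* n :* (r :* (r :* (r :* con 1ℚ))) := D :* (r :* r) :* (n :* r))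
             refl D (ι (suc s)) (recip s) ⟩
      D * (recip s * recip s) * (ι (suc s) * recip s)
        ≡⟨ cong (D * (recip s * recip s) *_) (ι*recip s) ⟩
      D * (recip s * recip s) * 1ℚ
        ≡⟨ *-identityʳ _ ⟩
      D * (recip s * recip s) ∎

  ∥newton-dirichletPartial∥≤ : ∀ D M i → 0ℚ ≤ D →
    (∀ s → s ℕ.< M → ∥ c (suc s) ∥ ≤ D * ι (suc s)) →
    ∥ newton (λ l → dirichletPartial c (e ℕ.+ a ℕ.* l) M) negNode i ∥ ≤ 2ℚ * D * ∏ (node a) i
  ∥newton-dirichletPartial∥≤ D M i 0≤D h = ≤-trans (partials M h) (*-monoʳ (∏ (node a) i) 0≤P (≤-trans
      (*-monoˡ D 0≤D (sumInvSquares≤2 M)) (≤-reflexive (*-comm D 2ℚ))))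
    where
    P = ∏ (node a) i
    0≤P : 0ℚ ≤ P
    0≤P = 0≤∏ (0≤node a) i
    node≤1 : ∀ l → ∥ negNode l ∥ ≤ 1ℚ
    node≤1 l = ≤-trans (≤-reflexive (trans (∥∥-neg (ofℚ (node a l))) (∥ofℚ∥ (0≤node a l))))
      (^-≤1 a (0≤recip l) (recip≤1 l))
    partials : ∀ M → (∀ s → s ℕ.< M → ∥ c (suc s) ∥ ≤ D * ι (suc s)) →
      ∥ newton (λ l → dirichletPartial c (e ℕ.+ a ℕ.* l) M) negNode i ∥ ≤ D * sumInvSquares M * P
    partials zero    h = ≤-trans (∥newton∥≤ (λ _ → ofℚ 0ℚ) negNode i node≤1 λ _ _ → ≤-refl)
      (≤-reflexive (solve 3 (λ D P t → t :* con 0ℚ := D :* con 0ℚ :* P) refl D P (2ℚ ^ i)))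
    partials (suc M) h = begin
      ∥ newton (λ l → ρ l +ᵍ τ l) negNode i ∥
        ≡⟨ cong ∥_∥ (newton-+ ρ τ negNode i) ⟩
      ∥ newton ρ negNode i +ᵍ newton τ negNode i ∥
        ≤⟨ ∥∥-+-mono (newton ρ negNode i) (newton τ negNode i)
             (partials M λ s s<M → h s (ℕ.m≤n⇒m≤1+n s<M)) (∥newton-term∥≤ D M i 0≤D (h M ℕ.≤-refl)) ⟩
      D * sumInvSquares M * P + D * (recip M * recip M) * P
        ≡⟨ solve 4 (λ D s r P → D :* s :* P :+ D :* r :* P := D :* (s :+ r) :* P) refl
             D (sumInvSquares M) (recip M * recip M) P ⟩
      D * sumInvSquares (suc M) * P ∎
      where
      open ≤-Reasoning
      ρ τ : ℕ → ℚ[i]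
      ρ l = dirichletPartial c (e ℕ.+ a ℕ.* l) M
      τ l = c (suc M) *ᵍ ofℚ (recip M ^ (e ℕ.+ a ℕ.* l))

-- Factorials and their products.

[m+n]!≤ : ∀ m n → (m ℕ.+ n) ℕ.! ℕ.≤ 2 ℕ.^ (m ℕ.+ n) ℕ.* (m ℕ.! ℕ.* n ℕ.!)
[m+n]!≤ zero    n = ℕ.≤-trans (ℕ.m≤n*m (n ℕ.!) (2 ℕ.^ n) {{ℕ.m^n≢0 2 n}})
  (ℕ.≤-reflexive (cong (2 ℕ.^ n ℕ.*_) (sym (ℕ.*-identityˡ (n ℕ.!)))))
[m+n]!≤ (suc m) zero    rewrite ℕ.+-identityʳ m =
  ℕ.≤-trans (ℕ.m≤n*m (suc m ℕ.!) (2 ℕ.^ suc m) {{ℕ.m^n≢0 2 (suc m)}})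
  (ℕ.≤-reflexive (cong (2 ℕ.^ suc m ℕ.*_) (sym (ℕ.*-identityʳ (suc m ℕ.!)))))
[m+n]!≤ (suc m) (suc n) = begin
  -- Splitting the leading factor as (m+1) + (n+1) is Pascal's rule for the binomial coefficient
  -- (m+n)!/(m! n!), which the claim bounds by 2^(m+n).
  suc (m ℕ.+ suc n) ℕ.* F
    ≡⟨ ℕ.*-distribʳ-+ F (suc m) (suc n) ⟩
  suc m ℕ.* F ℕ.+ suc n ℕ.* F
    ≤⟨ ℕ.+-mono-≤ (ℕ.*-monoʳ-≤ (suc m) ([m+n]!≤ m (suc n)))
         (ℕ.*-monoʳ-≤ (suc n) (subst (λ k → k ℕ.! ℕ.≤ 2 ℕ.^ k ℕ.* (suc m ℕ.! ℕ.* n ℕ.!))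
           (sym (ℕ.+-suc m n)) ([m+n]!≤ (suc m) n))) ⟩
  suc m ℕ.* (T ℕ.* (m ℕ.! ℕ.* (suc n ℕ.* n ℕ.!))) ℕ.+ suc n ℕ.* (T ℕ.* (suc m ℕ.* m ℕ.! ℕ.* n ℕ.!))
    ≡⟨ solveℕ 5 (λ M N T f g →
         M ⊗ (T ⊗ (f ⊗ (N ⊗ g))) ⊕ N ⊗ (T ⊗ (M ⊗ f ⊗ g)) ⊜ (conℕ 2 ⊗ T) ⊗ (M ⊗ f ⊗ (N ⊗ g)))
         refl (suc m) (suc n) T (m ℕ.!) (n ℕ.!) ⟩
  2 ℕ.^ suc (m ℕ.+ suc n) ℕ.* (suc m ℕ.! ℕ.* suc n ℕ.!) ∎
  where
  open ℕ.≤-Reasoning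
  F = (m ℕ.+ suc n) ℕ.!
  T = 2 ℕ.^ (m ℕ.+ suc n)

n^i*n!≤[i+n]! : ∀ n i → n ℕ.^ i ℕ.* n ℕ.! ℕ.≤ (i ℕ.+ n) ℕ.!
n^i*n!≤[i+n]! n zero    = ℕ.≤-reflexive (ℕ.*-identityˡ (n ℕ.!))
n^i*n!≤[i+n]! n (suc i) = ℕ.≤-trans (ℕ.≤-reflexive (ℕ.*-assoc n (n ℕ.^ i) (n ℕ.!)))
  (ℕ.*-mono-≤ (ℕ.≤-trans (ℕ.m≤n+m n i) (ℕ.n≤1+n (i ℕ.+ n))) (n^i*n!≤[i+n]! n i))

-- A substitute for Stirling's formula: n^i is at most (i+n)!/n!, which is i! times a binomial
-- coefficient. The loss 2^(i+n), multiplied over i < n, is only e^(O(n²)).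
n^i≤2^[i+n]*i! : ∀ n i → n ℕ.^ i ℕ.≤ 2 ℕ.^ (i ℕ.+ n) ℕ.* i ℕ.!
n^i≤2^[i+n]*i! n i = ℕ.*-cancelʳ-≤ (n ℕ.^ i) (2 ℕ.^ (i ℕ.+ n) ℕ.* i ℕ.!) (n ℕ.!) {{n ℕ.!≢0}}
  (ℕ.≤-trans (n^i*n!≤[i+n]! n i) (ℕ.≤-trans ([m+n]!≤ i n)
    (ℕ.≤-reflexive (sym (ℕ.*-assoc (2 ℕ.^ (i ℕ.+ n)) (i ℕ.!) (n ℕ.!))))))

n≤2^n : ∀ n → n ℕ.≤ 2 ℕ.^ n
n≤2^n zero    = ℕ.z≤n
n≤2^n (suc n) = ℕ.+-mono-≤ (ℕ.m^n>0 2 n) (ℕ.≤-trans (n≤2^n n) (ℕ.≤-reflexive (sym (ℕ.+-identityʳ _))))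

n!≤2^[n*n] : ∀ n → n ℕ.! ℕ.≤ 2 ℕ.^ (n ℕ.* n)
n!≤2^[n*n] zero    = ℕ.≤-refl
n!≤2^[n*n] (suc n) = ℕ.≤-trans (ℕ.*-mono-≤ (n≤2^n (suc n)) (n!≤2^[n*n] n))
  (ℕ.≤-trans (ℕ.≤-reflexive (sym (ℕ.^-distribˡ-+-* 2 (suc n) (n ℕ.* n))))
    (ℕ.^-monoʳ-≤ 2 (ℕ.+-monoʳ-≤ (suc n) (ℕ.*-monoʳ-≤ n (ℕ.n≤1+n n)))))

ι≤2^ : ∀ n → ι n ≤ 2ℚ ^ n
ι≤2^ n = subst (ι n ≤_) (ι-^ 2 n) (ι-mono (n≤2^n n))

∏-snoc : ∀ β n → ∏ β (suc n) ≡ ∏ β n * β n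
∏-snoc β zero    = *-comm (β 0) 1ℚ
∏-snoc β (suc n) = trans (cong (β 0 *_) (∏-snoc (β ∘ suc) n))
  (sym (*-assoc (β 0) (∏ (β ∘ suc) n) (β (suc n))))

∏-* : ∀ β γ n → ∏ (λ i → β i * γ i) n ≡ ∏ β n * ∏ γ n
∏-* β γ zero    = refl
∏-* β γ (suc n) = trans (cong (β 0 * γ 0 *_) (∏-* (β ∘ suc) (γ ∘ suc) n))
  (solve 4 (λ a b p q → a :* b :* (p :* q) := a :* p :* (b :* q)) refl
    (β 0) (γ 0) (∏ (β ∘ suc) n) (∏ (γ ∘ suc) n))

∏-^ : ∀ β a n → ∏ (λ i → β i ^ a) n ≡ ∏ β n ^ a
∏-^ β a zero    = sym (1^ a)
  where
  1^ : ∀ a → 1ℚ ^ a ≡ 1ℚ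
  1^ zero    = refl
  1^ (suc a) = trans (*-identityˡ (1ℚ ^ a)) (1^ a)
∏-^ β a (suc n) = trans (cong (β 0 ^ a *_) (∏-^ (β ∘ suc) a n))
  (sym (^-distrib-* (β 0) (∏ (β ∘ suc) n) a))

∏-const : ∀ q n → ∏ (λ _ → q) n ≡ q ^ n
∏-const q zero    = refl
∏-const q (suc n) = cong (q *_) (∏-const q n)

∏-cong : ∀ {β γ} → (∀ i → β i ≡ γ i) → ∀ n → ∏ β n ≡ ∏ γ n
∏-cong h zero    = refl
∏-cong h (suc n) = cong₂ _*_ (h 0) (∏-cong (h ∘ suc) n)

invFact : ℕ → ℚ
invFact = ∏ recip

0≤invFact : ∀ i → 0ℚ ≤ invFact i
0≤invFact = 0≤∏ 0≤recip

!*invFact : ∀ i → ι (i ℕ.!) * invFact i ≡ 1ℚ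
!*invFact zero    = refl
!*invFact (suc i) = begin
  ι (suc i ℕ.* i ℕ.!) * ∏ recip (suc i)
    ≡⟨ cong₂ _*_ (ι-* (suc i) (i ℕ.!)) (∏-snoc recip i) ⟩
  ι (suc i) * ι (i ℕ.!) * (∏ recip i * recip i)
    ≡⟨ solve 4 (λ n f p r → n :* f :* (p :* r) := (n :* r) :* (f :* p)) refl
         (ι (suc i)) (ι (i ℕ.!)) (∏ recip i) (recip i) ⟩
  ι (suc i) * recip i * (ι (i ℕ.!) * ∏ recip i)
    ≡⟨ cong₂ _*_ (ι*recip i) (!*invFact i) ⟩
  1ℚ ∎
  where open ≡.≡-Reasoning

1≤2^ : ∀ n → 1ℚ ≤ 2ℚ ^ n
1≤2^ n = 1≤^ n (≤-from 1ℚ (<⇒≤ 0<1) refl)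
  where
  1≤^ : ∀ {p} n → 1ℚ ≤ p → 1ℚ ≤ p ^ n
  1≤^ zero    1≤p = ≤-refl
  1≤^ (suc n) 1≤p = *-mono (≤-trans (<⇒≤ 0<1) 1≤p) (<⇒≤ 0<1) 1≤p (1≤^ n 1≤p)

n^i*invFact≤ : ∀ n i → ι n ^ i * invFact i ≤ 2ℚ ^ (i ℕ.+ n)
n^i*invFact≤ n i = begin
  ι n ^ i * invFact i
    ≡⟨ cong (_* invFact i) (ι-^ n i) ⟨
  ι (n ℕ.^ i) * invFact i
    ≤⟨ *-monoʳ (invFact i) (0≤invFact i) (ι-mono (n^i≤2^[i+n]*i! n i)) ⟩
  ι (2 ℕ.^ (i ℕ.+ n) ℕ.* i ℕ.!) * invFact i
    ≡⟨ cong (_* invFact i) (trans (ι-* (2 ℕ.^ (i ℕ.+ n)) (i ℕ.!)) (cong (_* ι (i ℕ.!)) (ι-^ 2 (i ℕ.+ n)))) ⟩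
  2ℚ ^ (i ℕ.+ n) * ι (i ℕ.!) * invFact i
    ≡⟨ trans (*-assoc (2ℚ ^ (i ℕ.+ n)) (ι (i ℕ.!)) (invFact i))
         (trans (cong (2ℚ ^ (i ℕ.+ n) *_) (!*invFact i)) (*-identityʳ _)) ⟩
  2ℚ ^ (i ℕ.+ n) ∎
  where open ≤-Reasoning

2^-mono : ∀ {m n} → m ℕ.≤ n → 2ℚ ^ m ≤ 2ℚ ^ n
2^-mono {n = n} ℕ.z≤n       = 1≤2^ n
2^-mono         (ℕ.s≤s m≤n) = *-monoˡ 2ℚ (nonNegative⁻¹ 2ℚ) (2^-mono m≤n)

-- Size of the determinant bound.

hankelBound : ℕ → ℕ → ℚ → ℚ
hankelBound n a D = ι (n ℕ.!) * ∏ (λ i → D * ∏ (node a) i) n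

-- The base of an n²-th power. One factor 4 absorbs the squared constant 2 in front of the bound,
-- the other (n!)², and D² absorbs D^(2n). In 2^5 four factors come from `Q * Q` = 2^(4n) and one
-- from a left-over n^n ≤ 2^(n²).
growth : ℕ → ℚ → ℚ
growth a D = 2ℚ * 2ℚ * (2ℚ * 2ℚ) * (D * D) * (2ℚ ^ 5) ^ a

0<hankelBound : ∀ n a {D} → 0ℚ < D → 0ℚ < hankelBound n a D
0<hankelBound n a {D} 0<D = 0<* {ι (n ℕ.!)} {∏ (λ i → D * ∏ (node a) i) n}
  (<-≤-trans 0<1 (ι-mono {1} (ℕ.>-nonZero⁻¹ (n ℕ.!) {{n ℕ.!≢0}})))
  (0<∏ (λ i → 0<* 0<D (0<∏ (0<node a) i)) n)

0≤growth : ∀ a D → 0ℚ ≤ growth a D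
0≤growth a D = 0≤* {2ℚ * 2ℚ * (2ℚ * 2ℚ) * (D * D)} {(2ℚ ^ 5) ^ a}
  (0≤* {2ℚ * 2ℚ * (2ℚ * 2ℚ)} {D * D} (nonNegative⁻¹ (2ℚ * 2ℚ * (2ℚ * 2ℚ))) (0≤² D))
  (0≤^ a (0≤^ 5 (nonNegative⁻¹ 2ℚ)))

module _ (n : ℕ) where

  private
    Q : ℚ
    Q = 2ℚ ^ (n ℕ.+ n)
    P : ℕ → ℚ
    P = ∏ invFact

  -- The exponents i < m add up to m(m-1)/2, so two copies of the product absorb m² - m powers of n;
  -- the other m powers remain on the right.
  ∏invFact²≤ : ∀ m → m ℕ.≤ n →
    P m * P m * ι n ^ (m ℕ.* m) ≤ (Q * Q) ^ m * ι n ^ m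
  ∏invFact²≤ zero    _   = ≤-refl
  ∏invFact²≤ (suc m) m<n = begin
    P (suc m) * P (suc m) * X ^ (suc m ℕ.* suc m)
      -- Since (m+1)² = m² + m + m + 1, each of the two new factors `invFact m` takes m powers of n,
      -- and the last power goes to the right-hand side.
      ≡⟨ cong₂ (λ p e → p * p * X ^ e) (∏-snoc invFact m)
           (solveℕ 1 (λ m → (conℕ 1 ⊕ m) ⊗ (conℕ 1 ⊕ m) ⊜ m ⊗ m ⊕ (m ⊕ (m ⊕ conℕ 1))) refl m) ⟩
    P m * w * (P m * w) * X ^ (m ℕ.* m ℕ.+ (m ℕ.+ (m ℕ.+ 1)))
      ≡⟨ cong (P m * w * (P m * w) *_) (trans (^-homo-* X (m ℕ.* m) (m ℕ.+ (m ℕ.+ 1)))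
           (cong (X ^ (m ℕ.* m) *_) (trans (^-homo-* X m (m ℕ.+ 1))
             (cong (X ^ m *_) (^-homo-* X m 1))))) ⟩
    P m * w * (P m * w) * (X ^ (m ℕ.* m) * (X ^ m * (X ^ m * (X * 1ℚ))))
      ≡⟨ solve 5 (λ p w y z x → p :* w :* (p :* w) :* (y :* (z :* (z :* (x :* con 1ℚ))))
            := (p :* p :* y) :* ((z :* w) :* (z :* w) :* x)) refl (P m) w (X ^ (m ℕ.* m)) (X ^ m) X ⟩
    P m * P m * X ^ (m ℕ.* m) * (X ^ m * w * (X ^ m * w) * X)
      ≤⟨ *-mono (0≤* (0≤^ m 0≤QQ) (0≤^ m 0≤X)) (0≤* (0≤* 0≤v 0≤v) 0≤X)
           (∏invFact²≤ m (ℕ.<⇒≤ m<n)) (*-monoʳ X 0≤X (*-mono 0≤Q 0≤v v≤Q v≤Q)) ⟩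
    (Q * Q) ^ m * X ^ m * (Q * Q * X)
      ≡⟨ solve 4 (λ q r y x → r :* y :* (q :* q :* x) := q :* q :* r :* (x :* y)) refl
           Q ((Q * Q) ^ m) (X ^ m) X ⟩
    (Q * Q) ^ suc m * X ^ suc m ∎
    where
    open ≤-Reasoning
    X = ι n
    w = invFact m
    0≤X : 0ℚ ≤ X
    0≤X = 0≤ι n
    0≤Q : 0ℚ ≤ Q
    0≤Q = 0≤^ (n ℕ.+ n) (nonNegative⁻¹ 2ℚ)
    0≤QQ : 0ℚ ≤ Q * Q
    0≤QQ = 0≤* 0≤Q 0≤Q
    0≤v : 0ℚ ≤ X ^ m * w
    0≤v = 0≤* (0≤^ m 0≤X) (0≤invFact m)
    v≤Q : X ^ m * w ≤ Q
    v≤Q = ≤-trans (n^i*invFact≤ n m) (2^-mono (ℕ.+-monoˡ-≤ n (ℕ.<⇒≤ m<n)))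

  ∏invFact²*n^n²≤ : P n * P n * ι n ^ (n ℕ.* n) ≤ (2ℚ ^ 5) ^ (n ℕ.* n)
  ∏invFact²*n^n²≤ = begin
    P n * P n * ι n ^ (n ℕ.* n)  ≤⟨ ∏invFact²≤ n ℕ.≤-refl ⟩
    (Q * Q) ^ n * ι n ^ n
      ≤⟨ *-monoˡ ((Q * Q) ^ n) (0≤^ n (0≤² Q)) (^-mono n (0≤ι n) (ι≤2^ n)) ⟩
    (Q * Q) ^ n * (2ℚ ^ n) ^ n
      ≡⟨ ^-distrib-* (Q * Q) (2ℚ ^ n) n ⟨
    (Q * Q * 2ℚ ^ n) ^ n
      ≡⟨ cong (_^ n) (trans (cong (_* 2ℚ ^ n) (sym (^-homo-* 2ℚ (n ℕ.+ n) (n ℕ.+ n))))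
           (trans (sym (^-homo-* 2ℚ (n ℕ.+ n ℕ.+ (n ℕ.+ n)) n))
             (trans (cong (2ℚ ^_) (solveℕ 1 (λ n → n ⊕ n ⊕ (n ⊕ n) ⊕ n ⊜ conℕ 5 ⊗ n) refl n))
               (sym (^-assocʳ 2ℚ 5 n))))) ⟩
    ((2ℚ ^ 5) ^ n) ^ n
      ≡⟨ ^-assocʳ (2ℚ ^ 5) n n ⟩
    (2ℚ ^ 5) ^ (n ℕ.* n) ∎
    where open ≤-Reasoning

  hankelBound²≤ : ∀ a D → 1ℚ ≤ D → 1 ℕ.≤ n →
    2ℚ * hankelBound n a D * (2ℚ * hankelBound n a D) * ι n ^ (a ℕ.* (n ℕ.* n)) ≤ growth a D ^ (n ℕ.* n)
  hankelBound²≤ a D 1≤D 1≤n = begin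
    2ℚ * hankelBound n a D * (2ℚ * hankelBound n a D) * X ^ (a ℕ.* nn)
      ≡⟨ cong (λ p → 2ℚ * (F * p) * (2ℚ * (F * p)) * X ^ (a ℕ.* nn)) split ⟩
    2ℚ * (F * (D ^ n * P n ^ a)) * (2ℚ * (F * (D ^ n * P n ^ a))) * X ^ (a ℕ.* nn)
      ≡⟨ solve 4 (λ F d p x → con 2ℚ :* (F :* (d :* p)) :* (con 2ℚ :* (F :* (d :* p))) :* x
           := con 2ℚ :* con 2ℚ :* (F :* F) :* (d :* d) :* (p :* p :* x)) refl F (D ^ n) (P n ^ a) (X ^ (a ℕ.* nn)) ⟩
    2ℚ * 2ℚ * (F * F) * (D ^ n * D ^ n) * (P n ^ a * P n ^ a * X ^ (a ℕ.* nn))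
      ≡⟨ cong (2ℚ * 2ℚ * (F * F) * (D ^ n * D ^ n) *_) collect ⟩
    2ℚ * 2ℚ * (F * F) * (D ^ n * D ^ n) * (P n * P n * X ^ nn) ^ a
      ≤⟨ *-mono (0≤* (0≤* 0≤4 (0≤² T)) (0≤² (D ^ nn))) (0≤^ a (0≤* (0≤² (P n)) (0≤^ nn (0≤ι n))))
           (*-mono (0≤* 0≤4 (0≤² T)) (0≤² (D ^ n))
             (*-monoˡ (2ℚ * 2ℚ) 0≤4 (*-mono 0≤T (0≤ι (n ℕ.!)) F≤T F≤T))
             (*-mono (0≤^ nn 0≤D) (0≤^ n 0≤D) D^n≤ D^n≤))
           (^-mono a (0≤* (0≤² (P n)) (0≤^ nn (0≤ι n))) ∏invFact²*n^n²≤) ⟩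
    2ℚ * 2ℚ * (T * T) * (D ^ nn * D ^ nn) * ((2ℚ ^ 5) ^ nn) ^ a
      ≤⟨ *-monoʳ (((2ℚ ^ 5) ^ nn) ^ a) (0≤^ a (0≤^ nn (0≤^ 5 (nonNegative⁻¹ 2ℚ))))
           (*-monoʳ (D ^ nn * D ^ nn) (0≤² (D ^ nn)) (*-monoʳ (T * T) (0≤² T)
             (*-mono 0≤T (nonNegative⁻¹ 2ℚ) 2≤T 2≤T))) ⟩
    T * T * (T * T) * (D ^ nn * D ^ nn) * ((2ℚ ^ 5) ^ nn) ^ a
      ≡⟨ cong₂ _*_ (trans (cong₂ _*_ (trans (cong₂ _*_ TT TT) (sym (^-distrib-* (2ℚ * 2ℚ) (2ℚ * 2ℚ) nn)))
             (sym (^-distrib-* D D nn))) (sym (^-distrib-* (2ℚ * 2ℚ * (2ℚ * 2ℚ)) (D * D) nn)))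
           (trans (^-assocʳ (2ℚ ^ 5) nn a) (trans (cong ((2ℚ ^ 5) ^_) (ℕ.*-comm nn a))
             (sym (^-assocʳ (2ℚ ^ 5) a nn)))) ⟩
    (2ℚ * 2ℚ * (2ℚ * 2ℚ) * (D * D)) ^ nn * ((2ℚ ^ 5) ^ a) ^ nn
      ≡⟨ ^-distrib-* (2ℚ * 2ℚ * (2ℚ * 2ℚ) * (D * D)) ((2ℚ ^ 5) ^ a) nn ⟨
    growth a D ^ nn ∎
    where
    open ≤-Reasoning
    nn = n ℕ.* n
    X = ι n
    F = ι (n ℕ.!)
    T = 2ℚ ^ nn
    0≤D : 0ℚ ≤ D
    0≤D = ≤-trans (<⇒≤ 0<1) 1≤D
    0≤4 : 0ℚ ≤ 2ℚ * 2ℚ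
    0≤4 = nonNegative⁻¹ (2ℚ * 2ℚ)
    0≤T : 0ℚ ≤ T
    0≤T = 0≤^ nn (nonNegative⁻¹ 2ℚ)
    F≤T : F ≤ T
    F≤T = subst (F ≤_) (ι-^ 2 nn) (ι-mono (n!≤2^[n*n] n))
    n≤nn : n ℕ.≤ nn
    n≤nn = ℕ.m≤m*n n n {{ℕ.>-nonZero 1≤n}}
    2≤T : 2ℚ ≤ T
    2≤T = 2^-mono {1} {nn} (ℕ.≤-trans 1≤n n≤nn)
    1≤D^ : ∀ k → 1ℚ ≤ D ^ k
    1≤D^ zero    = ≤-refl
    1≤D^ (suc k) = *-mono 0≤D (<⇒≤ 0<1) 1≤D (1≤D^ k)
    D^-mono : ∀ {k l} → k ℕ.≤ l → D ^ k ≤ D ^ l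
    D^-mono {l = l} ℕ.z≤n       = 1≤D^ l
    D^-mono         (ℕ.s≤s k≤l) = *-monoˡ D 0≤D (D^-mono k≤l)
    D^n≤ : D ^ n ≤ D ^ nn
    D^n≤ = D^-mono n≤nn
    TT : T * T ≡ (2ℚ * 2ℚ) ^ nn
    TT = sym (^-distrib-* 2ℚ 2ℚ nn)
    split : ∏ (λ i → D * ∏ (node a) i) n ≡ D ^ n * P n ^ a
    split = trans (∏-* (λ _ → D) (∏ (node a)) n) (cong₂ _*_ (∏-const D n)
      (trans (∏-cong (∏-^ recip a) n) (∏-^ invFact a n)))
    collect : P n ^ a * P n ^ a * X ^ (a ℕ.* nn) ≡ (P n * P n * X ^ nn) ^ a
    collect = trans (cong₂ _*_ (sym (^-distrib-* (P n) (P n) a))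
        (trans (cong (X ^_) (ℕ.*-comm a nn)) (sym (^-assocʳ X nn a))))
      (sym (^-distrib-* (P n * P n) (X ^ nn) a))

-- From real and complex numbers to their approximants.

ev-map : {P Q : ℕ → Set} → (∀ {n} → P n → Q n) → Eventually P → Eventually Q
ev-map f (N , p) = N , λ n h → f (p n h)

ev-all : ∀ n {P : ℕ → ℕ → Set} → (∀ i → i ℕ.< n → Eventually (P i)) →
  Eventually λ k → ∀ i → i ℕ.< n → P i k
ev-all zero    h = 0 , λ _ _ _ ()
ev-all (suc n) h = ev-map₂
  (λ { p ps zero _ → p ; p ps (suc i) (ℕ.s≤s i<n) → ps i i<n })
  (h 0 (ℕ.s≤s ℕ.z≤n)) (ev-all n λ i i<n → h (suc i) (ℕ.s≤s i<n))

-- The order on reals tolerates every positive error, so a bound on approximants needs a strictly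
-- larger rational.
≤ʳ-fromℚ : ∀ {x q r} → q < r → x ≤ʳ fromℚ q → Eventually λ k → seq x k ≤ r
≤ʳ-fromℚ {x} {q} {r} q<r x≤q = ev-map
  (λ {k} h → subst (seq x k ≤_) (solve 2 (λ q r → q :+ (r :- q) := r) refl q r) h)
  (x≤q (r - q) (gap< q<r))

²-cancel-≤ : ∀ {p q} → 0ℚ ≤ q → p * p ≤ q * q → p ≤ q
²-cancel-≤ {p} {q} 0≤q p²≤q² = ≮⇒≥ λ q<p → <-irrefl refl (<-≤-trans
  (<-from ((p - q) * (p + q)) (0<* (gap< q<p) (0<+ (≤-<-trans 0≤q q<p) 0≤q))
    (solve 2 (λ p q → q :* q :+ (p :- q) :* (p :+ q) := p :* p) refl p q)) p²≤q²)

at : ℕ → ℂ → ℚ[i]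
at k z = seq (re z) k , seq (im z) k

∣p∣² : ∀ p → ∣ p ∣ * ∣ p ∣ ≡ p * p
∣p∣² p = trans (sym (∣p*q∣≡∣p∣*∣q∣ p p)) (0≤p⇒∣p∣≡p (0≤² p))

∥at∥²≤ : ∀ z k → ∥ at k z ∥ * ∥ at k z ∥ ≤ 2ℚ * seq ∣ z ∣² k
∥at∥²≤ z k = ≤-trans
  (≤-from ((x - y) * (x - y)) (0≤² (x - y))
    (solve 2 (λ x y → (x :+ y) :* (x :+ y) :+ (x :- y) :* (x :- y) := con 2ℚ :* (x :* x :+ y :* y)) refl x y))
  (≤-reflexive (cong (2ℚ *_) (cong₂ _+_ (∣p∣² (seq (re z) k)) (∣p∣² (seq (im z) k)))))
  where
  x = ∣ seq (re z) k ∣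
  y = ∣ seq (im z) k ∣

∣∣²≤∥at∥² : ∀ z k → seq ∣ z ∣² k ≤ ∥ at k z ∥ * ∥ at k z ∥
∣∣²≤∥at∥² z k = ≤-trans
  (≤-reflexive (sym (cong₂ _+_ (∣p∣² (seq (re z) k)) (∣p∣² (seq (im z) k)))))
  (≤-from (2ℚ * (x * y)) (0≤* (nonNegative⁻¹ 2ℚ) (0≤* (0≤∣p∣ (seq (re z) k)) (0≤∣p∣ (seq (im z) k))))
    (solve 2 (λ x y → (x :* x :+ y :* y) :+ con 2ℚ :* (x :* y) := (x :+ y) :* (x :+ y)) refl x y))
  where
  x = ∣ seq (re z) k ∣
  y = ∣ seq (im z) k ∣

-- With s the approximant of the modulus, ∥z∥² ≤ 2(s² + R²) ≤ 4R², where R² is the tolerance granted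
-- to the square root. As s may be slightly negative, s ≥ -R is needed as well.
∣∣ᶜ≤⇒∥∥≤ : ∀ z {R} → 0ℚ < R → (Eventually λ k → seq ∣ z ∣ᶜ k ≤ R) →
  Eventually λ k → ∥ at k z ∥ ≤ 2ℚ * R
∣∣ᶜ≤⇒∥∥≤ z {R} 0<R s≤R = ev-map₂ step
  (ev-map₂ _,_ s≤R (sqrt-nonNeg ∣ z ∣² (∣∣²-nonNeg z) R 0<R))
  (sqrt-square ∣ z ∣² (∣∣²-nonNeg z) (R * R) (0<* 0<R 0<R))
  where
  step : ∀ {k} → seq ∣ z ∣ᶜ k ≤ R × 0ℚ ≤ seq ∣ z ∣ᶜ k + R →
    ∣ seq ∣ z ∣ᶜ k * seq ∣ z ∣ᶜ k - seq ∣ z ∣² k ∣ ≤ R * R → ∥ at k z ∥ ≤ 2ℚ * R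
  step {k} (s≤R , 0≤s+R) s²≈ = ²-cancel-≤ (0≤* (nonNegative⁻¹ 2ℚ) (<⇒≤ 0<R)) (≤-trans (∥at∥²≤ z k)
    (≤-from (2ℚ * ((s * s + R * R) - seq ∣ z ∣² k) + 2ℚ * ((R - s) * (s + R)))
      (0≤+ (0≤* (nonNegative⁻¹ 2ℚ) (gap (abs-upper {s * s} s²≈)))
           (0≤* (nonNegative⁻¹ 2ℚ) (0≤* (gap s≤R) 0≤s+R)))
      (solve 3 (λ z s R → con 2ℚ :* z :+ (con 2ℚ :* ((s :* s :+ R :* R) :- z) :+ con 2ℚ :* ((R :- s) :* (s :+ R)))
         := con 2ℚ :* R :* (con 2ℚ :* R)) refl (seq ∣ z ∣² k) s R)))
    where s = seq ∣ z ∣ᶜ k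

∥∥≤⇒∣∣ᶜ≤ : ∀ z {R} → 0ℚ < R → (Eventually λ k → ∥ at k z ∥ ≤ R) →
  Eventually λ k → seq ∣ z ∣ᶜ k ≤ 2ℚ * R
∥∥≤⇒∣∣ᶜ≤ z {R} 0<R z≤R = ev-map₂ step z≤R
  (sqrt-square ∣ z ∣² (∣∣²-nonNeg z) (R * R) (0<* 0<R 0<R))
  where
  step : ∀ {k} → ∥ at k z ∥ ≤ R →
    ∣ seq ∣ z ∣ᶜ k * seq ∣ z ∣ᶜ k - seq ∣ z ∣² k ∣ ≤ R * R → seq ∣ z ∣ᶜ k ≤ 2ℚ * R
  step {k} z≤R s²≈ = ²-cancel-≤ (0≤* (nonNegative⁻¹ 2ℚ) (<⇒≤ 0<R))
    (≤-trans (abs-lower {seq ∣ z ∣ᶜ k * seq ∣ z ∣ᶜ k} s²≈)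
    (≤-trans (+-monoˡ-≤ (R * R) (≤-trans (∣∣²≤∥at∥² z k)
      (*-mono (<⇒≤ 0<R) (0≤∥∥ (at k z)) z≤R z≤R)))
    (≤-from (2ℚ * (R * R)) (0≤* (nonNegative⁻¹ 2ℚ) (0≤² R))
      (solve 1 (λ R → R :* R :+ R :* R :+ con 2ℚ :* (R :* R) := con 2ℚ :* R :* (con 2ℚ :* R)) refl R))))

at-Σ : ∀ {n} (u : Fin n → ℂ) k → at k (Σᶜ u) ≡ sum λ i → at k (u i)
at-Σ {zero}  u k = refl
at-Σ {suc n} u k = cong (at k (u zero) +ᵍ_) (at-Σ (u ∘ suc) k)

at-sign : ∀ n k → at k (sign n) ≡ sgn n
at-sign zero    k = refl
at-sign (suc n) k = cong -ᵍ_ (at-sign n k)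

-- Arithmetic on sequences is pointwise, so `at k` respects sums and products of complex numbers by
-- computation.
at-det : ∀ n k (A : Fin n → Fin n → ℂ) (B : ℕ → Fin n → ℚ[i]) →
  (∀ i j → at k (A i j) ≡ B (toℕ i) j) → at k (det A) ≡ detRows n B
at-det zero    k A B h = refl
at-det (suc n) k A B h = trans (at-Σ (λ j → sign (toℕ j) *ᶜ A zero j *ᶜ det λ i l → A (suc i) (punchIn j l)) k)
  (sum-cong-≗ {suc n} λ j → cong₂ _*ᵍ_ (cong₂ _*ᵍ_ (at-sign (toℕ j) k) (h zero j))
    (at-det n k (λ i l → A (suc i) (punchIn j l)) (λ i l → B (suc i) (punchIn j l))
      λ i l → h (suc i) (punchIn j l)))

at-partialSum : ∀ c m M k →
  at k (partialSum (dirichletTerm c m) M) ≡ dirichletPartial (λ t → at k (c t)) m M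
at-partialSum c m zero    k = refl
at-partialSum c m (suc M) k = cong (_+ᵍ at k (c (suc M)) *ᵍ ofℚ (recip M ^ m)) (at-partialSum c m M k)

at--ᶜ : ∀ w z k → at k (w -ᶜ z) ≡ at k w +ᵍ -ᵍ at k z
at--ᶜ w z k = refl

-ᵍ-cancel : ∀ w z → z ≡ w +ᵍ -ᵍ (w +ᵍ -ᵍ z)
-ᵍ-cancel (a , b) (c , d) = cong₂ _,_ (eq a c) (eq b d)
  where
  eq : ∀ a c → c ≡ a + - (a + - c)
  eq = solve 2 (λ a c → c := a :+ :- (a :+ :- c)) refl

-- Newton rows of the Hankel matrix.

3ℚ : ℚ
3ℚ = ℤ.+ 3 / 1

negNodes : ℕ → ℕ → ℚ[i]
negNodes a l = ofℚ (- node a l)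

∥negNodes∥≤1 : ∀ a l → ∥ negNodes a l ∥ ≤ 1ℚ
∥negNodes∥≤1 a l = ≤-trans (≤-reflexive (trans (∥∥-neg (ofℚ (node a l))) (∥ofℚ∥ (0≤node a l))))
  (^-≤1 a (0≤recip l) (recip≤1 l))

-- Write f as partial sum minus error: linearity separates the bound for partial sums, which is
-- uniform in M, from the crude one for the error.
∥newton-limit∥≤ : ∀ (c f : ℕ → ℚ[i]) D a e M i {ε} → 3 ℕ.≤ e → 0ℚ ≤ D →
  (∀ s → s ℕ.< M → ∥ c (suc s) ∥ ≤ D * ι (suc s)) →
  (∀ l → l ℕ.≤ i → ∥ dirichletPartial c (e ℕ.+ a ℕ.* l) M +ᵍ -ᵍ f l ∥ ≤ ε) →
  ∥ newton f (negNodes a) i ∥ ≤ 2ℚ * D * ∏ (node a) i + 2ℚ ^ i * ε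
∥newton-limit∥≤ c f D a e M i {ε} 3≤e 0≤D c≤ close =
  subst (λ z → ∥ z ∥ ≤ 2ℚ * D * ∏ (node a) i + 2ℚ ^ i * ε)
    (sym (trans (newton-cong (λ l → -ᵍ-cancel (ρ l) (f l)) (negNodes a) i) (newton-+ ρ σ (negNodes a) i)))
    (∥∥-+-mono (newton ρ (negNodes a) i) (newton σ (negNodes a) i)
      (∥newton-dirichletPartial∥≤ c a e 3≤e D M i 0≤D c≤)
      (∥newton∥≤ σ (negNodes a) i (∥negNodes∥≤1 a) λ l l≤i →
        subst (_≤ ε) (sym (∥∥-neg (ρ l +ᵍ -ᵍ f l))) (close l l≤i)))
  where
  ρ σ : ℕ → ℚ[i]
  ρ l = dirichletPartial c (e ℕ.+ a ℕ.* l) M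
  σ l = -ᵍ (ρ l +ᵍ -ᵍ f l)

-- The order of quantifiers matters: the index k from which the approximants comply depends on the
-- cutoff M.
dirichletSum-at : ∀ c m z → IsDirichletSum c m z → ∀ {ε} → 0ℚ < ε →
  Eventually λ M → Eventually λ k →
    ∥ dirichletPartial (λ t → at k (c t)) m M +ᵍ -ᵍ at k z ∥ ≤ 2ℚ * ε
dirichletSum-at c m z sums {ε} 0<ε = ev-map
  (λ {M} close → ev-map
    (λ {k} → subst (λ w → ∥ w ∥ ≤ 2ℚ * ε) (trans (at--ᶜ (partialSum (dirichletTerm c m) M) z k)
      (cong (_+ᵍ -ᵍ at k z) (at-partialSum c m M k))))
    (∣∣ᶜ≤⇒∥∥≤ (partialSum (dirichletTerm c m) M -ᶜ z) 0<ε
      (≤ʳ-fromℚ {∣ partialSum (dirichletTerm c m) M -ᶜ z ∣ᶜ} ½ε<ε close)))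
  (sums (½ * ε) (half ε 0<ε))
  where
  ½ε<ε : ½ * ε < ε
  ½ε<ε = <-from (½ * ε) (half ε 0<ε) (solve 1 (λ ε → con ½ :* ε :+ con ½ :* ε := ε) refl ε)

-- The coefficient bounds begin to hold at indices depending on s. Once the cutoff M is fixed, only
-- finitely many of them, and finitely many exponents, have to share an index.
∥newton-dirichlet∥≤ : ∀ (c : ℕ → ℂ) D → 0ℚ < D →
  (∀ s → Eventually λ k → ∥ at k (c (suc s)) ∥ ≤ D * ι (suc s)) →
  ∀ a e → 3 ℕ.≤ e → (f : ℕ → ℂ) → (∀ l → IsDirichletSum c (e ℕ.+ a ℕ.* l) (f l)) →
  ∀ i → Eventually λ k → ∥ newton (λ l → at k (f l)) (negNodes a) i ∥ ≤ 3ℚ * D * ∏ (node a) i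
∥newton-dirichlet∥≤ c D 0<D c≤ a e 3≤e f sums i =
  atCutoff (proj₁ partials) (proj₂ partials (proj₁ partials) ℕ.≤-refl)
  where
  P = ∏ (node a) i
  -- The choice η 2^i = D P makes the truncation error cost one D P besides the 2 D P of the partial
  -- sum, whence the 3.
  Q = quotient (D * P) (2ℚ ^ i) (0<* 0<D (0<∏ (0<node a) i)) (0<^ i (positive⁻¹ 2ℚ))
  η = proj₁ Q

  Close : ℕ → ℕ → ℕ → Set
  Close l M k = ∥ dirichletPartial (λ t → at k (c t)) (e ℕ.+ a ℕ.* l) M +ᵍ -ᵍ at k (f l) ∥ ≤ 2ℚ * (½ * η)

  partials : Eventually λ M → ∀ l → l ℕ.< suc i → Eventually (Close l M)
  partials = ev-all (suc i) {λ l M → Eventually (Close l M)} λ l _ →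
    dirichletSum-at c (e ℕ.+ a ℕ.* l) (f l) (sums l) (half η (proj₁ (proj₂ Q)))

  total : 2ℚ * D * P + 2ℚ ^ i * (2ℚ * (½ * η)) ≡ 3ℚ * D * P
  total = trans (cong (2ℚ * D * P +_) (trans
      (solve 2 (λ t η → t :* (con 2ℚ :* (con ½ :* η)) := η :* t) refl (2ℚ ^ i) η) (proj₂ (proj₂ Q))))
    (solve 2 (λ D P → con 2ℚ :* D :* P :+ D :* P := con 3ℚ :* D :* P) refl D P)

  atCutoff : ∀ M → (∀ l → l ℕ.< suc i → Eventually (Close l M)) →
    Eventually λ k → ∥ newton (λ l → at k (f l)) (negNodes a) i ∥ ≤ 3ℚ * D * P
  atCutoff M close = ev-map₂
    (λ {k} close c≤ → ≤-trans
      (∥newton-limit∥≤ (λ t → at k (c t)) (λ l → at k (f l)) D a e M i 3≤e (<⇒≤ 0<D) c≤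
        λ l l≤i → close l (ℕ.s≤s l≤i))
      (≤-reflexive total))
    (ev-all (suc i) {λ l k → Close l M k} close)
    (ev-all M {λ s k → ∥ at k (c (suc s)) ∥ ≤ D * ι (suc s)} λ s _ → c≤ s)

∥hankel∥≤ : ∀ (c : ℕ → ℂ) D → 0ℚ < D →
  (∀ s → Eventually λ k → ∥ at k (c (suc s)) ∥ ≤ D * ι (suc s)) →
  (f : ℕ → ℂ) → (∀ m → 2 ℕ.≤ m → IsDirichletSum c m (f m)) →
  ∀ a b → 1 ℕ.≤ a → 1 ℕ.≤ b → ∀ n → Eventually λ k →
    ∥ at k (hankel a b f n) ∥ ≤ hankelBound n a (3ℚ * D)
∥hankel∥≤ c D 0<D c≤ f sums a b 1≤a 1≤b n =
  ev-map bound (ev-all n {λ i k → ∀ j → j ℕ.< n → Entry i j k} λ i _ →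
    ev-all n {λ j k → Entry i j k} λ j _ → entry i j)
  where
  β : ℕ → ℚ
  β i = 3ℚ * D * ∏ (node a) i
  0≤β : ∀ i → 0ℚ ≤ β i
  0≤β i = 0≤* (0≤* (nonNegative⁻¹ 3ℚ) (<⇒≤ 0<D)) (0≤∏ (0≤node a) i)

  Entry : ℕ → ℕ → ℕ → Set
  Entry i j k = ∥ newton (λ l → at k (f (a ℕ.* (suc l ℕ.+ suc j) ℕ.+ b))) (negNodes a) i ∥ ≤ β i

  entry : ∀ i j → Eventually (Entry i j)
  entry i j = ∥newton-dirichlet∥≤ c D 0<D c≤ a e 3≤e (λ l → f (a ℕ.* (suc l ℕ.+ suc j) ℕ.+ b))
    (λ l → subst (λ m → IsDirichletSum c m (f (a ℕ.* (suc l ℕ.+ suc j) ℕ.+ b))) (index l)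
      (sums (a ℕ.* (suc l ℕ.+ suc j) ℕ.+ b) (subst (2 ℕ.≤_) (sym (index l))
        (ℕ.≤-trans (ℕ.n≤1+n 2) (ℕ.≤-trans 3≤e (ℕ.m≤m+n e (a ℕ.* l)))))))
    i
    where
    -- The exponent in the top row of zero-based column j; each row further down adds a.
    e = a ℕ.* (1 ℕ.+ suc j) ℕ.+ b
    3≤e : 3 ℕ.≤ e
    3≤e = ℕ.+-mono-≤ (ℕ.*-mono-≤ 1≤a (ℕ.s≤s (ℕ.s≤s (ℕ.z≤n {j})))) 1≤b
    index : ∀ l → a ℕ.* (suc l ℕ.+ suc j) ℕ.+ b ≡ e ℕ.+ a ℕ.* l
    index l = solveℕ 4 (λ a b l j → a ⊗ (conℕ 1 ⊕ l ⊕ (conℕ 1 ⊕ j)) ⊕ b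
      ⊜ a ⊗ (conℕ 1 ⊕ (conℕ 1 ⊕ j)) ⊕ b ⊕ a ⊗ l) refl a b l j

  bound : ∀ {k} → (∀ i → i ℕ.< n → ∀ j → j ℕ.< n → Entry i j k) →
    ∥ at k (hankel a b f n) ∥ ≤ ι (n ℕ.!) * ∏ β n
  bound {k} h = subst (λ z → ∥ z ∥ ≤ ι (n ℕ.!) * ∏ β n)
    (trans (detRows-newton n B (negNodes a))
      (sym (at-det n k (λ i j → f (a ℕ.* (suc (toℕ i) ℕ.+ suc (toℕ j)) ℕ.+ b)) B λ _ _ → refl)))
    (∥detRows∥≤ n (λ i j → newton (λ l → B l j) (negNodes a) i) β 0≤β λ i i<n j → h i i<n (toℕ j) (toℕ<n j))
    where
    B : ℕ → Fin n → ℚ[i]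
    B i j = at k (f (a ℕ.* (suc i ℕ.+ suc (toℕ j)) ℕ.+ b))

-- Upper bounds for exponentials of rationals.

eventually-0≤base : ∀ p → Eventually λ k → 0ℚ ≤ base k p
eventually-0≤base p = ev-map
  (λ {k} small → ≤-trans (gap small)
    (+-monoʳ-≤ 1ℚ (≤-trans (≤-reflexive (solve 2 (λ a s → :- (a :* s) := (:- a) :* s) refl (∣ p ∣) (½ ^ k)))
      (*-monoʳ (½ ^ k) (0≤½^ k) (proj₁ (abs-range {p} ≤-refl))))))
  (shrink½ (∣ p ∣) 1ℚ (0≤∣p∣ p) 0<1)

-- A rational form of eᵖ ≤ q.
record Exp≤ (p q : ℚ) : Set where
  constructor exp≤
  field
    eventually : Eventually λ k → expApprox k p ≤ q

Exp≤-trans : ∀ {p q r} → Exp≤ p q → q ≤ r → Exp≤ p r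
Exp≤-trans (exp≤ h) q≤r = exp≤ (ev-map (λ h → ≤-trans h q≤r) h)

Exp≤-intro : ∀ {p x q} → exp (fromℚ p) <ʳ x → (Eventually λ k → seq x k ≤ q) → Exp≤ p q
Exp≤-intro (ε , 0<ε , h) x≤q = exp≤
  (ev-map₂ (λ e x≤ → ≤-trans (≤-from ε (<⇒≤ 0<ε) refl) (≤-trans e x≤)) h x≤q)

-- The product of the bases for p and p′ is 1 + (p + p′ + p p′/2ᵏ)/2ᵏ; the loss η covers the cross
-- term, which tends to 0.
Exp≤-+ : ∀ {p p′ q q′ η} → 0ℚ < η → 0ℚ ≤ q → Exp≤ p q → Exp≤ p′ q′ → Exp≤ (p + p′ - η) (q * q′)
Exp≤-+ {p} {p′} {q} {q′} {η} 0<η 0≤q (exp≤ h) (exp≤ h′) = exp≤ (ev-map₂ (λ {k} → step {k})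
  (ev-map₂ _,_ h h′)
  (ev-map₂ _,_ (ev-map₂ _,_ (eventually-0≤base p) (eventually-0≤base p′))
    (ev-map₂ _,_ (eventually-0≤base (p + p′ - η)) (shrink½ (∣ p * p′ ∣) η (0≤∣p∣ (p * p′)) 0<η))))
  where
  step : ∀ {k} → expApprox k p ≤ q × expApprox k p′ ≤ q′ →
    (0ℚ ≤ base k p × 0ℚ ≤ base k p′) × (0ℚ ≤ base k (p + p′ - η) × ∣ p * p′ ∣ * ½ ^ k ≤ η) →
    expApprox k (p + p′ - η) ≤ q * q′
  step {k} (e≤ , e′≤) ((0≤b , 0≤b′) , (0≤d , small)) = begin
    expApprox k (p + p′ - η)          ≤⟨ ^-mono (2 ℕ.^ k) 0≤d d≤ ⟩
    (base k p * base k p′) ^ (2 ℕ.^ k) ≡⟨ ^-distrib-* (base k p) (base k p′) (2 ℕ.^ k) ⟩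
    expApprox k p * expApprox k p′    ≤⟨ *-mono 0≤q (0≤^ (2 ℕ.^ k) 0≤b′) e≤ e′≤ ⟩
    q * q′                            ∎
    where
    open ≤-Reasoning
    s = ½ ^ k
    d≤ : base k (p + p′ - η) ≤ base k p * base k p′
    d≤ = ≤-from (((η - ∣ p * p′ ∣ * s) + (p * p′ - - ∣ p * p′ ∣) * s) * s)
      (0≤* (0≤+ (gap small) (0≤* (gap (proj₁ (abs-range {p * p′} ≤-refl))) (0≤½^ k))) (0≤½^ k))
      (solve 5 (λ p q η s a →
        (con 1ℚ :+ (p :+ q :- η) :* s) :+ ((η :- a :* s) :+ (p :* q :- (:- a)) :* s) :* s
        := (con 1ℚ :+ p :* s) :* (con 1ℚ :+ q :* s)) refl p p′ η s (∣ p * p′ ∣))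

bernoulli : ∀ m x → 0ℚ ≤ 1ℚ + x → 1ℚ + ι m * x ≤ (1ℚ + x) ^ m
bernoulli zero    x h = ≤-reflexive (solve 1 (λ x → con 1ℚ :+ con 0ℚ :* x := con 1ℚ) refl x)
bernoulli (suc m) x h = ≤-trans
  (≤-from (ι m * (x * x)) (0≤* (0≤ι m) (0≤² x))
    (solve 2 (λ m x → con 1ℚ :+ (con 1ℚ :+ m) :* x :+ m :* (x :* x)
      := (con 1ℚ :+ x) :* (con 1ℚ :+ m :* x)) refl (ι m) x))
  (*-monoˡ (1ℚ + x) h (bernoulli m x h))

^-comm : ∀ p m n → (p ^ m) ^ n ≡ (p ^ n) ^ m
^-comm p m n = trans (^-assocʳ p m n) (trans (cong (p ^_) (ℕ.*-comm m n)) (sym (^-assocʳ p n m)))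

-- Bernoulli's inequality compares the bases directly, so multiples cost no η.
Exp≤-* : ∀ m {p q} → Exp≤ p q → Exp≤ (ι m * p) (q ^ m)
Exp≤-* m {p} {q} (exp≤ h) = exp≤ (ev-map₂ (λ {k} → step {k}) h
  (ev-map₂ _,_ (eventually-0≤base p) (eventually-0≤base (ι m * p))))
  where
  step : ∀ {k} → expApprox k p ≤ q → 0ℚ ≤ base k p × 0ℚ ≤ base k (ι m * p) →
    expApprox k (ι m * p) ≤ q ^ m
  step {k} e≤ (0≤b , 0≤b′) = begin
    base k (ι m * p) ^ (2 ℕ.^ k)
      ≤⟨ ^-mono (2 ℕ.^ k) 0≤b′ (≤-trans
           (≤-reflexive (cong (1ℚ +_) (*-assoc (ι m) p (½ ^ k)))) (bernoulli m (p * ½ ^ k) 0≤b)) ⟩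
    (base k p ^ m) ^ (2 ℕ.^ k)   ≡⟨ ^-comm (base k p) m (2 ℕ.^ k) ⟩
    expApprox k p ^ m            ≤⟨ ^-mono m (0≤^ (2 ℕ.^ k) 0≤b) e≤ ⟩
    q ^ m                        ∎
    where open ≤-Reasoning

-- The approximants at g and -g multiply to at most 1, and the one at g is at least 1 + g.
Exp≤-neg : ∀ {g q} → 0ℚ ≤ g → 0ℚ ≤ q → q * (1ℚ + g) ≡ 1ℚ → Exp≤ (- g) q
Exp≤-neg {g} {q} 0≤g 0≤q q[1+g]≡1 =
  exp≤ (ev-map₂ (λ {k} → step {k}) (eventually-0≤base g) (eventually-0≤base (- g)))
  where
  step : ∀ {k} → 0ℚ ≤ base k g → 0ℚ ≤ base k (- g) → expApprox k (- g) ≤ q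
  step {k} 0≤b 0≤b′ = begin
    x                  ≡⟨ *-identityʳ x ⟨
    x * 1ℚ             ≡⟨ cong (x *_) q[1+g]≡1 ⟨
    x * (q * (1ℚ + g)) ≡⟨ solve 3 (λ x q y → x :* (q :* y) := q :* (y :* x)) refl x q (1ℚ + g) ⟩
    q * ((1ℚ + g) * x) ≤⟨ *-monoˡ q 0≤q (≤-trans
                            (*-monoʳ x (0≤^ (2 ℕ.^ k) 0≤b′) (1+p≤expApprox k g (0≤+ (<⇒≤ 0<1) 0≤g)))
                            (expApprox-neg≤1 k g 0≤b 0≤b′)) ⟩
    q * 1ℚ             ≡⟨ *-identityʳ q ⟩
    q                  ∎
    where
    open ≤-Reasoning
    x = expApprox k (- g)

Exp≤1⇒≤0 : ∀ {p} → Exp≤ p 1ℚ → p ≤ 0ℚ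
Exp≤1⇒≤0 {p} (exp≤ (N , h)) with ≤-total 0ℚ p
... | inj₂ p≤0 = p≤0
... | inj₁ 0≤p = ≤-trans (≤-reflexive (solve 1 (λ p → p := con 1ℚ :+ p :- con 1ℚ) refl p))
  (≤-trans (+-monoˡ-≤ (- 1ℚ) (≤-trans (1+p≤expApprox N p (0≤+ (<⇒≤ 0<1) 0≤p)) (h N ℕ.≤-refl)))
    (≤-reflexive (+-inverseʳ 1ℚ)))

≤-limit : ∀ {p q} → (∀ η → 0ℚ < η → p ≤ q + η) → p ≤ q
≤-limit {p} {q} h = ≮⇒≥ λ q<p → <-irrefl refl (<-≤-trans
  (<-from (½ * (p - q)) (half (p - q) (gap< q<p))
    (solve 2 (λ p q → q :+ con ½ :* (p :- q) :+ con ½ :* (p :- q) := p) refl p q))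
  (h (½ * (p - q)) (half (p - q) (gap< q<p))))

-- The sharp conclusion has log g in place of the larger g, which suffices
-- because the constant K is arbitrary.
log-combination : ∀ {u l B X g} m M → 0ℚ ≤ B → 0ℚ ≤ X → 0ℚ ≤ g →
  Exp≤ u B → Exp≤ l X → B * B * X ^ m ≤ g ^ M → 2ℚ * u + ι m * l ≤ g * ι M
log-combination {u} {l} {B} {X} {g} m M 0≤B 0≤X 0≤g u≤ l≤ bound = ≤-limit λ η 0<η →
  -- One half of η for each of the two additions of exponents.
  let 0<½η = half η 0<η
  in ≤-trans
    (≤-reflexive (solve 6 (λ u l m g M η → con 2ℚ :* u :+ m :* l
        := (con 2ℚ :* u :+ m :* l :- con ½ :* η :+ M :* (:- g) :- con ½ :* η) :+ (g :* M :+ η))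
        refl u l (ι m) g (ι M) η))
    (≤-trans (+-monoˡ-≤ (g * ι M + η) (Exp≤1⇒≤0 (Exp≤-trans
        (Exp≤-+ 0<½η (0≤* (0≤* 0≤B 0≤B) (0≤^ m 0≤X))
          (Exp≤-+ 0<½η (0≤* 0≤B 0≤B) two (Exp≤-* m l≤))
          (Exp≤-* M (Exp≤-neg 0≤g (<⇒≤ 0<q) q[1+g]≡1)))
        ≤1)))
      (≤-reflexive (+-identityˡ (g * ι M + η))))
  where
  -- q = 1/(1+g) bounds e^(-g) from above and satisfies g q ≤ 1. Hence B² X^m q^M ≤ (g q)^M ≤ 1,
  -- which makes the combined exponent non-positive.
  Q = quotient 1ℚ (1ℚ + g) 0<1 (0<+ 0<1 0≤g)
  q = proj₁ Q
  0<q : 0ℚ < q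
  0<q = proj₁ (proj₂ Q)
  q[1+g]≡1 : q * (1ℚ + g) ≡ 1ℚ
  q[1+g]≡1 = proj₂ (proj₂ Q)
  two : Exp≤ (2ℚ * u) (B * B)
  two = Exp≤-trans (Exp≤-* 2 u≤) (≤-reflexive (cong (B *_) (*-identityʳ B)))
  gq≤1 : g * q ≤ 1ℚ
  gq≤1 = ≤-from q (<⇒≤ 0<q) (trans (solve 2 (λ g q → g :* q :+ q := q :* (con 1ℚ :+ g)) refl g q) q[1+g]≡1)
  ≤1 : B * B * X ^ m * q ^ M ≤ 1ℚ
  ≤1 = ≤-trans (*-monoʳ (q ^ M) (0≤^ M (<⇒≤ 0<q)) bound)
    (≤-trans (≤-reflexive (sym (^-distrib-* g q M))) (^-≤1 M (0≤* 0≤g (<⇒≤ 0<q)) gq≤1))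

-- Real powers and the growth of the coefficients.

exp-mono-≤ʳ : ∀ {x y} → x ≤ʳ y → exp x ≤ʳ exp y
exp-mono-≤ʳ {x} {y} x≤y ε 0<ε =
  ev-map₂ (λ {k} → step {k}) (ev-map₂ _,_ (x≤y η 0<η) (k₀ , λ _ k₀≤k → k₀≤k))
    (ev-map₂ _,_ (proj₂ (proj₂ (bounded x))) (proj₂ (proj₂ (bounded y))))
  where
  open ≤-Reasoning
  A = proj₁ (bounded x)
  A′ = proj₁ (bounded y)
  0≤A : 0ℚ ≤ A
  0≤A = ≤-trans (<⇒≤ 0<1) (proj₁ (proj₂ (bounded x)))
  0≤A′ : 0ℚ ≤ A′
  0≤A′ = ≤-trans (<⇒≤ 0<1) (proj₁ (proj₂ (bounded y)))
  B = 1ℚ + (A + A′)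
  k₀ = proj₁ (expBoundIndex B)
  open ExpBounds B (≤-from (A + A′) (0≤+ 0≤A 0≤A′) refl) k₀ (proj₂ (expBoundIndex B))
  Q = quotient ε (M + 1ℚ) 0<ε (+-mono-≤-< 0≤M 0<1)
  L = lesser (proj₁ Q) (proj₁ (proj₂ Q))
  η = proj₁ L
  0<η : 0ℚ < η
  0<η = proj₁ (proj₂ L)
  η≤1 : η ≤ 1ℚ
  η≤1 = proj₁ (proj₂ (proj₂ L))
  ηM≤ε : η * M ≤ ε
  ηM≤ε = subst (η * M ≤_) (proj₂ (proj₂ Q))
    (*-mono (<⇒≤ (proj₁ (proj₂ Q))) 0≤M (proj₂ (proj₂ (proj₂ L))) (≤-from 1ℚ (<⇒≤ 0<1) refl))
  A≤B : A ≤ B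
  A≤B = ≤-from (1ℚ + A′) (0≤+ (<⇒≤ 0<1) 0≤A′)
    (solve 2 (λ a b → a :+ (con 1ℚ :+ b) := con 1ℚ :+ (a :+ b)) refl A A′)
  A′+1≤B : A′ + 1ℚ ≤ B
  A′+1≤B = ≤-from A 0≤A (solve 2 (λ a b → b :+ con 1ℚ :+ a := con 1ℚ :+ (a :+ b)) refl A A′)

  step : ∀ {k} → seq x k ≤ seq y k + η × k₀ ℕ.≤ k → ∣ seq x k ∣ ≤ A × ∣ seq y k ∣ ≤ A′ →
    expApprox k (seq x k) ≤ expApprox k (seq y k) + ε
  step {k} (p≤q+η , k₀≤k) (∣p∣≤A , ∣q∣≤A′) = begin
    expApprox k p
      ≤⟨ exp-mono k₀≤k -B≤p p≤q+η ⟩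
    expApprox k (q + η)
      ≤⟨ exp-lipschitz k₀≤k -B≤q (≤-from η (<⇒≤ 0<η) refl)
           (≤-trans (+-mono-≤ (proj₂ (abs-range ∣q∣≤A′)) η≤1) A′+1≤B) ⟩
    expApprox k q + (q + η - q) * M
      ≡⟨ cong (λ d → expApprox k q + d * M) (solve 2 (λ q η → q :+ η :- q := η) refl q η) ⟩
    expApprox k q + η * M
      ≤⟨ +-monoʳ-≤ (expApprox k q) ηM≤ε ⟩
    expApprox k q + ε ∎
    where
    p = seq x k
    q = seq y k
    -B≤p : - B ≤ p
    -B≤p = ≤-trans (neg-antimono-≤ A≤B) (proj₁ (abs-range ∣p∣≤A))
    -B≤q : - B ≤ q
    -B≤q = ≤-trans (neg-antimono-≤ (≤-trans (≤-from 1ℚ (<⇒≤ 0<1) refl) A′+1≤B)) (proj₁ (abs-range ∣q∣≤A′))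

-- An upper bracket end h < 0 would give x < exp h ≤ 1. So the upper ends are non-negative, and the
-- lower ends trail them by the width.
log-nonNeg : ∀ x (0<x : 0ʳ <ʳ x) → 1ʳ ≤ʳ x → 0ʳ ≤ʳ log x 0<x
log-nonNeg x 0<x 1≤x ε 0<ε = proj₁ narrow , λ k J≤k →
  ≤-trans (hi-nonNeg (Log.hi bJ) (Log.below bJ))
    (≤-trans (≤-from (ε - (Log.hi bJ - Log.lo bJ)) (gap (proj₂ narrow))
        (solve 3 (λ h l ε → h :+ (ε :- (h :- l)) := l :+ ε) refl (Log.hi bJ) (Log.lo bJ) ε))
      (+-monoˡ-≤ ε (Log.lo-≤ x b₀ J≤k)))
  where
  b₀ = logBracket x 0<x
  narrow = Log.brackets-narrow x b₀ ε 0<ε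
  bJ = Log.brackets x b₀ (proj₁ narrow)

  hi-nonNeg : ∀ h → x <ʳ exp (fromℚ h) → 0ℚ ≤ h
  hi-nonNeg h (ε , 0<ε , x+ε≤) = ≮⇒≥ λ h<0 →
    let N , holds = ev-map₂ _,_ (ev-map₂ _,_ x+ε≤ (1≤x (½ * ε) (half ε 0<ε))) (eventually-0≤base h)
    in absurd h<0 N (holds N ℕ.≤-refl)
    where
    absurd : h < 0ℚ → ∀ k → (seq x k + ε ≤ expApprox k h × 1ℚ ≤ seq x k + ½ * ε) × 0ℚ ≤ base k h → ⊥
    absurd h<0 k ((x+ε≤ , 1≤x+) , 0≤b) = <-irrefl refl (begin-strict
      1ℚ                       <⟨ <-from (½ * ε) (half ε 0<ε) refl ⟩
      1ℚ + ½ * ε               ≤⟨ +-monoˡ-≤ (½ * ε) 1≤x+ ⟩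
      seq x k + ½ * ε + ½ * ε  ≡⟨ solve 2 (λ x ε → x :+ con ½ :* ε :+ con ½ :* ε := x :+ ε) refl (seq x k) ε ⟩
      seq x k + ε              ≤⟨ x+ε≤ ⟩
      expApprox k h            ≤⟨ ^-≤1 (2 ℕ.^ k) 0≤b base≤1 ⟩
      1ℚ                       ∎)
      where
      open ≤-Reasoning
      base≤1 : base k h ≤ 1ℚ
      base≤1 = ≤-from ((0ℚ - h) * ½ ^ k) (0≤* (gap (<⇒≤ h<0)) (0≤½^ k))
        (solve 2 (λ h s → con 1ℚ :+ h :* s :+ (con 0ℚ :- h) :* s := con 1ℚ) refl h (½ ^ k))

shrink-*ʳ : ∀ δ x → 0ʳ <ʳ δ → 0ʳ ≤ʳ x → (1ʳ -ʳ δ) *ʳ x ≤ʳ x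
shrink-*ʳ δ x (ε₀ , 0<ε₀ , ε₀≤δ) 0≤x ε 0<ε = ev-map₂ (λ {k} → step {k})
  (ev-map₂ _,_ ε₀≤δ (proj₂ (proj₂ (bounded δ)))) (0≤x η 0<η)
  where
  A = proj₁ (bounded δ)
  Q = quotient ε A 0<ε (<-≤-trans 0<1 (proj₁ (proj₂ (bounded δ))))
  η = proj₁ Q
  0<η : 0ℚ < η
  0<η = proj₁ (proj₂ Q)
  step : ∀ {k} → 0ℚ + ε₀ ≤ seq δ k × ∣ seq δ k ∣ ≤ A → 0ℚ ≤ seq x k + η →
    (1ℚ + - seq δ k) * seq x k ≤ seq x k + ε
  step {k} (ε₀≤d , d≤A) 0≤y+η = subst (λ e → (1ℚ + - d) * y ≤ y + e) (proj₂ (proj₂ Q))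
    (≤-from (d * (y + η) + η * (A - d))
      (0≤+ (0≤* 0≤d 0≤y+η) (0≤* (<⇒≤ 0<η) (gap (proj₂ (abs-range d≤A)))))
      (solve 4 (λ d y η A → (con 1ℚ :+ (:- d)) :* y :+ (d :* (y :+ η) :+ η :* (A :- d)) := y :+ η :* A)
        refl d y η A))
    where
    d = seq δ k
    y = seq x k
    0≤d : 0ℚ ≤ d
    0≤d = ≤-trans (<⇒≤ 0<ε₀) (≤-trans (≤-reflexive (sym (+-identityˡ ε₀))) ε₀≤d)

1≤ι-suc : ∀ s → 1ℚ ≤ ι (suc s)
1≤ι-suc s = ≤-from (ι s) (0≤ι s) refl

1≤fromℕ-suc : ∀ s → 1ʳ ≤ʳ fromℕ (suc s)
1≤fromℕ-suc s ε 0<ε = 0 , λ _ _ → ≤-trans (subst (1ℚ ≤_) (ι≡/1 (suc s)) (1≤ι-suc s))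
  (≤-from ε (<⇒≤ 0<ε) refl)

-- Since log n ≥ 0, (1 - δ) log n is at most log n, whose exponential is n. The added 1 is two
-- tolerances of ½, one for the monotonicity of `exp` and one for `exp-log`.
^ʳ-≤ : ∀ δ → 0ʳ <ʳ δ → ∀ s → Eventually λ k → seq (suc s ^ʳ (1ʳ -ʳ δ)) k ≤ ι (suc s) + 1ℚ
^ʳ-≤ δ 0<δ s = ev-map₂ (λ {k} e≤ l≈ → ≤-trans e≤
    (≤-trans (+-monoˡ-≤ ½ (abs-lower {seq (exp L) k} {ℤ.+ suc s / 1} l≈))
      (≤-reflexive (trans (cong (λ n → n + ½ + ½) (sym (ι≡/1 (suc s))))
        (solve 1 (λ n → n :+ con ½ :+ con ½ := n :+ con 1ℚ) refl (ι (suc s)))))))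
  (exp-mono-≤ʳ {(1ʳ -ʳ δ) *ʳ L} {L} (shrink-*ʳ δ L 0<δ
    (log-nonNeg (fromℕ (suc s)) (fromℕ-positive (suc s)) (1≤fromℕ-suc s))) ½ 0<½)
  (exp-log (fromℕ (suc s)) (fromℕ-positive (suc s)) ½ 0<½)
  where
  L = logℕ (suc s)

coefficients≤ : ∀ δ → 0ʳ <ʳ δ → ∀ c → c ≪n^ (1ʳ -ʳ δ) → ∃ λ D → 1ℚ ≤ D ×
  (∀ s → Eventually λ k → ∥ at k (c (suc s)) ∥ ≤ D * ι (suc s))
-- With A ≥ 1 bounding C, A(n+1) + 1 ≤ 3 A n; the factor 2 is the passage from the modulus to the
-- norm.
coefficients≤ δ 0<δ c (C , (ε₀ , 0<ε₀ , ε₀≤C) , c≤) = 2ℚ * (3ℚ * A) , 1≤D , λ s →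
  ev-map (λ h → ≤-trans h (≤-reflexive (sym (*-assoc 2ℚ (3ℚ * A) (ι (suc s))))))
    (∣∣ᶜ≤⇒∥∥≤ (c (suc s)) (0<* (0<* (positive⁻¹ 3ℚ) 0<A) (<-≤-trans 0<1 (1≤ι-suc s)))
      (ev-map₂ (λ {k} → step {s} {k}) (ev-map₂ _,_ ε₀≤C (proj₂ (proj₂ (bounded C))))
        (ev-map₂ _,_ (^ʳ-≤ δ 0<δ s) (c≤ (suc s) 1ℚ 0<1))))
  where
  A = proj₁ (bounded C)
  1≤A : 1ℚ ≤ A
  1≤A = proj₁ (proj₂ (bounded C))
  0<A : 0ℚ < A
  0<A = <-≤-trans 0<1 1≤A
  1≤D : 1ℚ ≤ 2ℚ * (3ℚ * A)
  1≤D = ≤-trans 1≤A (≤-from (ℤ.+ 5 / 1 * A) (0≤* (nonNegative⁻¹ (ℤ.+ 5 / 1)) (<⇒≤ 0<A))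
    (solve 1 (λ A → A :+ con (ℤ.+ 5 / 1) :* A := con 2ℚ :* (con 3ℚ :* A)) refl A))
  step : ∀ {s k} → 0ℚ + ε₀ ≤ seq C k × ∣ seq C k ∣ ≤ A →
    seq (suc s ^ʳ (1ʳ -ʳ δ)) k ≤ ι (suc s) + 1ℚ ×
      seq ∣ c (suc s) ∣ᶜ k ≤ seq C k * seq (suc s ^ʳ (1ʳ -ʳ δ)) k + 1ℚ →
    seq ∣ c (suc s) ∣ᶜ k ≤ 3ℚ * A * ι (suc s)
  step {s} {k} (ε₀≤ , C≤A) (e≤ , c≤) = begin
    seq ∣ c (suc s) ∣ᶜ k    ≤⟨ c≤ ⟩
    seq C k * seq (suc s ^ʳ (1ʳ -ʳ δ)) k + 1ℚ
      ≤⟨ +-monoˡ-≤ 1ℚ (≤-trans (*-monoˡ (seq C k) 0≤C e≤)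
           (*-monoʳ (n + 1ℚ) (0≤+ (0≤ι (suc s)) (<⇒≤ 0<1)) (proj₂ (abs-range C≤A)))) ⟩
    A * (n + 1ℚ) + 1ℚ
      ≤⟨ ≤-from (2ℚ * (A * (n - 1ℚ)) + (A - 1ℚ))
           (0≤+ (0≤* (nonNegative⁻¹ 2ℚ) (0≤* (<⇒≤ 0<A) (gap (1≤ι-suc s)))) (gap 1≤A))
           (solve 2 (λ A n → A :* (n :+ con 1ℚ) :+ con 1ℚ :+ (con 2ℚ :* (A :* (n :- con 1ℚ)) :+ (A :- con 1ℚ))
             := con 3ℚ :* A :* n) refl A n) ⟩
    3ℚ * A * n ∎
    where
    open ≤-Reasoning
    n = ι (suc s)
    0≤C : 0ℚ ≤ seq C k
    0≤C = ≤-trans (<⇒≤ 0<ε₀) (≤-trans (≤-reflexive (sym (+-identityˡ ε₀))) ε₀≤)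

-- Passage to logarithms.

/2≡ : ∀ a → ℤ.+ a / 2 ≡ ½ * ι a
/2≡ a = trans (toℚᵘ-injective
  (ℚᵘ.≃-trans (toℚᵘ-fromℚᵘ (mkℚᵘ (ℤ.+ a) 1))
  (ℚᵘ.≃-trans (ℚᵘ.*≡* (trans (cong (λ m → ℤ.+ a ℤ.* m) (ℤ.pos-* 2 1))
      (cong (ℤ._* ℤ.+ 2) (sym (ℤ.*-identityˡ (ℤ.+ a))))))
  (ℚᵘ.≃-trans (ℚᵘ.≃-sym (ℚᵘ.*-congˡ {toℚᵘ ½} (toℚᵘ-fromℚᵘ (mkℚᵘ (ℤ.+ a) 0))))
    (ℚᵘ.≃-sym (toℚᵘ-homo-* ½ (ℤ.+ a / 1)))))))
  (cong (½ *_) (sym (ι≡/1 a)))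

-- Both logarithms are approximated by lower bracket ends u and l, with e^u below the modulus of z
-- and e^l below n. This is the right direction for both, as the claim bounds 2u + a n² l from
-- above, so the inequality already holds at every index.
log-bound : ∀ z (n : ℕ) .{{_ : ℕ.NonZero n}} a B g → 0ℚ < B → 0ℚ ≤ g →
  (Eventually λ k → ∥ at k z ∥ ≤ B) →
  2ℚ * B * (2ℚ * B) * ι n ^ (a ℕ.* (n ℕ.* n)) ≤ g ^ (n ℕ.* n) →
  log∣ z ∣≤ ((-ʳ (fromℚ (ℤ.+ a / 2) *ʳ (fromℕ n *ʳ fromℕ n) *ʳ logℕ n))
    +ʳ fromℚ (½ * g) *ʳ (fromℕ n *ʳ fromℕ n))
log-bound z n a B g 0<B 0≤g z≤B bound z≢0 ε 0<ε = 0 , λ k _ →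
  ≤-trans (pointwise (Log.lo (zBracket k)) (Log.lo (nBracket k))
      (log-combination {Log.lo (zBracket k)} {Log.lo (nBracket k)} {2ℚ * B} {ι n} {g}
        (a ℕ.* (n ℕ.* n)) (n ℕ.* n)
        (0≤* (nonNegative⁻¹ 2ℚ) (<⇒≤ 0<B)) (0≤ι n) 0≤g
        (Exp≤-intro {x = ∣ z ∣ᶜ} {2ℚ * B} (Log.above (zBracket k)) (∥∥≤⇒∣∣ᶜ≤ z 0<B z≤B))
        (Exp≤-intro {x = fromℕ n} {ι n} (Log.above (nBracket k)) (0 , λ _ _ → ≤-reflexive (sym (ι≡/1 n))))
        bound))
    (≤-from ε (<⇒≤ 0<ε) refl)
  where
  zBracket : ℕ → Log.Bracket ∣ z ∣ᶜ
  zBracket = Log.brackets ∣ z ∣ᶜ (logBracket ∣ z ∣ᶜ z≢0)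
  nBracket : ℕ → Log.Bracket (fromℕ n)
  nBracket = Log.brackets (fromℕ n) (logBracket (fromℕ n) (fromℕ-positive n))
  n/1 : ℚ
  n/1 = ℤ.+ n / 1
  pointwise : ∀ u l → 2ℚ * u + ι (a ℕ.* (n ℕ.* n)) * l ≤ g * ι (n ℕ.* n) →
    u ≤ - (ℤ.+ a / 2 * (n/1 * n/1) * l) + ½ * g * (n/1 * n/1)
  pointwise u l h = subst₂ (λ h n → u ≤ - (h * (n * n) * l) + ½ * g * (n * n))
    (sym (/2≡ a)) (ι≡/1 n)
    (≤-from (½ * (g * (m * m) - (2ℚ * u + ι a * (m * m) * l)))
      (0≤* (<⇒≤ 0<½) (gap (subst₂ (λ p q → 2ℚ * u + p * l ≤ g * q)
        (trans (ι-* a (n ℕ.* n)) (cong (ι a *_) (ι-* n n))) (ι-* n n) h)))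
      (solve 5 (λ u g n a l → u :+ con ½ :* (g :* (n :* n) :- (con 2ℚ :* u :+ a :* (n :* n) :* l))
        := (:- (con ½ :* a :* (n :* n) :* l)) :+ con ½ :* g :* (n :* n)) refl u g m (ι a) l))
    where m = ι n

log-hankel≤ : ∀ (c : ℕ → ℂ) D → 1ℚ ≤ D →
  (∀ s → Eventually λ k → ∥ at k (c (suc s)) ∥ ≤ D * ι (suc s)) →
  (f : ℕ → ℂ) → (∀ m → 2 ℕ.≤ m → IsDirichletSum c m (f m)) →
  ∀ a b → 1 ℕ.≤ a → 1 ℕ.≤ b → (n : ℕ) .{{_ : ℕ.NonZero n}} →
  log∣ hankel a b f n ∣≤
    ((-ʳ (fromℚ (ℤ.+ a / 2) *ʳ (fromℕ n *ʳ fromℕ n) *ʳ logℕ n))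
      +ʳ fromℚ (½ * growth a (3ℚ * D)) *ʳ (fromℕ n *ʳ fromℕ n))
log-hankel≤ c D 1≤D c≤ f sums a b 1≤a 1≤b n =
  log-bound (hankel a b f n) n a (hankelBound n a (3ℚ * D)) (growth a (3ℚ * D))
    (0<hankelBound n a (<-≤-trans 0<1 1≤3D)) (0≤growth a (3ℚ * D))
    (∥hankel∥≤ c D 0<D c≤ f sums a b 1≤a 1≤b n)
    (hankelBound²≤ n a (3ℚ * D) 1≤3D (ℕ.>-nonZero⁻¹ n))
  where
  0<D : 0ℚ < D
  0<D = <-≤-trans 0<1 1≤D
  1≤3D : 1ℚ ≤ 3ℚ * D
  1≤3D = ≤-trans 1≤D (≤-from (2ℚ * D) (0≤* (nonNegative⁻¹ 2ℚ) (<⇒≤ 0<D))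
    (solve 1 (λ D → D :+ con 2ℚ :* D := con 3ℚ :* D) refl D))

lemma2 : (δ : ℝ) → 0ʳ <ʳ δ →
    (c : ℕ → ℂ) → c ≪n^ (1ʳ -ʳ δ) →
    (f : ℕ → ℂ) → (∀ m → 2 ℕ.≤ m → IsDirichletSum c m (f m)) →
    (a b : ℕ) → 1 ℕ.≤ a → 1 ℕ.≤ b →
    ∃ λ (K : ℝ) → ∃ λ (N : ℕ) →
    ∀ (n : ℕ) .{{_ : ℕ.NonZero n}} → N ℕ.≤ n →
    log∣ hankel a b f n ∣≤
    ((-ʳ (fromℚ (ℤ.+ a / 2) *ʳ (fromℕ n *ʳ fromℕ n) *ʳ logℕ n))
    +ʳ K *ʳ (fromℕ n *ʳ fromℕ n))
lemma2 δ 0<δ c c≪ f sums a b 1≤a 1≤b =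
  let D , 1≤D , c≤ = coefficients≤ δ 0<δ c c≪
  -- The ½ undoes the squaring; the estimate is uniform over n ≥ 1, so 1 serves as threshold.
  in fromℚ (½ * growth a (3ℚ * D)) , 1 , λ n _ → log-hankel≤ c D 1≤D c≤ f sums a b 1≤a 1≤b n
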